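{- Let $H$ be an ordered graph on $h$ vertices. Suppose that $B$ is a bottlegraph assigned to $H$. Then for every $\eta>0$, there exists an $n_0\in\mathbb N$ so that every ordered graph $G$ on $n\ge n_0$ vertices with $$\delta(G)\ge\left(1-\frac{1}{\chi_{cr}(B)}+\eta\right)n$$ contains an $H$-tiling covering all but at most $\eta n$ vertices.
   Context: An ordered graph $H$ on $h$ vertices is a graph with vertex set $[h]=\{1,\dots,h\}$ (more generally, a finite graph with a linearly ordered vertex set). An ordered graph $G$ contains a copy of $H$ if there is an order-preserving injection $\phi:[h]\to V(G)$ with $\phi(i)\phi(j)\in E(G)$ whenever $ij\in E(H)$. An $H$-tiling in $G$ is a collection of vertex-disjoint copies of $H$ in $G$; it is perfect if it covers all vertices of $G$. $\delta(G)$ denotes the minimum degree. For sets $X,Y$ of integers (or subsets of a linearly ordered set), $X<Y$ means $x<y$ for all $x\in X,y\in Y$. The critical chromatic number of an unordered graph $F$ is $\chi_{cr}(F):=(\chi(F)-1)\frac{|F|}{|F|-\sigma(F)}$, where $|F|$ is the number of vertices and $\sigma(F)$ is the size of the smallest possible colour class in any proper $\chi(F)$-colouring of $F$. Let $B$ be a complete $k$-partite unordered graph with (non-empty) parts $U_1,\dots,U_k$, where $k\ge2$, and let $\sigma$ be a permutation of $[k]$. An interval labeling of $B$ with respect to $\sigma$ is a bijection $\phi:V(B)\to[|B|]$ such that $\phi(U_i)<\phi(U_j)$ if $\sigma(i)<\sigma(j)$. For $t\in\mathbb N$, the blow-up $B(t)$ is obtained from $B$ by replacing every vertex $x$ by an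 independent set $V_x$ of $t$ vertices, and joining $u\in V_x$ to $v\in V_y$ precisely when $xy\in E(B)$. The ordered blow-up $(B(t),\phi)$ is the ordered graph obtained from $B(t)$ by equipping $V(B(t))$ with a vertex ordering satisfying $V_x<V_y$ for all $x,y\in V(B)$ with $\phi(x)<\phi(y)$. $B$ is a bottlegraph assigned to $H$ if for every permutation $\sigma$ of $[k]$ and every interval labeling $\phi$ of $B$ with respect to $\sigma$, there exists a constant $t=t(B,H,\phi)\in\mathbb N$ such that the ordered blow-up $(B(t),\phi)$ contains a perfect $H$-tiling. -}

module Defs where

open import Level using (0ℓ)
open import Data.Empty using (⊥-elim)
open import Data.Fin using (Fin; zero; suc; finToFun; funToFin; quotient)
import Data.Fin as Fin
open import Data.Fin.Permutation using (Permutation′; _⟨$⟩ʳ_; _⟨$⟩ˡ_)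
open import Data.Fin.Properties using (_≟_; 0≢1+n; any?; all?; finToFun-funToFin)
open import Data.Integer using (+_)
open import Data.List using ([]; _∷_; length; filter; map; allFin)
open import Data.List.Extrema.Nat using (min)
open import Data.List.Membership.Propositional.Properties using (∈-allFin)
open import Data.List.Properties using (filter-notAll; length-tabulate)
open import Data.List.Relation.Unary.Any using (Any)
import Data.List.Relation.Unary.Any as Any
open import Data.Nat using (ℕ; zero; suc; _*_; _∸_; _≤_; _<_; _⊔_; z≤n; s≤s; NonZero)
import Data.Nat as ℕ
import Data.Nat.Properties as ℕ
open import Data.Product using (∃; ∃₂; _×_; _,_; proj₁; proj₂)
open import Data.Rational using (ℚ; 0ℚ; ½; _/_)
import Data.Rational as ℚ
import Data.Rational.Properties as ℚ
open import Data.Rational.Solver using (module +-*-Solver)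
open import Function using (_∘_; id)
open import Function.Definitions using (Injective)
open import Relation.Binary using (Rel; Symmetric; Irreflexive) renaming (Decidable to Decidable₂)
open import Relation.Binary.PropositionalEquality
  using (_≡_; _≢_; _≗_; refl; sym; trans; cong; subst)
open import Relation.Nullary using (¬_; Dec; yes; no)
open import Relation.Nullary.Decidable using (map′; ¬?; _×-dec_; _→-dec_)
open import Relation.Unary using (Pred; Decidable)

-- Cauchy reals; two sequences denote the same real when each is ≤ᴿ the other.
record ℝ : Set where
  field
    seq    : ℕ → ℚ
    cauchy : ∀ ε → 0ℚ ℚ.< ε → ∃ λ N → ∀ m n → N ≤ m → N ≤ n →
             ℚ.∣ seq m ℚ.- seq n ∣ ℚ.≤ ε

open ℝ public

infix  4 _≤ᴿ_ _<ᴿ_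
infixl 6 _+ᴿ_
infixr 7 _·ᴿ_

_≤ᴿ_ : ℝ → ℝ → Set
x ≤ᴿ y = ∀ ε → 0ℚ ℚ.< ε → ∃ λ N → ∀ n → N ≤ n → seq x n ℚ.≤ seq y n ℚ.+ ε

_<ᴿ_ : ℝ → ℝ → Set
x <ᴿ y = ∃ λ ε → 0ℚ ℚ.< ε × ∃ λ N → ∀ n → N ≤ n → seq x n ℚ.+ ε ℚ.≤ seq y n

fromℚ : ℚ → ℝ
fromℚ q = record
  { seq    = λ _ → q
  ; cauchy = λ ε ε>0 → 0 , λ _ _ _ _ →
      subst (ℚ._≤ ε) (sym (cong ℚ.∣_∣ (ℚ.+-inverseʳ q))) (ℚ.<⇒≤ ε>0)
  }

fromℕ : ℕ → ℝ
fromℕ n = fromℚ (+ n / 1)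

_+ᴿ_ : ℝ → ℝ → ℝ
x +ᴿ y = record { seq = λ n → seq x n ℚ.+ seq y n ; cauchy = c }
  where
  interchange : ∀ a b c d → (a ℚ.+ b) ℚ.- (c ℚ.+ d) ≡ (a ℚ.- c) ℚ.+ (b ℚ.- d)
  interchange = solve 4 (λ a b c d →
    ((a :+ b) :- (c :+ d)) := ((a :- c) :+ (b :- d))) refl
    where open +-*-Solver

  halves : ∀ ε → ε ℚ.* ½ ℚ.+ ε ℚ.* ½ ≡ ε
  halves ε = trans (sym (ℚ.*-distribˡ-+ ε ½ ½)) (ℚ.*-identityʳ ε)

  c : ∀ ε → 0ℚ ℚ.< ε → ∃ λ N → ∀ m n → N ≤ m → N ≤ n →
      ℚ.∣ (seq x m ℚ.+ seq y m) ℚ.- (seq x n ℚ.+ seq y n) ∣ ℚ.≤ ε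
  c ε ε>0 with cauchy x (ε ℚ.* ½) ε/2>0 | cauchy y (ε ℚ.* ½) ε/2>0
    where
    ε/2>0 : 0ℚ ℚ.< ε ℚ.* ½
    ε/2>0 = subst (ℚ._< ε ℚ.* ½) (ℚ.*-zeroˡ ½) (ℚ.*-monoˡ-<-pos ½ ε>0)
  ... | M , p | N , q = M ⊔ N , λ m n m≥ n≥ →
    ℚ.≤-trans
      (ℚ.≤-reflexive (cong ℚ.∣_∣ (interchange (seq x m) (seq y m) (seq x n) (seq y n))))
      (ℚ.≤-trans
        (ℚ.∣p+q∣≤∣p∣+∣q∣ (seq x m ℚ.- seq x n) (seq y m ℚ.- seq y n))
        (ℚ.≤-trans
          (ℚ.+-mono-≤
            (p m n (ℕ.≤-trans (ℕ.m≤m⊔n M N) m≥) (ℕ.≤-trans (ℕ.m≤m⊔n M N) n≥))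
            (q m n (ℕ.≤-trans (ℕ.m≤n⊔m M N) m≥) (ℕ.≤-trans (ℕ.m≤n⊔m M N) n≥)))
          (ℚ.≤-reflexive (halves ε))))

_·ᴿ_ : ℕ → ℝ → ℝ
zero  ·ᴿ x = fromℚ 0ℚ
suc n ·ᴿ x = x +ᴿ n ·ᴿ x

#_ : ∀ {n} {P : Pred (Fin n) 0ℓ} → Decidable P → ℕ
# P? = length (filter P? (allFin _))

record Graph (n : ℕ) : Set₁ where
  field
    Adj        : Rel (Fin n) 0ℓ
    adj?       : Decidable₂ Adj
    adj-sym    : Symmetric Adj
    adj-irrefl : Irreflexive _≡_ Adj

-- The vertex ordering is the standard order on Fin n.
OrderedGraph : ℕ → Set₁
OrderedGraph = Graph

module _ {n : ℕ} (G : Graph n) where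
  open Graph G

  degree : Fin n → ℕ
  degree v = # adj? v

  -- Degrees are less than n, so the default value n of the minimum matters
  -- only for the empty graph.
  minDegree : ℕ
  minDegree = min n (map degree (allFin n))

  Edge : Set
  Edge = ∃₂ Adj

Least : Pred ℕ 0ℓ → Pred ℕ 0ℓ
Least P m = P m × (∀ k → P k → m ≤ k)

least : ∀ {P : Pred ℕ 0ℓ} → Decidable P → ∀ n → P n → ∃ (Least P)
least P? n pn with P? 0
least P? n       pn | yes p₀ = 0 , p₀ , λ _ _ → z≤n
least P? zero    pn | no ¬p₀ = ⊥-elim (¬p₀ pn)
least P? (suc n) pn | no ¬p₀ with least (P? ∘ suc) n pn
... | m , pm , m-least = suc m , pm , λ where
  zero    p₀ → ⊥-elim (¬p₀ p₀)
  (suc k) pk → s≤s (m-least k pk)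

module _ {n : ℕ} (F : Graph n) where
  open Graph F

  Proper : ∀ {c} → (Fin n → Fin c) → Set
  Proper f = ∀ x y → Adj x y → f x ≢ f y

  Colourable : ℕ → Set
  Colourable c = ∃ λ (f : Fin n → Fin c) → Proper f

  ClassSize : ℕ → ℕ → Set
  ClassSize c s = ∃ λ (f : Fin n → Fin c) → Proper f × ∃ λ i → # (λ v → f v ≟ i) ≡ s

  proper? : ∀ {c} (f : Fin n → Fin c) → Dec (Proper f)
  proper? f = all? λ x → all? λ y → adj? x y →-dec ¬? (f x ≟ f y)

  proper-resp : ∀ {c} {f g : Fin n → Fin c} → f ≗ g → Proper f → Proper g
  proper-resp f≗g p x y xy gx≡gy =
    p x y xy (trans (f≗g x) (trans gx≡gy (sym (f≗g y))))

  filter-resp : ∀ {c} {f g : Fin n → Fin c} (i : Fin c) → f ≗ g → ∀ vs →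
                length (filter (λ v → f v ≟ i) vs) ≡ length (filter (λ v → g v ≟ i) vs)
  filter-resp i f≗g [] = refl
  filter-resp {f = f} {g} i f≗g (v ∷ vs) rewrite f≗g v with g v ≟ i
  ... | yes _ = cong suc (filter-resp i f≗g vs)
  ... | no  _ = filter-resp i f≗g vs

  colourable? : Decidable Colourable
  colourable? c = map′
    (λ (k , p) → finToFun k , p)
    (λ (f , p) → funToFin f , proper-resp (sym ∘ finToFun-funToFin f) p)
    (any? (λ (k : Fin (c ℕ.^ n)) → proper? (finToFun k)))

  classSize? : ∀ c → Decidable (ClassSize c)
  classSize? c s = map′
    (λ (k , p , i , e) → finToFun {c} {n} k , p , i , e)
    (λ (f , p , i , e) → funToFin f , proper-resp (sym ∘ finToFun-funToFin f) p ,
       i , trans (filter-resp {c} {finToFun (funToFin f)} {f} i (finToFun-funToFin f) (allFin n)) e)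
    (any? λ (k : Fin (c ℕ.^ n)) → proper? (finToFun k) ×-dec
       any? λ i → (# λ v → finToFun {c} {n} k v ≟ i) ℕ.≟ s)

  chromatic : ∃ (Least Colourable)
  chromatic = least colourable?
    n (id , λ x y xy x≡y → adj-irrefl x≡y xy)

  χ : ℕ
  χ = proj₁ chromatic

  smallestClass : Edge F → ∃ (Least (ClassSize χ))
  smallestClass (x , _) with proj₂ chromatic
  ... | (f , p) , _ = least (classSize? χ)
    (# λ v → f v ≟ f x) (f , p , f x , refl)

  σ : Edge F → ℕ
  σ e = proj₁ (smallestClass e)

  -- A colour class does not contain both ends of an edge.
  σ<n : ∀ e → σ e < n
  σ<n e@(x , y , xy) with smallestClass e
  ... | s , (f , p , i , #≡s) , _ = subst (_< n) #≡s
    (subst ((# λ v → f v ≟ i) <_) (length-tabulate {n = n} id)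
      (filter-notAll (λ v → f v ≟ i) (allFin n) notAll))
    where
    notAll : Any (λ v → ¬ f v ≡ i) (allFin n)
    notAll with f x ≟ i
    ... | no fx≢i = Any.map (λ { refl → fx≢i }) (∈-allFin x)
    ... | yes fx≡i = Any.map
      (λ { refl fy≡i → p x y xy (trans fx≡i (sym fy≡i)) }) (∈-allFin y)

  n∸σ≢0 : ∀ e → NonZero (n ∸ σ e)
  n∸σ≢0 e = ℕ.>-nonZero (ℕ.m<n⇒0<n∸m (σ<n e))

  -- (χ - 1)|F| / (|F| - σ).  The edge rules out edgeless graphs, where this is 0/0.
  χcr : Edge F → ℚ
  χcr e = _/_ (+ ((χ ∸ 1) * n)) (n ∸ σ e) {{n∸σ≢0 e}}

  χ>1 : Edge F → 1 < χ
  χ>1 (x , y , xy) with chromatic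
  ... | 0 , (f , p) , _ with () ← f x
  ... | 1 , (f , p) , _ with f x in fx | f y in fy
  ...   | zero | zero = ⊥-elim (p x y xy (trans fx (sym fy)))
  χ>1 (x , y , xy) | suc (suc _) , _ = s≤s (s≤s z≤n)

  χcr≢0 : ∀ e → ℚ.NonZero (χcr e)
  χcr≢0 e = ℚ.pos⇒nonZero (χcr e) {{pos}}
    where
    instance
      _ = n∸σ≢0 e
      _ = ℕ.>-nonZero (ℕ.m<n⇒0<n∸m (χ>1 e))
      _ = ℕ.>-nonZero (ℕ.≤-<-trans z≤n (σ<n e))
      _ = ℕ.m*n≢0 (χ ∸ 1) n
    pos : ℚ.Positive (χcr e)
    pos = ℚ.normalize-pos ((χ ∸ 1) * n) (n ∸ σ e)

  1/χcr : Edge F → ℚ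
  1/χcr e = ℚ.1/_ (χcr e) {{χcr≢0 e}}

record Copy {h n} (H : OrderedGraph h) (G : OrderedGraph n) : Set where
  field
    embed          : Fin h → Fin n
    injective      : Injective _≡_ _≡_ embed
    preserves-<    : ∀ i j → i Fin.< j → embed i Fin.< embed j
    preserves-edge : ∀ i j → Graph.Adj H i j → Graph.Adj G (embed i) (embed j)

open Copy public

record Tiling {h n} (H : OrderedGraph h) (G : OrderedGraph n) : Set where
  field
    size     : ℕ
    copy     : Fin size → Copy H G
    disjoint : ∀ s t → s ≢ t → ∀ i j → embed (copy s) i ≢ embed (copy t) j

  Covered : Pred (Fin n) 0ℓ
  Covered v = ∃₂ λ s i → embed (copy s) i ≡ v

  covered? : Decidable Covered
  covered? v = any? λ s → any? λ i → embed (copy s) i ≟ v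

  uncovered : ℕ
  uncovered = # λ v → ¬? (covered? v)

  Perfect : Set
  Perfect = ∀ v → Covered v

open Tiling public

-- The graph on Fin b with parts Uᵢ = part⁻¹(i).
record CompletePartite (k b : ℕ) : Set where
  field
    2≤k      : 2 ≤ k
    part     : Fin b → Fin k
    nonEmpty : ∀ i → ∃ λ x → part x ≡ i

  graph : Graph b
  graph = record
    { Adj        = λ x y → part x ≢ part y
    ; adj?       = λ x y → ¬? (part x ≟ part y)
    ; adj-sym    = λ x≢y → x≢y ∘ sym
    ; adj-irrefl = λ { refl x≢x → x≢x refl }
    }

  edge : Edge graph
  edge = go 2≤k part nonEmpty
    where
    go : ∀ {k} → 2 ≤ k → (p : Fin b → Fin k) → (∀ i → ∃ λ x → p x ≡ i) →
         ∃₂ λ x y → p x ≢ p y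
    go (s≤s (s≤s _)) p ne with ne zero | ne (suc zero)
    ... | x , px | y , py = x , y , λ px≡py → 0≢1+n (trans (sym px) (trans px≡py py))

IsIntervalLabelling : ∀ {k b} → CompletePartite k b → Permutation′ k → Permutation′ b → Set
IsIntervalLabelling B π φ = ∀ x y →
  (π ⟨$⟩ʳ part x) Fin.< (π ⟨$⟩ʳ part y) → (φ ⟨$⟩ʳ x) Fin.< (φ ⟨$⟩ʳ y)
  where open CompletePartite B

-- The vertices of Fin (b * t) with quotient p are the t consecutive vertices
-- forming V_x for the x with φ(x) = p.  Vertices of the same V_x are twins, so
-- their relative order is immaterial.
orderedBlowUp : ∀ {b} → Graph b → (t : ℕ) → Permutation′ b → OrderedGraph (b * t)
orderedBlowUp {b} F t φ = record
  { Adj        = λ v w → Adj (original v) (original w)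
  ; adj?       = λ v w → adj? (original v) (original w)
  ; adj-sym    = adj-sym
  ; adj-irrefl = λ v≡w → adj-irrefl (cong original v≡w)
  }
  where
  open Graph F
  original : Fin (b * t) → Fin b
  original v = φ ⟨$⟩ˡ quotient t v

-- t must be positive: the blow-up with t = 0 is empty and has a perfect tiling.
IsBottlegraph : ∀ {k b h} → CompletePartite k b → OrderedGraph h → Set
IsBottlegraph {k} {b} B H =
  ∀ (π : Permutation′ k) (φ : Permutation′ b) → IsIntervalLabelling B π φ →
  ∃ λ t → 1 ≤ t × ∃ λ (T : Tiling H (orderedBlowUp (CompletePartite.graph B) t φ)) → Perfect T

{-# OPTIONS --safe #-}
module Submission where

-- Instead of the regularity lemma the proof uses an iterated retiling.  A low tile of
-- scale L is an ordered complete j-partite subgraph of G with j ≤ r "big" cells of size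
-- m L; a top tile has r big cells and a "small" one of size s L, where s < m, in any
-- order of the cells, and m / (s + r m) is 1/χcr(B) up to an error depending on η.  If
-- the top tiles miss more than a small part of G, the degree condition yields many
-- disjoint pairs of tiles, one of them low, in which a typical vertex of the low tile
-- misses less than one big cell's worth of the other tile and hence has many neighbours
-- in each of its big cells.  Choosing vertices of large degree one by one, and halving
-- by the vertex order each time, produces complete ordered blocks with one cell more.
-- Cutting everything up at a much smaller scale, this increases the potential
-- Σ L j² (with a large constant in place of j² for top tiles) by a fixed proportion of
-- n; as the potential is O(n), a bounded number of rounds suffices.  Finally a top tile
-- is cut into blow-ups of interval labellings of B, one for each way in which the
-- parts of B can be rotated through its cells.

open import Defs
import Algebra.Solver.CommutativeMonoid as CommutativeMonoidSolver
open import Data.Empty using (⊥; ⊥-elim)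
open import Data.Fin using (Fin; zero; suc; toℕ; fromℕ<; finToFun; funToFin; quotient; remainder; combine)
import Data.Fin as Fin
open import Data.Fin.Permutation using (Permutation′; permutation; _⟨$⟩ʳ_; _⟨$⟩ˡ_; inverseˡ; inverseʳ)
import Data.Fin.Permutation as Permutation
open import Data.Fin.Properties using (all?)
import Data.Fin.Properties as Fin
import Data.Integer as ℤ
import Data.Integer.Properties as ℤ
open import Data.List using (List; []; _∷_; [_]; _++_; length; filter; map; concat; take; drop; allFin; lookup)
open import Data.List.Extrema.Nat using (min≤xs)
open import Data.List.Membership.Propositional using (_∈_)
open import Data.List.Membership.Propositional.Properties
  using (∈-++⁺ˡ; ∈-filter⁻; ∈-filter⁺; ∈-allFin; ∈-lookup; ∈-map⁺; ∈-map⁻; ∈-concat⁺′; ∈-concat⁻′)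
open import Data.List.Properties
  using (map-tabulate; tabulate-lookup; map-∘; map-cong; map-++; concat-map; concat-++; length-tabulate; length-map;
         length-++; length-take; length-drop; take++drop≡id; ++-identityʳ)
  renaming (++-assoc to ++-assoc′)
open import Data.List.Relation.Binary.Permutation.Propositional
  using (_↭_; ↭-refl; ↭-sym; ↭-trans; ↭-prep; ↭-swap; ↭-reflexive)
import Data.List.Relation.Binary.Permutation.Propositional as Perm
open import Data.List.Relation.Binary.Permutation.Propositional.Properties
  using (↭-length; map⁺; All-resp-↭; ∈-resp-↭; shift; shifts; ++-comm; ++⁺; ++⁺ˡ; ++⁺ʳ; ++-assoc; ++-commutativeMonoid)
open import Data.List.Relation.Unary.All using (All; []; _∷_)
import Data.List.Relation.Unary.All as All
import Data.List.Relation.Unary.All.Properties as Allₚ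
open import Data.List.Relation.Unary.AllPairs using (AllPairs; []; _∷_)
import Data.List.Relation.Unary.AllPairs.Properties as AllPairsₚ
open import Data.List.Relation.Unary.Any using (here; there)
import Data.List.Relation.Unary.Any as Any
import Data.List.Relation.Unary.Any.Properties as Anyₚ
open import Data.List.Relation.Unary.Unique.Propositional using (Unique)
import Data.List.Relation.Unary.Unique.Propositional.Properties as Uniqueₚ
open import Data.Nat
open import Data.Nat.DivMod
  using (m/n*n≤m; m≡m%n+[m/n]*n; m%n<n; m≥n⇒m/n>0; %-distribˡ-+; [m+n]%n≡m%n; m<n⇒m%n≡m)
open import Data.Nat.Divisibility using (_∣_)
open import Data.Nat.ListAction using (product)
open import Data.Nat.ListAction.Properties using (product≢0; ∈⇒∣product)
open import Data.Nat.Properties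
open import Data.Nat.Tactic.RingSolver using (solve-∀)
open import Data.Product using (∃; ∃₂; _×_; _,_; proj₁; proj₂)
open import Data.Rational using (ℚ; 0ℚ; 1ℚ; _-_; toℚᵘ)
import Data.Rational as ℚ
import Data.Rational.Properties as ℚ
open import Data.Rational.Solver using (module +-*-Solver)
open import Data.Rational.Unnormalised using (mkℚᵘ)
import Data.Rational.Unnormalised as ℚᵘ
import Data.Rational.Unnormalised.Properties as ℚᵘ
open import Data.Sum using (_⊎_; inj₁; inj₂)
open import Data.Vec.Functional using (insertAt)
import Data.Vec.Functional.Properties as Vectorₚ
open import Function using (_∘_; id; _∋_)
open import Level using (0ℓ)
open import Relation.Binary.Definitions using (Tri; tri<; tri≈; tri>)
open import Relation.Binary.PropositionalEquality
  using (_≡_; _≢_; refl; sym; trans; cong; cong₂; subst; subst₂; ≢-sym; module ≡-Reasoning)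
open import Relation.Nullary using (¬_; Dec; yes; no)
open import Relation.Nullary.Decidable using (¬?; _→-dec_)
open import Relation.Unary using (Pred; Decidable)

-- Lists as multisets

-- The potential is quadratic because of convexity: when a tile with i + 1 big cells gives one up to
-- a tile with j > i of them, the sum of squares grows by 2(j - i). A tile that already has r big
-- cells cannot grow in this way; it is here that s < m counts, since r + 1 cells of size (s + r m)
-- m l hold (r + 1) m > s + r m top tiles of scale l. If all parts of B are equal, the obvious
-- proportions give s = m, and the shape of the top tile has to be perturbed. Finding a block costs
-- a factor exponential in its size, so blocks are tiny compared with the tiles they are cut from.
-- Each round thus moves to a far smaller scale, and the whole chain of scales is fixed before n₀;
-- this works because the gain per round is a share of n that does not depend on the scale. Only a
-- small share of each cell is cut off in a round, so that the remainders are still joined densely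
-- enough for the next block. The order of the cells in a block is not under control. This is what
-- the quantification over all permutations in `IsBottlegraph` is for.

private variable
  A : Set
  xs ys zs ws : List A

-- Linear arithmetic by certificate: b − a is added to a known inequality a ≤ b
-- and the remaining equation is a semiring identity.
≤-cert : ∀ {a b} x y z → a ≤ b → x + b + z ≡ y + a → x ≤ y
≤-cert {a} {b} x y z a≤b eq = +-cancelʳ-≤ a x y (begin
  x + a     ≤⟨ +-monoʳ-≤ x a≤b ⟩
  x + b     ≤⟨ m≤m+n (x + b) z ⟩
  x + b + z ≡⟨ eq ⟩
  y + a     ∎)
  where open ≤-Reasoning

∑ : List A → (A → ℕ) → ℕ
∑ []       f = 0
∑ (x ∷ xs) f = f x + ∑ xs f

∑-++ : ∀ (xs ys : List A) f → ∑ (xs ++ ys) f ≡ ∑ xs f + ∑ ys f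
∑-++ []       ys f = refl
∑-++ (x ∷ xs) ys f = trans (cong (f x +_) (∑-++ xs ys f)) (sym (+-assoc (f x) (∑ xs f) (∑ ys f)))

∑-concat : ∀ (xss : List (List A)) f → ∑ (concat xss) f ≡ ∑ xss (λ xs → ∑ xs f)
∑-concat []         f = refl
∑-concat (xs ∷ xss) f = trans (∑-++ xs (concat xss) f) (cong (∑ xs f +_) (∑-concat xss f))

∑-↭ : ∀ f → xs ↭ ys → ∑ xs f ≡ ∑ ys f
∑-↭ f Perm.refl = refl
∑-↭ f (Perm.prep x p) = cong (f x +_) (∑-↭ f p)
∑-↭ {ys = _ ∷ _ ∷ ys} f (Perm.swap x y p) = trans (cong (λ k → f x + (f y + k)) (∑-↭ f p))
  (((∀ a b c → a + (b + c) ≡ b + (a + c)) ∋ solve-∀) (f x) (f y) (∑ ys f))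
∑-↭ f (Perm.trans p q) = trans (∑-↭ f p) (∑-↭ f q)

∑-mono : ∀ (xs : List A) {f g} → (∀ {x} → x ∈ xs → f x ≤ g x) → ∑ xs f ≤ ∑ xs g
∑-mono []       h = z≤n
∑-mono (x ∷ xs) h = +-mono-≤ (h (here refl)) (∑-mono xs (h ∘ there))

∑-cong : ∀ (xs : List A) {f g} → (∀ x → f x ≡ g x) → ∑ xs f ≡ ∑ xs g
∑-cong []       h = refl
∑-cong (x ∷ xs) h = cong₂ _+_ (h x) (∑-cong xs h)

∑-const : ∀ (xs : List A) c → ∑ xs (λ _ → c) ≡ length xs * c
∑-const []       c = refl
∑-const (x ∷ xs) c = cong (c +_) (∑-const xs c)

∑-+ : ∀ (xs : List A) f g → ∑ xs (λ x → f x + g x) ≡ ∑ xs f + ∑ xs g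
∑-+ []       f g = refl
∑-+ (x ∷ xs) f g = trans (cong (f x + g x +_) (∑-+ xs f g))
  (((∀ a b c d → a + b + (c + d) ≡ a + c + (b + d)) ∋ solve-∀) (f x) (g x) (∑ xs f) (∑ xs g))

∑-*ˡ : ∀ c (xs : List A) f → ∑ xs (λ x → c * f x) ≡ c * ∑ xs f
∑-*ˡ c []       f = sym (*-zeroʳ c)
∑-*ˡ c (x ∷ xs) f = trans (cong (c * f x +_) (∑-*ˡ c xs f)) (sym (*-distribˡ-+ c (f x) (∑ xs f)))

∑-swap : ∀ {B : Set} (xs : List A) (ys : List B) (f : A → B → ℕ) →
         ∑ xs (λ x → ∑ ys (f x)) ≡ ∑ ys (λ y → ∑ xs (λ x → f x y))
∑-swap []       ys f = sym (trans (∑-const ys 0) (*-zeroʳ (length ys)))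
∑-swap (x ∷ xs) ys f = trans (cong (∑ ys (f x) +_) (∑-swap xs ys f))
  (sym (∑-+ ys (f x) (λ y → ∑ xs (λ x → f x y))))

∑-map : ∀ {B : Set} (g : A → B) xs f → ∑ (map g xs) f ≡ ∑ xs (f ∘ g)
∑-map g []       f = refl
∑-map g (x ∷ xs) f = cong (f (g x) +_) (∑-map g xs f)

length-as-∑ : ∀ (xs : List A) → length xs ≡ ∑ xs (λ _ → 1)
length-as-∑ xs = sym (trans (∑-const xs 1) (*-identityʳ (length xs)))

length-concat : ∀ (xss : List (List A)) → length (concat xss) ≡ ∑ xss length
length-concat []         = refl
length-concat (xs ∷ xss) = trans (length-++ xs) (cong (length xs +_) (length-concat xss))

∃-≥average : ∀ (x : A) xs f → ∃ λ y → y ∈ x ∷ xs × ∑ (x ∷ xs) f ≤ length (x ∷ xs) * f y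
∃-≥average x [] f = x , here refl , ≤-refl
∃-≥average x (x′ ∷ xs) f with ∃-≥average x′ xs f
... | y , y∈ , le with f x ≤? f y
... | yes fx≤ = y , there y∈ , +-mono-≤ fx≤ le
... | no  fx≰ = x , here refl , +-monoʳ-≤ (f x) (≤-trans le (*-monoʳ-≤ (length (x′ ∷ xs)) (≰⇒≥ fx≰)))

∃-≤average : ∀ (x : A) xs f → ∃ λ y → y ∈ x ∷ xs × length (x ∷ xs) * f y ≤ ∑ (x ∷ xs) f
∃-≤average x [] f = x , here refl , ≤-refl
∃-≤average x (x′ ∷ xs) f with ∃-≤average x′ xs f
... | y , y∈ , le with f y ≤? f x
... | yes fy≤ = y , there y∈ , +-mono-≤ fy≤ le
... | no  fy≰ = x , here refl , +-monoʳ-≤ (f x) (≤-trans (*-monoʳ-≤ (length (x′ ∷ xs)) (≰⇒≥ fy≰)) le)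

infix 4 _⊑_
-- Inclusion of multisets. Since `allFin n` has no repetitions, `verts ts ⊑ allFin n` says at once
-- that the tiles are disjoint and that no vertex is listed twice.
_⊑_ : List A → List A → Set
ys ⊑ xs = ∃ λ rest → ys ++ rest ↭ xs

⊑-reflexive : xs ↭ ys → xs ⊑ ys
⊑-reflexive {xs = xs} p = [] , ↭-trans (↭-reflexive (++-identityʳ xs)) p

⊑-refl : xs ⊑ xs
⊑-refl = ⊑-reflexive ↭-refl

⊑-trans : xs ⊑ ys → ys ⊑ zs → xs ⊑ zs
⊑-trans {xs = xs} (r , p) (r′ , q) =
  r ++ r′ , ↭-trans (↭-sym (++-assoc xs r r′)) (↭-trans (++⁺ʳ r′ p) q)

⊑-resp-↭ : xs ⊑ ys → ys ↭ zs → xs ⊑ zs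
⊑-resp-↭ (r , p) q = r , ↭-trans p q

↭-resp-⊑ : xs ↭ ys → ys ⊑ zs → xs ⊑ zs
↭-resp-⊑ p (r , q) = r , ↭-trans (++⁺ʳ r p) q

interchange-↭ : ∀ (as bs cs ds : List A) → (as ++ bs) ++ (cs ++ ds) ↭ (as ++ cs) ++ (bs ++ ds)
interchange-↭ as bs cs ds = ↭-trans (++-assoc as bs (cs ++ ds))
  (↭-trans (++⁺ˡ as (shifts bs cs)) (↭-sym (++-assoc as cs (bs ++ ds))))

⊑-++ : xs ⊑ ys → ws ⊑ zs → xs ++ ws ⊑ ys ++ zs
⊑-++ {xs = xs} {ws = ws} (r , p) (r′ , q) =
  r ++ r′ , ↭-trans (interchange-↭ xs ws r r′) (++⁺ p q)

[]⊑ : ∀ (xs : List A) → [] ⊑ xs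
[]⊑ xs = xs , ↭-refl

⊑-++ʳ : ∀ (xs ys : List A) → xs ⊑ xs ++ ys
⊑-++ʳ xs ys = ys , ↭-refl

⊑-++ˡ : ∀ (xs ys : List A) → ys ⊑ xs ++ ys
⊑-++ˡ xs ys = xs , ++-comm ys xs

∈-⊑ : ∀ {x} → xs ⊑ ys → x ∈ xs → x ∈ ys
∈-⊑ (r , p) x∈ = ∈-resp-↭ p (∈-++⁺ˡ x∈)

∑-⊑ : ∀ f → xs ⊑ ys → ∑ xs f ≤ ∑ ys f
∑-⊑ {xs = xs} f (r , p) = subst (∑ xs f ≤_) (trans (sym (∑-++ xs r f)) (∑-↭ f p)) (m≤m+n _ _)

length-⊑ : xs ⊑ ys → length xs ≤ length ys
length-⊑ {xs = xs} (r , p) = subst (length xs ≤_) (trans (sym (length-++ xs)) (↭-length p)) (m≤m+n _ _)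

concat-⊑ : ∀ {xs : List A} {xss} → xs ∈ xss → xs ⊑ concat xss
concat-⊑ {xs = xs} {xss = _ ∷ xss} (here refl) = ⊑-++ʳ xs (concat xss)
concat-⊑ {xss = ys ∷ xss} (there xs∈) = ⊑-trans (concat-⊑ xs∈) (⊑-++ˡ ys (concat xss))

filter-↭-¬ : ∀ {P : Pred A 0ℓ} (P? : Decidable P) xs → filter P? xs ++ filter (¬? ∘ P?) xs ↭ xs
filter-↭-¬ P? [] = ↭-refl
filter-↭-¬ P? (x ∷ xs) with P? x
... | yes _ = ↭-prep x (filter-↭-¬ P? xs)
... | no  _ = ↭-trans (shift x (filter P? xs) (filter (¬? ∘ P?) xs)) (↭-prep x (filter-↭-¬ P? xs))

filter-⊑ : ∀ {P : Pred A 0ℓ} (P? : Decidable P) xs → filter P? xs ⊑ xs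
filter-⊑ P? xs = filter (¬? ∘ P?) xs , filter-↭-¬ P? xs

splitAt-length : ∀ k l (xs : List A) → length xs ≡ k + l →
  ∃₂ λ ys zs → ys ++ zs ≡ xs × length ys ≡ k × length zs ≡ l
splitAt-length k l xs eq = take k xs , drop k xs , take++drop≡id k xs
  , trans (length-take k xs) (trans (cong (k ⊓_) eq) (m≤n⇒m⊓n≡m (m≤m+n k l)))
  , trans (length-drop k xs) (trans (cong (_∸ k) eq) (m+n∸m≡n k l))

sublist-of-length : ∀ k (xs : List A) → k ≤ length xs → ∃ λ ys → ys ⊑ xs × length ys ≡ k
sublist-of-length k xs k≤ with splitAt-length k (length xs ∸ k) xs (sym (m+[n∸m]≡n k≤))
... | ys , zs , refl , |ys| , _ = ys , ⊑-++ʳ ys zs , |ys|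

∈⇒↭ : ∀ {x} → x ∈ xs → ∃ λ ys → x ∷ ys ↭ xs
∈⇒↭ {xs = x ∷ xs} (here refl) = xs , ↭-refl
∈⇒↭ {xs = y ∷ xs} {x = x} (there x∈) with ∈⇒↭ x∈
... | ys , p = y ∷ ys , ↭-trans (↭-swap x y ↭-refl) (↭-prep y p)

AllPairs-↭ : ∀ {R : A → A → Set} → (∀ {x y} → R x y → R y x) → ∀ {xs ys} → xs ↭ ys → AllPairs R xs → AllPairs R ys
AllPairs-↭ R-sym Perm.refl u = u
AllPairs-↭ R-sym (Perm.prep x p) (h ∷ u) = All-resp-↭ p h ∷ AllPairs-↭ R-sym p u
AllPairs-↭ R-sym (Perm.swap x y p) ((xy ∷ h) ∷ h′ ∷ u) =
  (R-sym xy ∷ All-resp-↭ p h′) ∷ All-resp-↭ p h ∷ AllPairs-↭ R-sym p u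
AllPairs-↭ R-sym (Perm.trans p q) u = AllPairs-↭ R-sym q (AllPairs-↭ R-sym p u)

Unique-↭ : xs ↭ ys → Unique xs → Unique ys
Unique-↭ = AllPairs-↭ ≢-sym

Unique-++ˡ : ∀ (xs : List A) {ys} → Unique (xs ++ ys) → Unique xs
Unique-++ˡ []       u        = []
Unique-++ˡ (x ∷ xs) (x∉ ∷ u) = Allₚ.++⁻ˡ xs x∉ ∷ Unique-++ˡ xs u

Unique-⊑ : xs ⊑ ys → Unique ys → Unique xs
Unique-⊑ {xs = xs} (r , p) u = Unique-++ˡ xs (Unique-↭ (↭-sym p) u)

Unique⇒⊑ : Unique xs → (∀ {x} → x ∈ xs → x ∈ ys) → xs ⊑ ys
Unique⇒⊑ {xs = []} _ _ = []⊑ _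
Unique⇒⊑ {xs = x ∷ xs} (x∉ ∷ u) sub with ∈⇒↭ (sub (here refl))
... | zs , p with Unique⇒⊑ u xs⊆zs
  where
  xs⊆zs : ∀ {y} → y ∈ xs → y ∈ zs
  xs⊆zs y∈ with ∈-resp-↭ (↭-sym p) (sub (there y∈))
  ... | here refl  = ⊥-elim (All.lookup x∉ y∈ refl)
  ... | there y∈zs = y∈zs
... | r , q = r , ↭-trans (↭-prep x q) p

⊑-length⇒↭ : xs ⊑ ys → length ys ≤ length xs → xs ↭ ys
⊑-length⇒↭ {xs = xs} ([] , p) le = ↭-trans (↭-reflexive (sym (++-identityʳ xs))) p
⊑-length⇒↭ {xs = xs} (r ∷ rs , p) le = ⊥-elim (<⇒≱ (begin-strict
  length xs                   <⟨ m<m+n (length xs) (s≤s z≤n) ⟩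
  length xs + length (r ∷ rs) ≡⟨ sym (length-++ xs) ⟩
  length (xs ++ r ∷ rs)       ≡⟨ ↭-length p ⟩
  _                           ∎) le)
  where open ≤-Reasoning

-- Complete ordered pairs of cells

𝟙 : ∀ {P : Set} → Dec P → ℕ
𝟙 (yes _) = 1
𝟙 (no _)  = 0

𝟙-complement : ∀ {P : Set} (P? : Dec P) → 𝟙 P? + 𝟙 (¬? P?) ≡ 1
𝟙-complement (yes _) = refl
𝟙-complement (no _)  = refl

𝟙-cong : ∀ {P Q : Set} (P? : Dec P) (Q? : Dec Q) → (P → Q) → (Q → P) → 𝟙 P? ≡ 𝟙 Q?
𝟙-cong (yes p) (yes q) f g = refl
𝟙-cong (yes p) (no ¬q) f g = ⊥-elim (¬q (f p))
𝟙-cong (no ¬p) (yes q) f g = ⊥-elim (¬p (g q))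
𝟙-cong (no ¬p) (no ¬q) f g = refl

length-filter-𝟙 : ∀ {P : Pred A 0ℓ} (P? : Decidable P) xs → length (filter P? xs) ≡ ∑ xs (𝟙 ∘ P?)
length-filter-𝟙 P? [] = refl
length-filter-𝟙 P? (x ∷ xs) with P? x
... | yes _ = cong suc (length-filter-𝟙 P? xs)
... | no  _ = length-filter-𝟙 P? xs

-- Markov's inequality. The bound on `f y` lies halfway between c and the bound d/(d+1) · c on the
-- mean, so the entries above it cannot be all but a tiny share of `xs`. The share 1/(2d+1) that
-- comes out is rounded down to 1/(2d+2).
markov : ∀ d c (xs : List A) f → 1 ≤ c → suc d * ∑ xs f ≤ d * (length xs * c) →
  ∃ λ ys → ys ⊑ xs × length xs ≤ 2 * suc d * length ys ×
           (∀ {y} → y ∈ ys → 2 * suc d * f y ≤ suc (2 * d) * c)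
markov {A} d c xs f 1≤c few = filter good? xs , filter-⊑ good? xs , large
  , λ y∈ → proj₂ (∈-filter⁻ good? {xs = xs} y∈)
  where
  good? : Decidable (λ x → 2 * suc d * f x ≤ suc (2 * d) * c)
  good? x = 2 * suc d * f x ≤? suc (2 * d) * c
  g = ∑ xs (𝟙 ∘ good?)
  pointwise : ∀ {x} → x ∈ xs → suc (2 * d) * c ≤ suc (2 * d) * c * 𝟙 (good? x) + 2 * suc d * f x
  pointwise {x} _ with good? x
  ... | yes _ = ≤-trans (≤-reflexive (sym (*-identityʳ _))) (m≤m+n _ _)
  ... | no ¬g = ≤-trans (≰⇒≥ ¬g) (m≤n+m (2 * suc d * f x) (suc (2 * d) * c * 0))
  summed : length xs * (suc (2 * d) * c) ≤ suc (2 * d) * c * g + 2 * suc d * ∑ xs f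
  summed = subst₂ _≤_ (∑-const xs _)
    (trans (∑-+ xs (λ x → suc (2 * d) * c * 𝟙 (good? x)) (λ x → 2 * suc d * f x))
      (cong₂ _+_ (∑-*ˡ (suc (2 * d) * c) xs (𝟙 ∘ good?)) (∑-*ˡ (2 * suc d) xs f))) (∑-mono xs pointwise)
  scaled : length xs * c ≤ (suc (2 * d) * g) * c
  scaled = ≤-cert (length xs * c) (suc (2 * d) * g * c) 0 (+-mono-≤ summed (*-monoʳ-≤ 2 few))
    (((∀ d c l g s → l * c + (suc (2 * d) * c * g + 2 * suc d * s + 2 * (d * (l * c))) + 0
       ≡ suc (2 * d) * g * c + (l * (suc (2 * d) * c) + 2 * (suc d * s))) ∋ solve-∀)
      d c (length xs) g (∑ xs f))
  large : length xs ≤ 2 * suc d * length (filter good? xs)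
  large = begin
    length xs                               ≤⟨ *-cancelʳ-≤ _ _ c {{>-nonZero 1≤c}} scaled ⟩
    suc (2 * d) * g                         ≤⟨ *-monoˡ-≤ g (≤-trans (n≤1+n _) (≤-reflexive (sym (*-suc 2 d)))) ⟩
    2 * suc d * g                           ≡⟨ cong (2 * suc d *_) (sym (length-filter-𝟙 good? xs)) ⟩
    2 * suc d * length (filter good? xs)    ∎
    where open ≤-Reasoning

module _ {n} (G : Graph n) where
  open Graph G

  infix 4 _◁_ _⋈_

  _◁_ _⋈_ : List (Fin n) → List (Fin n) → Set
  X ◁ Y = ∀ {x y} → x ∈ X → y ∈ Y → Adj x y × x Fin.< y
  X ⋈ Y = X ◁ Y ⊎ Y ◁ X

  ⋈-sym : ∀ {X Y} → X ⋈ Y → Y ⋈ X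
  ⋈-sym (inj₁ p) = inj₂ p
  ⋈-sym (inj₂ p) = inj₁ p

  ◁-⊑ : ∀ {X Y X′ Y′} → X′ ⊑ X → Y′ ⊑ Y → X ◁ Y → X′ ◁ Y′
  ◁-⊑ X′⊑X Y′⊑Y X◁Y x∈ y∈ = X◁Y (∈-⊑ X′⊑X x∈) (∈-⊑ Y′⊑Y y∈)

  ⋈-⊑ : ∀ {X Y X′ Y′} → X′ ⊑ X → Y′ ⊑ Y → X ⋈ Y → X′ ⋈ Y′
  ⋈-⊑ p q (inj₁ X◁Y) = inj₁ (◁-⊑ p q X◁Y)
  ⋈-⊑ p q (inj₂ Y◁X) = inj₂ (◁-⊑ q p Y◁X)

  -- A vertex is unjoined from itself, so that `unjoined v` sums over all vertices to n minus the
  -- degree of v.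
  joined unjoined : Fin n → Fin n → ℕ
  joined   u v = 𝟙 (adj? u v)
  unjoined u v = 𝟙 (¬? (adj? u v))

  unjoined-sym : ∀ u v → unjoined u v ≡ unjoined v u
  unjoined-sym u v = 𝟙-cong (¬? (adj? u v)) (¬? (adj? v u)) (_∘ adj-sym) (_∘ adj-sym)

  joined+unjoined : ∀ u X → ∑ X (joined u) + ∑ X (unjoined u) ≡ length X
  joined+unjoined u X = trans (sym (∑-+ X (joined u) (unjoined u)))
    (trans (∑-cong X (λ v → 𝟙-complement (adj? u v))) (sym (length-as-∑ X)))

  misses : List (Fin n) → List (Fin n) → ℕ
  misses X Y = ∑ X (λ u → ∑ Y (unjoined u))

  misses-sym : ∀ X Y → misses X Y ≡ misses Y X
  misses-sym X Y = trans (∑-swap X Y unjoined) (∑-cong Y (λ v → ∑-cong X (λ u → unjoined-sym u v)))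

  misses-⊑ : ∀ {X X′ Y Y′} → X′ ⊑ X → Y′ ⊑ Y → misses X′ Y′ ≤ misses X Y
  misses-⊑ {X} {X′} {Y} {Y′} p q =
    ≤-trans (∑-⊑ (λ u → ∑ Y′ (unjoined u)) p) (∑-mono X (λ {u} _ → ∑-⊑ (unjoined u) q))

  -- A vertex w of C with at least average degree into P, and the larger of the
  -- two parts into which w splits its neighbourhood in P.
  pick-one : ∀ {P C c κ t Y} → 1 ≤ κ → 1 ≤ c → 1 ≤ Y → length C ≤ c →
    (∀ {u} → u ∈ P → c + κ * suc t ≤ κ * ∑ C (joined u)) → 2 * κ * Y ≤ length P →
    ∃₂ λ w C′ → ∃ λ P′ → w ∷ C′ ↭ C × P′ ⊑ P × Y ≤ length P′ × P′ ⋈ [ w ]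
  pick-one {[]} {κ = suc _} {Y = suc _} _ _ _ _ _ ()
  pick-one {u ∷ _} {[]} {suc c} {κ} {t} _ _ _ _ rich _
    with subst (suc (c + κ * suc t) ≤_) (*-zeroʳ κ) (rich (here refl))
  ... | ()
  pick-one {P@(_ ∷ _)} {C@(w₀ ∷ C₀)} {c} {κ} {t} {Y} 1≤κ 1≤c _ |C|≤c rich P-large
    with ∃-≥average w₀ C₀ (λ w → ∑ P (λ u → joined u w))
  ... | w , w∈ , avg with ∈⇒↭ w∈
  ... | C′ , p = w , C′ , halves
    where
    N = filter (λ u → adj? u w) P
    N⊑P = filter-⊑ (λ u → adj? u w) P
    N< = filter (λ u → u Fin.<? w) N
    N> = filter (λ u → ¬? (u Fin.<? w)) N
    deg = ∑ P (λ u → joined u w)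
    2Y≤N : 2 * Y ≤ length N
    2Y≤N = subst (2 * Y ≤_) (sym (length-filter-𝟙 (λ u → adj? u w) P))
      (*-cancelˡ-≤ κ {{>-nonZero 1≤κ}} (≤-trans (≤-reflexive
        (((∀ κ Y → κ * (2 * Y) ≡ 2 * κ * Y) ∋ solve-∀) κ Y))
        (≤-trans P-large (*-cancelʳ-≤ _ _ c {{>-nonZero 1≤c}} bound))))
      where
      open ≤-Reasoning
      bound : length P * c ≤ κ * deg * c
      bound = begin
        length P * c                             ≡⟨ sym (∑-const P c) ⟩
        ∑ P (λ _ → c)                            ≤⟨ ∑-mono P (λ u∈ → ≤-trans (m≤m+n c _) (rich u∈)) ⟩
        ∑ P (λ u → κ * ∑ C (joined u))           ≡⟨ ∑-*ˡ κ P _ ⟩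
        κ * ∑ P (λ u → ∑ C (joined u))           ≡⟨ cong (κ *_) (∑-swap P C joined) ⟩
        κ * ∑ C (λ w → ∑ P (λ u → joined u w))   ≤⟨ *-monoʳ-≤ κ (≤-trans avg (*-monoˡ-≤ deg |C|≤c)) ⟩
        κ * (c * deg)                            ≡⟨ ((∀ κ c d → κ * (c * d) ≡ κ * d * c) ∋ solve-∀) κ c deg ⟩
        κ * deg * c                              ∎
    |N| : length N< + length N> ≡ length N
    |N| = trans (sym (length-++ N<)) (↭-length (filter-↭-¬ (λ u → u Fin.<? w) N))
    halves : ∃ λ P′ → w ∷ C′ ↭ C × P′ ⊑ P × Y ≤ length P′ × P′ ⋈ [ w ]
    halves with Y ≤? length N<
    ... | yes Y≤ = N< , p , ⊑-trans (filter-⊑ (λ u → u Fin.<? w) N) N⊑P , Y≤ , inj₁ below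
      where
      below : N< ◁ [ w ]
      below u∈ (here refl) with ∈-filter⁻ (λ u → u Fin.<? w) {xs = N} u∈
      ... | u∈N , u<w = proj₂ (∈-filter⁻ (λ u → adj? u w) {xs = P} u∈N) , u<w
    ... | no Y≰ = N> , p , ⊑-trans (filter-⊑ (λ u → ¬? (u Fin.<? w)) N) N⊑P , Y≤ , inj₂ above
      where
      Y≤ : Y ≤ length N>
      Y≤ = ≤-cert Y (length N>) 0 (+-mono-≤ (≤-trans 2Y≤N (≤-reflexive (sym |N|))) (≰⇒≥ Y≰))
        (((∀ Y a b → Y + (a + b + Y) + 0 ≡ b + (2 * Y + a)) ∋ solve-∀) Y (length N<) (length N>))
      above : [ w ] ◁ N>
      above {y = u} (here refl) u∈ with ∈-filter⁻ (λ u → ¬? (u Fin.<? w)) {xs = N} u∈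
      ... | u∈N , u≮w with proj₂ (∈-filter⁻ (λ u → adj? u w) {xs = P} u∈N)
      ... | uw = adj-sym uw , ≤∧≢⇒< (≮⇒≥ u≮w) (λ w≡u → adj-irrefl (sym (Fin.toℕ-injective w≡u)) uw)

  ◁-∷ : ∀ {P w A} → P ◁ [ w ] → P ◁ A → P ◁ w ∷ A
  ◁-∷ p q x∈ (here refl) = p x∈ (here refl)
  ◁-∷ p q x∈ (there y∈)  = q x∈ y∈

  ∷-◁ : ∀ {P w A} → [ w ] ◁ P → A ◁ P → w ∷ A ◁ P
  ∷-◁ p q (here refl) y∈ = p (here refl) y∈
  ∷-◁ p q (there x∈)  y∈ = q x∈ y∈

  -- Pigeonhole: each `pick-one` puts a vertex of `C` above or below the surviving part of `P`, so
  -- after at most x + y picks there are x above or y below. The slack κ(x + y) pays for the picked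
  -- vertices, each of which takes at most one neighbour in `C` from a vertex of `P`; the factor
  -- (2κ)^(x + y) pays for the shrinking of `P`.
  pick-side : ∀ x y {P C c κ Y} → 1 ≤ κ → 1 ≤ c → 1 ≤ Y → length C ≤ c →
    (∀ {u} → u ∈ P → c + κ * (x + y) ≤ κ * ∑ C (joined u)) → Y * (2 * κ) ^ (x + y) ≤ length P →
    ∃ λ P′ → P′ ⊑ P × Y ≤ length P′ × ∃₂ λ A C′ → A ++ C′ ↭ C ×
      (length A ≡ x × P′ ◁ A ⊎ length A ≡ y × A ◁ P′)
  pick-side zero y {P} {C} {κ = κ} {Y} 1≤κ _ _ _ _ P-large = P , ⊑-refl
    , ≤-trans (m≤m*n Y _ {{m^n≢0 (2 * κ) y {{m*n≢0 2 κ {{_}} {{>-nonZero 1≤κ}}}}}}) P-large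
    , [] , C , ↭-refl , inj₁ (refl , λ _ ())
  pick-side (suc x) zero {P} {C} {κ = κ} {Y} 1≤κ _ _ _ _ P-large = P , ⊑-refl
    , ≤-trans (m≤m*n Y _ {{m^n≢0 (2 * κ) (suc x + 0) {{m*n≢0 2 κ {{_}} {{>-nonZero 1≤κ}}}}}}) P-large
    , [] , C , ↭-refl , inj₂ (refl , λ ())
  pick-side (suc x) (suc y) {P} {C} {c} {κ} {Y} 1≤κ 1≤c 1≤Y |C|≤c rich P-large
    with pick-one {Y = Y * (2 * κ) ^ (x + suc y)} 1≤κ 1≤c
      (≤-trans 1≤Y (m≤m*n Y _ {{m^n≢0 (2 * κ) (x + suc y) {{m*n≢0 2 κ {{_}} {{>-nonZero 1≤κ}}}}}})) |C|≤c rich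
      (≤-trans (≤-reflexive (((∀ κ Y Z → 2 * κ * (Y * Z) ≡ Y * (2 * κ * Z)) ∋ solve-∀) κ Y ((2 * κ) ^ (x + suc y)))) P-large)
  ... | w , C′ , P₁ , p , P₁⊑P , P₁-large , P₁⋈w = continue P₁⋈w
    where
    t = x + suc y
    |C′|≤c : length C′ ≤ c
    |C′|≤c = ≤-trans (n≤1+n _) (≤-trans (≤-reflexive (↭-length p)) |C|≤c)
    rich′ : ∀ {u} → u ∈ P₁ → c + κ * t ≤ κ * ∑ C′ (joined u)
    rich′ {u} u∈ = ≤-cert (c + κ * t) (κ * ∑ C′ (joined u)) 0
      (≤-trans (rich (∈-⊑ P₁⊑P u∈)) (≤-trans (≤-reflexive (cong (κ *_) (sym (∑-↭ (joined u) p))))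
        (*-monoʳ-≤ κ (+-monoˡ-≤ _ (≤-trans (m≤m+n _ _) (≤-reflexive (𝟙-complement (adj? u w))))))))
      (((∀ c κ t s → c + κ * t + κ * (1 + s) + 0 ≡ κ * s + (c + κ * suc t)) ∋ solve-∀) c κ t (∑ C′ (joined u)))
    Result = ∃ λ P′ → P′ ⊑ P × Y ≤ length P′ × ∃₂ λ A C′ → A ++ C′ ↭ C ×
      (length A ≡ suc x × P′ ◁ A ⊎ length A ≡ suc y × A ◁ P′)
    keep : ∀ {A C″} → A ++ C″ ↭ C′ → A ++ w ∷ C″ ↭ C
    keep {A} {C″} q = ↭-trans (shift w A C″) (↭-trans (↭-prep w q) p)
    continue : P₁ ⋈ [ w ] → Result
    continue (inj₁ P₁◁w) with pick-side x (suc y) 1≤κ 1≤c 1≤Y |C′|≤c rich′ P₁-large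
    ... | P₂ , P₂⊑P₁ , large , A , C″ , q , inj₁ (|A| , P₂◁A) =
      P₂ , ⊑-trans P₂⊑P₁ P₁⊑P , large , w ∷ A , C″ , ↭-trans (↭-prep w q) p
      , inj₁ (cong suc |A| , ◁-∷ (◁-⊑ P₂⊑P₁ ⊑-refl P₁◁w) P₂◁A)
    ... | P₂ , P₂⊑P₁ , large , A , C″ , q , inj₂ r =
      P₂ , ⊑-trans P₂⊑P₁ P₁⊑P , large , A , w ∷ C″ , keep q , inj₂ r
    continue (inj₂ w◁P₁) with pick-side (suc x) y 1≤κ 1≤c 1≤Y |C′|≤c
      (subst (λ t → ∀ {u} → u ∈ P₁ → c + κ * t ≤ κ * ∑ C′ (joined u)) (+-suc x y) rich′)
      (subst (λ t → Y * (2 * κ) ^ t ≤ length P₁) (+-suc x y) P₁-large)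
    ... | P₂ , P₂⊑P₁ , large , A , C″ , q , inj₂ (|A| , A◁P₂) =
      P₂ , ⊑-trans P₂⊑P₁ P₁⊑P , large , w ∷ A , C″ , ↭-trans (↭-prep w q) p
      , inj₂ (cong suc |A| , ∷-◁ (◁-⊑ ⊑-refl P₂⊑P₁ w◁P₁) A◁P₂)
    ... | P₂ , P₂⊑P₁ , large , A , C″ , q , inj₁ r =
      P₂ , ⊑-trans P₂⊑P₁ P₁⊑P , large , A , w ∷ C″ , keep q , inj₁ r

-- Cutting slices of equal size off all cells

data Peel {A : Set} (a : ℕ) : (As Ds Cs : List (List A)) → Set where
  []  : Peel a [] [] []
  _∷_ : ∀ {X Y C As Ds Cs} → X ++ Y ↭ C × length X ≡ a → Peel a As Ds Cs →
        Peel a (X ∷ As) (Y ∷ Ds) (C ∷ Cs)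

module _ {a : ℕ} where

  Peel-concat : ∀ {As Ds Cs : List (List A)} → Peel a As Ds Cs → concat As ++ concat Ds ↭ concat Cs
  Peel-concat [] = ↭-refl
  Peel-concat {As = X ∷ As} {Y ∷ Ds} ((p , _) ∷ ps) =
    ↭-trans (interchange-↭ X (concat As) Y (concat Ds)) (++⁺ p (Peel-concat ps))

  Peel-lengthˡ : ∀ {As Ds Cs : List (List A)} → Peel a As Ds Cs → length As ≡ length Cs
  Peel-lengthˡ []       = refl
  Peel-lengthˡ (_ ∷ ps) = cong suc (Peel-lengthˡ ps)

  Peel-lengthʳ : ∀ {As Ds Cs : List (List A)} → Peel a As Ds Cs → length Ds ≡ length Cs
  Peel-lengthʳ []       = refl
  Peel-lengthʳ (_ ∷ ps) = cong suc (Peel-lengthʳ ps)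

  Peel-sizesˡ : ∀ {As Ds Cs : List (List A)} → Peel a As Ds Cs → All (λ X → length X ≡ a) As
  Peel-sizesˡ []             = []
  Peel-sizesˡ ((_ , e) ∷ ps) = e ∷ Peel-sizesˡ ps

  Peel-sizesʳ : ∀ {k} {As Ds Cs : List (List A)} → Peel a As Ds Cs →
    All (λ C → length C ≡ a + k) Cs → All (λ X → length X ≡ k) Ds
  Peel-sizesʳ [] [] = []
  Peel-sizesʳ {k = k} {As = X ∷ _} {Y ∷ _} ((p , e) ∷ ps) (e′ ∷ es) =
    +-cancelˡ-≡ a _ _ (trans (cong (_+ length Y) (sym e))
      (trans (sym (length-++ X)) (trans (↭-length p) e′))) ∷ Peel-sizesʳ ps es

  module _ {P : List A → Set} (resp : ∀ {X Y} → Y ⊑ X → P X → P Y) where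

    Peel-Allˡ : ∀ {As Ds Cs} → Peel a As Ds Cs → All P Cs → All P As
    Peel-Allˡ [] [] = []
    Peel-Allˡ (_∷_ {Y = Y} (p , _) ps) (h ∷ hs) = resp (Y , p) h ∷ Peel-Allˡ ps hs

    Peel-Allʳ : ∀ {As Ds Cs} → Peel a As Ds Cs → All P Cs → All P Ds
    Peel-Allʳ [] [] = []
    Peel-Allʳ (_∷_ {X} {Y} (p , _) ps) (h ∷ hs) =
      resp (⊑-resp-↭ (⊑-++ˡ X Y) p) h ∷ Peel-Allʳ ps hs

  module _ {R : List A → List A → Set} (resp : ∀ {X Y X′ Y′} → X′ ⊑ X → Y′ ⊑ Y → R X Y → R X′ Y′) where

    Peel-AllPairsˡ : ∀ {As Ds Cs} → Peel a As Ds Cs → AllPairs R Cs → AllPairs R As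
    Peel-AllPairsˡ [] [] = []
    Peel-AllPairsˡ (_∷_ {Y = Y} (p , _) ps) (h ∷ hs) =
      All.map (resp (Y , p) ⊑-refl) (Peel-Allˡ (resp ⊑-refl) ps h) ∷ Peel-AllPairsˡ ps hs

    Peel-AllPairsʳ : ∀ {As Ds Cs} → Peel a As Ds Cs → AllPairs R Cs → AllPairs R Ds
    Peel-AllPairsʳ [] [] = []
    Peel-AllPairsʳ (_∷_ {X} {Y} (p , _) ps) (h ∷ hs) =
      All.map (resp (⊑-resp-↭ (⊑-++ˡ X Y) p) ⊑-refl) (Peel-Allʳ (resp ⊑-refl) ps h) ∷ Peel-AllPairsʳ ps hs

Peel-split : ∀ k l (Cs : List (List A)) → All (λ C → length C ≡ k + l) Cs →
  ∃₂ λ As Ds → Peel k As Ds Cs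
Peel-split k l [] [] = [] , [] , []
Peel-split k l (C ∷ Cs) (e ∷ es) with splitAt-length k l C e | Peel-split k l Cs es
... | X , Y , p , |X| , _ | As , Ds , ps = X ∷ As , Y ∷ Ds , (↭-reflexive p , |X|) ∷ ps

-- Extraction of complete blocks

Peel-zero : ∀ (Cs : List (List A)) → ∃ λ As → Peel 0 As Cs Cs
Peel-zero []       = [] , []
Peel-zero (C ∷ Cs) = _ , (↭-refl , refl) ∷ proj₂ (Peel-zero Cs)

Peel-trans : ∀ {a b} {As Ds Cs Bs Es : List (List A)} → Peel a As Ds Cs → Peel b Bs Es Ds →
  ∃ λ Fs → Peel (a + b) Fs Es Cs
Peel-trans [] [] = [] , []
Peel-trans (_∷_ {X} {Y} (p , |X|) ps) (_∷_ {X′} {Y′} (q , |X′|) qs) =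
  (X ++ X′) ∷ _ , (↭-trans (++-assoc X X′ Y′) (↭-trans (++⁺ˡ X q) p)
                , trans (length-++ X) (cong₂ _+_ |X| |X′|)) ∷ proj₂ (Peel-trans ps qs)

abstract
  -- With κ = 4(d + 1), the first summand makes the slack κ(a + a) of `pick-side` at most the cell
  -- size. The second leaves a candidates after r rounds of picking have started from the share
  -- 1/(2d + 2) that `markov` provides.
  threshold : ℕ → ℕ → ℕ → ℕ
  threshold d a r = 4 * suc d * (a + a) + 2 * suc d * (a * ((2 * (4 * suc d)) ^ (a + a)) ^ r)

  threshold-side : ∀ d a r → 4 * suc d * (a + a) ≤ threshold d a r
  threshold-side d a r = m≤m+n (4 * suc d * (a + a)) (2 * suc d * (a * ((2 * (4 * suc d)) ^ (a + a)) ^ r))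

  threshold-large : ∀ d a r → 2 * suc d * (a * ((2 * (4 * suc d)) ^ (a + a)) ^ r) ≤ threshold d a r
  threshold-large d a r = m≤n+m (2 * suc d * (a * ((2 * (4 * suc d)) ^ (a + a)) ^ r)) (4 * suc d * (a + a))

  a≤threshold : ∀ d a r → a ≤ threshold d a r
  a≤threshold d a r = ≤-trans (m≤m+n a a) (≤-trans (m≤n*m (a + a) (4 * suc d)) (threshold-side d a r))

-- Missing at most (2d+1)/(2d+2) of a cell means being joined to 1/(2d+2) of it. Taking 4(d + 1)
-- instead of 2(d + 1) yields 2c, and the second c covers the slack t.
many-joined : ∀ d {c t} J M → t ≤ c → J + M ≡ c → 2 * suc d * M ≤ suc (2 * d) * c → c + t ≤ 4 * suc d * J
many-joined d {t = t} J M t≤c refl few = ≤-cert (J + M + t) (4 * suc d * J) 0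
  (+-mono-≤ t≤c (*-monoʳ-≤ 2 few))
  (((∀ d t J M → J + M + t + (J + M + 2 * (suc (2 * d) * (J + M))) + 0
    ≡ 4 * suc d * J + (t + 2 * (2 * suc d * M))) ∋ solve-∀) d t J M)

module _ {n} (G : Graph n) where
  open Graph G

  private
    _⋈′_ = _⋈_ G
    infix 4 _⋈′_

  -- The list of cells need not follow the vertex order: `_⋈′_` admits both directions,
  -- independently for each pair.
  record Block (c j : ℕ) : Set where
    field
      cells  : List (List (Fin n))
      linked : AllPairs _⋈′_ cells
      sizes  : All (λ C → length C ≡ c) cells
      count  : length cells ≡ j

    vertices : List (Fin n)
    vertices = concat cells

  -- Whether a cell's vertices end up above or below `P′` cannot be chosen, so `pick-side` is asked
  -- for a vertices on either side. The cells are treated one after the other; what was gained for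
  -- earlier ones survives since `_⋈′_` passes to subsets of `P`.
  pick-sides : ∀ a {c κ Y} Cs {P} → 1 ≤ κ → 1 ≤ c → 1 ≤ Y → (∀ {C} → C ∈ Cs → length C ≤ c) →
    (∀ {C u} → C ∈ Cs → u ∈ P → c + κ * (a + a) ≤ κ * ∑ C (joined G u)) →
    Y * ((2 * κ) ^ (a + a)) ^ length Cs ≤ length P →
    ∃ λ P′ → P′ ⊑ P × Y ≤ length P′ × ∃₂ λ As Ds → Peel a As Ds Cs × All (P′ ⋈′_) As
  pick-sides a {Y = Y} [] {P} _ _ _ _ _ large =
    P , ⊑-refl , subst (_≤ length P) (*-identityʳ Y) large , [] , [] , [] , []
  pick-sides a {c} {κ} {Y} (C ∷ Cs) {P} 1≤κ 1≤c 1≤Y small rich large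
    with pick-sides a {c} {κ} {Y * (2 * κ) ^ (a + a)} Cs 1≤κ 1≤c
      (≤-trans 1≤Y (m≤m*n Y _ {{m^n≢0 (2 * κ) (a + a) {{m*n≢0 2 κ {{_}} {{>-nonZero 1≤κ}}}}}}))
      (small ∘ there) (rich ∘ there) (≤-trans (≤-reflexive (*-assoc Y _ _)) large)
  ... | P₁ , P₁⊑P , large₁ , As , Ds , ps , P₁⋈As
    with pick-side G a a 1≤κ 1≤c 1≤Y (small (here refl)) (rich (here refl) ∘ ∈-⊑ P₁⊑P) large₁
  ... | P₂ , P₂⊑P₁ , large₂ , X , Y′ , p , side =
    P₂ , ⊑-trans P₂⊑P₁ P₁⊑P , large₂ , X ∷ As , Y′ ∷ Ds , (p , side-size side) ∷ ps
    , link side ∷ All.map (⋈-⊑ G P₂⊑P₁ ⊑-refl) P₁⋈As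
    where
    Side = length X ≡ a × _◁_ G P₂ X ⊎ length X ≡ a × _◁_ G X P₂
    side-size : Side → length X ≡ a
    side-size (inj₁ (e , _)) = e
    side-size (inj₂ (e , _)) = e
    link : Side → P₂ ⋈′ X
    link (inj₁ (_ , P₂◁X)) = inj₁ P₂◁X
    link (inj₂ (_ , X◁P₂)) = inj₂ X◁P₂

  Extraction : ℕ → List (Fin n) → List (List (Fin n)) → Set
  Extraction a P Cs = ∃₂ λ U P′ → ∃₂ λ As Ds →
    U ++ P′ ↭ P × length U ≡ a × Peel a As Ds Cs × AllPairs _⋈′_ (U ∷ As)

  extract-from-rich : ∀ a {c κ P P₀} Cs → P₀ ⊑ P → 1 ≤ κ → 1 ≤ c → 1 ≤ a →
    All (λ C → length C ≡ c) Cs → AllPairs _⋈′_ Cs →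
    (∀ {C u} → C ∈ Cs → u ∈ P₀ → c + κ * (a + a) ≤ κ * ∑ C (joined G u)) →
    a * ((2 * κ) ^ (a + a)) ^ length Cs ≤ length P₀ → Extraction a P Cs
  extract-from-rich a {c} {κ} Cs P₀⊑P 1≤κ 1≤c 1≤a |Cs| linked rich large
    with pick-sides a {c} {κ} {a} Cs 1≤κ 1≤c 1≤a (λ C∈ → ≤-reflexive (All.lookup |Cs| C∈)) rich large
  ... | P₁ , P₁⊑P₀ , a≤P₁ , As , Ds , ps , P₁⋈As with sublist-of-length a P₁ a≤P₁
  ... | U , U⊑P₁ , |U| with ⊑-trans U⊑P₁ (⊑-trans P₁⊑P₀ P₀⊑P)
  ... | P′ , p = U , P′ , As , Ds , p , |U| , ps
    , All.map (⋈-⊑ G U⊑P₁ ⊑-refl) P₁⋈As ∷ Peel-AllPairsˡ (⋈-⊑ G) ps linked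

  extract-block : ∀ d a r {P Cs c} → 1 ≤ a → length P ≡ c → All (λ C → length C ≡ c) Cs → length Cs ≤ r →
    AllPairs _⋈′_ Cs → suc d * misses G P (concat Cs) ≤ d * (c * c) → threshold d a r ≤ c → Extraction a P Cs
  extract-block d a r {P} {Cs} {c} 1≤a |P| |Cs| Cs≤r linked few big =
    extract-from-rich a {c} {4 * suc d} {P} {P₀} Cs P₀⊑P (s≤s z≤n) 1≤c 1≤a |Cs| linked rich P₀-enough
    where
    1≤c : 1 ≤ c
    1≤c = ≤-trans 1≤a (≤-trans (a≤threshold d a r) big)
    marked = markov d c P (λ u → ∑ (concat Cs) (unjoined G u)) 1≤c
      (subst (λ k → suc d * misses G P (concat Cs) ≤ d * (k * c)) (sym |P|) few)
    P₀ = proj₁ marked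
    P₀⊑P : P₀ ⊑ P
    P₀⊑P = proj₁ (proj₂ marked)
    P₀-large : length P ≤ 2 * suc d * length P₀
    P₀-large = proj₁ (proj₂ (proj₂ marked))
    rich : ∀ {C u} → C ∈ Cs → u ∈ P₀ → c + 4 * suc d * (a + a) ≤ 4 * suc d * ∑ C (joined G u)
    rich {C} {u} C∈ u∈ = many-joined d (∑ C (joined G u)) (∑ C (unjoined G u))
      (≤-trans (threshold-side d a r) big) (trans (joined+unjoined G u C) (All.lookup |Cs| C∈))
      (≤-trans (*-monoʳ-≤ (2 * suc d) (∑-⊑ (unjoined G u) (concat-⊑ C∈))) (proj₂ (proj₂ (proj₂ marked)) u∈))
    P₀-enough : a * ((2 * (4 * suc d)) ^ (a + a)) ^ length Cs ≤ length P₀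
    P₀-enough = ≤-trans (*-monoʳ-≤ a (^-monoʳ-≤ ((2 * (4 * suc d)) ^ (a + a)) {{m^n≢0 (2 * (4 * suc d)) (a + a)}} Cs≤r))
      (*-cancelˡ-≤ (2 * suc d) (≤-trans (threshold-large d a r)
        (≤-trans big (≤-trans (≤-reflexive (sym |P|)) P₀-large))))

  blockVertices : ∀ {c j} → List (Block c j) → List (Fin n)
  blockVertices Bs = concat (map Block.vertices Bs)

  Extractions : ℕ → ℕ → ℕ → ℕ → List (Fin n) → List (List (Fin n)) → Set
  Extractions a k j q P Cs = ∃₂ λ P′ Es → P′ ⊑ P × length P′ ≡ k × (∃ λ Fs → Peel (q * a) Fs Es Cs) ×
    ∃ λ (Bs : List (Block a (suc j))) →
      length Bs ≡ q × (P′ ++ concat Es) ++ blockVertices Bs ↭ P ++ concat Cs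

  -- The missing pairs are compared with k², where k is the size of the cells left at the end.
  -- Missing pairs only disappear and all cells met on the way have size at least k, so this one
  -- hypothesis serves all q extractions. Every block takes a vertices from `P` and from each cell,
  -- which keeps the remainders equal in size.
  extract-blocks : ∀ d a r k {j} q {P Cs} → 1 ≤ a → length P ≡ q * a + k →
    All (λ C → length C ≡ q * a + k) Cs → length Cs ≡ j → j ≤ r → AllPairs _⋈′_ Cs →
    suc d * misses G P (concat Cs) ≤ d * (k * k) → threshold d a r ≤ k → Extractions a k j q P Cs
  extract-blocks d a r k zero {P} {Cs} _ |P| _ _ _ _ _ _ = P , Cs , ⊑-refl , |P| , Peel-zero Cs , [] , refl
    , ↭-reflexive (++-identityʳ (P ++ concat Cs))
  extract-blocks d a r k {j} (suc q) {P} {Cs} 1≤a |P| |Cs| count j≤r linked few big = first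
    (extract-block d a r 1≤a |P|′ |Cs|′ (≤-trans (≤-reflexive count) j≤r) linked
      (≤-trans few (*-monoʳ-≤ d (*-mono-≤ k≤ k≤))) (≤-trans big k≤))
    where
    k≤ : k ≤ a + (q * a + k)
    k≤ = ≤-trans (m≤n+m k (q * a)) (m≤n+m (q * a + k) a)
    |P|′ : length P ≡ a + (q * a + k)
    |P|′ = trans |P| (+-assoc a (q * a) k)
    |Cs|′ : All (λ C → length C ≡ a + (q * a + k)) Cs
    |Cs|′ = All.map (λ e → trans e (+-assoc a (q * a) k)) |Cs|
    first : Extraction a P Cs → Extractions a k j (suc q) P Cs
    first (U , P₁ , As , Ds , p , |U| , ps , U-linked) = second
      (extract-blocks d a r k q {P₁} {Ds} 1≤a |P₁| (Peel-sizesʳ ps |Cs|′)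
        (trans (Peel-lengthʳ ps) count) j≤r (Peel-AllPairsʳ (⋈-⊑ G) ps linked)
        (≤-trans (*-monoʳ-≤ (suc d) (misses-⊑ G P₁⊑P Ds⊑Cs)) few) big)
      where
      P₁⊑P : P₁ ⊑ P
      P₁⊑P = ⊑-resp-↭ (⊑-++ˡ U P₁) p
      Ds⊑Cs : concat Ds ⊑ concat Cs
      Ds⊑Cs = ⊑-resp-↭ (⊑-++ˡ (concat As) (concat Ds)) (Peel-concat ps)
      |P₁| : length P₁ ≡ q * a + k
      |P₁| = +-cancelˡ-≡ a _ _ (trans (cong (_+ length P₁) (sym |U|))
        (trans (sym (length-++ U)) (trans (↭-length p) |P|′)))
      block : Block a (suc j)
      block = record { cells = U ∷ As; linked = U-linked; sizes = |U| ∷ Peel-sizesˡ ps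
                     ; count = cong suc (trans (Peel-lengthˡ ps) count) }
      second : Extractions a k j q P₁ Ds → Extractions a k j (suc q) P Cs
      second (P′ , Es , P′⊑P₁ , |P′| , (Fs , qs) , Bs , |Bs| , perm) =
        P′ , Es , ⊑-trans P′⊑P₁ P₁⊑P , |P′| , Peel-trans ps qs , block ∷ Bs , cong suc |Bs|
        , ↭-trans (shifts (P′ ++ concat Es) (U ++ concat As))
          (↭-trans (++⁺ˡ (U ++ concat As) perm)
            (↭-trans (interchange-↭ U (concat As) P₁ (concat Ds)) (++⁺ p (Peel-concat ps))))

-- Tiles

concat-constant : ∀ {c} (Cs : List (List A)) → All (λ C → length C ≡ c) Cs → length (concat Cs) ≡ length Cs * c
concat-constant [] [] = refl
concat-constant (C ∷ Cs) (e ∷ es) = trans (length-++ C) (cong₂ _+_ e (concat-constant Cs es))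

concat-↭ : ∀ {xss yss : List (List A)} → xss ↭ yss → concat xss ↭ concat yss
concat-↭ Perm.refl = ↭-refl
concat-↭ (Perm.prep xs p) = ++⁺ˡ xs (concat-↭ p)
concat-↭ (Perm.swap xs ys p) = ↭-trans (shifts xs ys) (++⁺ˡ ys (++⁺ˡ xs (concat-↭ p)))
concat-↭ (Perm.trans p q) = ↭-trans (concat-↭ p) (concat-↭ q)

Peel-++ : ∀ {a} {As Ds Cs As′ Ds′ Cs′ : List (List A)} → Peel a As Ds Cs → Peel a As′ Ds′ Cs′ →
  Peel a (As ++ As′) (Ds ++ Ds′) (Cs ++ Cs′)
Peel-++ []       qs = qs
Peel-++ (p ∷ ps) qs = p ∷ Peel-++ ps qs

concatMap-++ : ∀ {B : Set} (f : B → List A) xs ys → concat (map f (xs ++ ys)) ≡ concat (map f xs) ++ concat (map f ys)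
concatMap-++ f xs ys = trans (cong concat (map-++ f xs ys)) (sym (concat-++ (map f xs) (map f ys)))

module Tiles {n} (G : Graph n) (r s m : ℕ) where

  private
    _⋈′_ = _⋈_ G
    infix 4 _⋈′_

  tot : ℕ
  tot = s + r * m

  -- Chosen so that a single top tile of scale l is worth l · `topValue` = τ(2r² + 1) for τ =
  -- `tot * l`. This pays for every loss of low tiles in `upgrade-full`, where slices of scale τ are
  -- given up for tiles of scale l.
  topValue : ℕ
  topValue = tot * suc (2 * (r * r))

  record Low (L : ℕ) : Set where
    field
      level   : ℕ
      level≤r : level ≤ r
      block   : Block G (m * L) level
    open Block block public

  record Top (L : ℕ) : Set where
    field
      small    : List (Fin n)
      |small|  : length small ≡ s * L
      block    : Block G (m * L) r
      crossing : All (small ⋈′_) (Block.cells block)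
    open Block block public using (cells; linked; sizes; count)

    vertices : List (Fin n)
    vertices = small ++ Block.vertices block

  data Tile (L : ℕ) : Set where
    low : Low L → Tile L
    top : Top L → Tile L

  tileVertices : ∀ {L} → Tile L → List (Fin n)
  tileVertices (low T) = Low.vertices T
  tileVertices (top T) = Top.vertices T

  verts : ∀ {L} → List (Tile L) → List (Fin n)
  verts ts = concat (map tileVertices ts)

  topVerts : ∀ {L} → List (Top L) → List (Fin n)
  topVerts ts = concat (map Top.vertices ts)

  weight : ∀ {L} → Tile L → ℕ
  weight (low T) = Low.level T * Low.level T
  weight (top T) = topValue

  Φ : ∀ {L} → List (Tile L) → ℕ
  Φ {L} ts = ∑ ts (λ t → L * weight t)

  |low| : ∀ {L} (T : Low L) → length (Low.vertices T) ≡ Low.level T * (m * L)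
  |low| {L} T = trans (concat-constant (Low.cells T) (Low.sizes T)) (cong (_* (m * L)) (Low.count T))

  |top| : ∀ {L} (T : Top L) → length (Top.vertices T) ≡ tot * L
  |top| {L} T = trans (length-++ (Top.small T)) (trans (cong₂ _+_ (Top.|small| T)
    (trans (concat-constant (Top.cells T) (Top.sizes T)) (cong (_* (m * L)) (Top.count T))))
    (((∀ s r m L → s * L + r * (m * L) ≡ (s + r * m) * L) ∋ solve-∀) s r m L))

  peelˡ : ∀ {a c j As Ds} (β : Block G c j) → Peel a As Ds (Block.cells β) → Block G a j
  peelˡ {As = As} β ps = record
    { cells = As ; linked = Peel-AllPairsˡ (⋈-⊑ G) ps (Block.linked β)
    ; sizes = Peel-sizesˡ ps ; count = trans (Peel-lengthˡ ps) (Block.count β) }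

  peelʳ : ∀ {a c k j As Ds} (β : Block G c j) → Peel a As Ds (Block.cells β) → c ≡ a + k → Block G k j
  peelʳ {Ds = Ds} β ps eq = record
    { cells = Ds ; linked = Peel-AllPairsʳ (⋈-⊑ G) ps (Block.linked β)
    ; sizes = Peel-sizesʳ ps (All.map (λ e → trans e eq) (Block.sizes β))
    ; count = trans (Peel-lengthʳ ps) (Block.count β) }

  splitLow : ∀ k l (T : Low (k + l)) → ∃₂ λ (T₁ : Low k) (T₂ : Low l) →
    Low.vertices T₁ ++ Low.vertices T₂ ↭ Low.vertices T × Low.level T₁ ≡ Low.level T × Low.level T₂ ≡ Low.level T
  splitLow k l T with Peel-split (m * k) (m * l) (Low.cells T)
    (All.map (λ e → trans e (*-distribˡ-+ m k l)) (Low.sizes T))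
  ... | _ , _ , ps =
    record { level≤r = Low.level≤r T ; block = peelˡ (Low.block T) ps }
    , record { level≤r = Low.level≤r T ; block = peelʳ (Low.block T) ps (*-distribˡ-+ m k l) }
    , Peel-concat ps , refl , refl

  splitTop : ∀ k l (T : Top (k + l)) → ∃₂ λ (T₁ : Top k) (T₂ : Top l) →
    Top.vertices T₁ ++ Top.vertices T₂ ↭ Top.vertices T
  splitTop k l T with Peel-split (m * k) (m * l) (Top.cells T)
      (All.map (λ e → trans e (*-distribˡ-+ m k l)) (Top.sizes T))
    | splitAt-length (s * k) (s * l) (Top.small T) (trans (Top.|small| T) (*-distribˡ-+ s k l))
  ... | As , Ds , ps | S₁ , S₂ , p , |S₁| , |S₂| =
    record { small = S₁ ; |small| = |S₁| ; block = peelˡ (Top.block T) ps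
           ; crossing = All.map (⋈-⊑ G S₁⊑ ⊑-refl) (Peel-Allˡ (⋈-⊑ G ⊑-refl) ps (Top.crossing T)) }
    , record { small = S₂ ; |small| = |S₂| ; block = peelʳ (Top.block T) ps (*-distribˡ-+ m k l)
             ; crossing = All.map (⋈-⊑ G S₂⊑ ⊑-refl) (Peel-Allʳ (⋈-⊑ G ⊑-refl) ps (Top.crossing T)) }
    , ↭-trans (interchange-↭ S₁ (concat As) S₂ (concat Ds)) (++⁺ (↭-reflexive p) (Peel-concat ps))
    where
    S₁⊑ : S₁ ⊑ Top.small T
    S₁⊑ = ⊑-resp-↭ (⊑-++ʳ S₁ S₂) (↭-reflexive p)
    S₂⊑ : S₂ ⊑ Top.small T
    S₂⊑ = ⊑-resp-↭ (⊑-++ˡ S₁ S₂) (↭-reflexive p)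

  chopTop : ∀ q l (T : Top (q * l)) → ∃ λ (ts : List (Top l)) → topVerts ts ⊑ Top.vertices T × length ts ≡ q
  chopTop zero    l T = [] , []⊑ _ , refl
  chopTop (suc q) l T with splitTop l (q * l) T
  ... | T₁ , T₂ , p with chopTop q l T₂
  ... | ts , ts⊑ , |ts| = T₁ ∷ ts , ⊑-resp-↭ (⊑-++ ⊑-refl ts⊑) p , cong suc |ts|

  chopLow : ∀ q l (T : Low (q * l)) → ∃ λ (ts : List (Tile l)) →
    verts ts ⊑ Low.vertices T × q * l * (Low.level T * Low.level T) ≤ Φ ts
  chopLow zero    l T = [] , []⊑ _ , z≤n
  chopLow (suc q) l T with splitLow l (q * l) T
  ... | T₁ , T₂ , p , e₁ , e₂ with chopLow q l T₂
  ... | ts , ts⊑ , value = low T₁ ∷ ts , ⊑-resp-↭ (⊑-++ ⊑-refl ts⊑) p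
    , ≤-trans (≤-reflexive (*-distribʳ-+ (Low.level T * Low.level T) l (q * l)))
        (+-mono-≤ (≤-reflexive (cong (λ k → l * (k * k)) (sym e₁)))
          (subst (λ k → q * l * (k * k) ≤ Φ ts) e₂ value))

  verts-tops : ∀ {L} (ts : List (Top L)) → verts (map top ts) ≡ topVerts ts
  verts-tops []       = refl
  verts-tops (t ∷ ts) = cong (Top.vertices t ++_) (verts-tops ts)

  Φ-tops : ∀ {L} (ts : List (Top L)) → Φ (map top ts) ≡ length ts * (L * topValue)
  Φ-tops {L} []       = refl
  Φ-tops {L} (t ∷ ts) = cong (L * topValue +_) (Φ-tops ts)

  chop : ∀ {L} q l → L ≡ q * l → (T : Tile L) → ∃ λ (ts : List (Tile l)) →
    verts ts ⊑ tileVertices T × L * weight T ≤ Φ ts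
  chop q l refl (low T) = chopLow q l T
  chop q l refl (top T) with chopTop q l T
  ... | ts , ts⊑ , |ts| = map top ts , ↭-resp-⊑ (↭-reflexive (verts-tops ts)) ts⊑
    , ≤-reflexive (trans (*-assoc q l topValue) (trans (cong (_* (l * topValue)) (sym |ts|)) (sym (Φ-tops ts))))

  verts-++ : ∀ {L} (ts us : List (Tile L)) → verts (ts ++ us) ≡ verts ts ++ verts us
  verts-++ = concatMap-++ tileVertices

  Φ-++ : ∀ {L} (ts us : List (Tile L)) → Φ (ts ++ us) ≡ Φ ts + Φ us
  Φ-++ {L} ts us = ∑-++ ts us (λ t → L * weight t)

  chopAll : ∀ {L} q l → L ≡ q * l → (Ts : List (Tile L)) → ∃ λ (ts : List (Tile l)) →
    verts ts ⊑ verts Ts × Φ Ts ≤ Φ ts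
  chopAll q l eq [] = [] , []⊑ _ , z≤n
  chopAll q l eq (T ∷ Ts) with chop q l eq T | chopAll q l eq Ts
  ... | ts , ts⊑ , v | us , us⊑ , w = ts ++ us
    , ↭-resp-⊑ (↭-reflexive (verts-++ ts us)) (⊑-++ ts⊑ us⊑)
    , ≤-trans (+-mono-≤ v w) (≤-reflexive (sym (Φ-++ ts us)))

  one-turn : ∀ M k {C Cs As Ds} → AllPairs _⋈′_ (C ∷ Cs) → length C ≡ s * M + k →
    Peel (m * M) As Ds Cs → length Cs ≡ r →
    ∃₂ λ (T : Top M) C′ → Top.vertices T ++ (C′ ++ concat Ds) ↭ C ++ concat Cs ×
      length C′ ≡ k × AllPairs _⋈′_ (C′ ∷ Ds)
  one-turn M k {C} {Cs} {As} {Ds} (C⋈ ∷ linked) |C| ps |Cs| with splitAt-length (s * M) k C |C|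
  ... | S , C′ , refl , |S| , |C′| =
    record { small = S ; |small| = |S|
           ; block = record { cells = As ; linked = Peel-AllPairsˡ (⋈-⊑ G) ps linked
                            ; sizes = Peel-sizesˡ ps ; count = trans (Peel-lengthˡ ps) |Cs| }
           ; crossing = All.map (⋈-⊑ G (⊑-++ʳ S C′) ⊑-refl) (Peel-Allˡ (⋈-⊑ G ⊑-refl) ps C⋈) }
    , C′ , ↭-trans (interchange-↭ S (concat As) C′ (concat Ds)) (++⁺ˡ C (Peel-concat ps)) , |C′|
    , All.map (⋈-⊑ G (⊑-++ˡ S C′) ⊑-refl) (Peel-Allʳ (⋈-⊑ G ⊑-refl) ps C⋈) ∷ Peel-AllPairsʳ (⋈-⊑ G) ps linked

  -- In turn each cell serves as the small one.  With u turns left, a cell that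
  -- has had its turn keeps u big shares, another one its small share and u ∸ 1 big ones.
  tops-in-turn : ∀ M u done {rest} → length rest ≡ u → u + length done ≡ suc r →
    All (λ C → length C ≡ u * (m * M)) done → All (λ C → length C ≡ s * M + (u ∸ 1) * (m * M)) rest →
    AllPairs _⋈′_ (rest ++ done) →
    ∃ λ (ts : List (Top M)) → topVerts ts ⊑ concat (rest ++ done) × length ts ≡ u
  tops-in-turn M zero    done _ _ _ _ _ = [] , []⊑ _ , refl
  tops-in-turn M (suc u) done {C ∷ rest} |rest| |all| done-sizes (|C| ∷ rest-sizes) linked = go
      (Peel-split (m * M) (s * M + (u ∸ 1) * (m * M)) rest shares) (Peel-split (m * M) (u * (m * M)) done done-sizes)
    where
    -- A cell besides `C` can be waiting only if u is positive, so `u ∸ 1` truncates nothing.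
    shares : All (λ C → length C ≡ m * M + (s * M + (u ∸ 1) * (m * M))) rest
    shares = reorder u (suc-injective |rest|) rest-sizes
      where
      reorder : ∀ {rest : List (List (Fin n))} u → length rest ≡ u → All (λ C → length C ≡ s * M + u * (m * M)) rest →
        All (λ C → length C ≡ m * M + (s * M + (u ∸ 1) * (m * M))) rest
      reorder _ _ [] = []
      reorder (suc u) _ es@(_ ∷ _) = All.map (λ e → trans e
        (((∀ a b c → a + (b + c) ≡ b + (a + c)) ∋ solve-∀) (s * M) (m * M) (u * (m * M)))) es
    Goal = ∃ λ (ts : List (Top M)) → topVerts ts ⊑ C ++ concat (rest ++ done) × length ts ≡ suc u
    go : (∃₂ λ As Ds → Peel (m * M) As Ds rest) → (∃₂ λ As Ds → Peel (m * M) As Ds done) → Goal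
    go (_ , Ds , ps) (_ , Ds′ , ps′) with one-turn M (u * (m * M)) linked |C| (Peel-++ ps ps′)
      (trans (length-++ rest) (trans (cong (_+ length done) (suc-injective |rest|)) (suc-injective |all|)))
    ... | T , C′ , p , |C′| , linked′
      with tops-in-turn M u (C′ ∷ Ds′) {Ds} (trans (Peel-lengthʳ ps) (suc-injective |rest|))
        (trans (cong (λ k → u + suc k) (Peel-lengthʳ ps′)) (trans (+-suc u (length done)) |all|))
        (|C′| ∷ Peel-sizesʳ ps′ done-sizes) (Peel-sizesʳ ps shares)
        (AllPairs-↭ (⋈-sym G) (↭-sym (shift C′ Ds Ds′)) linked′)
    ... | ts , ts⊑ , |ts| = T ∷ ts
      , ⊑-resp-↭ (⊑-++ ⊑-refl (⊑-resp-↭ ts⊑ (concat-↭ (shift C′ Ds Ds′)))) p , cong suc |ts|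

  -- A cell has size (s + r m) · m l: just enough to be the small cell of one top tile of scale m l
  -- and a big cell of r others. The r + 1 top tiles obtained in this way are cut into m tiles of
  -- scale l each.
  block⇒tops : ∀ l (β : Block G (m * (tot * l)) (suc r)) → ∃ λ (ts : List (Top l)) →
    topVerts ts ⊑ Block.vertices β × length ts ≡ suc r * m
  block⇒tops l β = coarse (tops-in-turn (m * l) (suc r) [] (Block.count β) (+-identityʳ (suc r)) []
      (All.map (λ e → trans e (((∀ s r m l → m * ((s + r * m) * l) ≡ s * (m * l) + r * (m * (m * l))) ∋ solve-∀) s r m l))
        (Block.sizes β))
      (subst (AllPairs _⋈′_) (sym (++-identityʳ (Block.cells β))) (Block.linked β)))
    where
    chopTops : (Ts : List (Top (m * l))) → ∃ λ (ts : List (Top l)) → topVerts ts ⊑ topVerts Ts × length ts ≡ length Ts * m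
    chopTops [] = [] , []⊑ _ , refl
    chopTops (T ∷ Ts) with chopTop m l T | chopTops Ts
    ... | ts , ts⊑ , |ts| | us , us⊑ , |us| = ts ++ us
      , ↭-resp-⊑ (↭-reflexive (concatMap-++ Top.vertices ts us)) (⊑-++ ts⊑ us⊑)
      , trans (length-++ ts) (cong₂ _+_ |ts| |us|)
    coarse : (∃ λ (Ts : List (Top (m * l))) → topVerts Ts ⊑ concat (Block.cells β ++ []) × length Ts ≡ suc r) →
      ∃ λ (ts : List (Top l)) → topVerts ts ⊑ Block.vertices β × length ts ≡ suc r * m
    coarse (Ts , Ts⊑ , |Ts|) with chopTops Ts
    ... | ts , ts⊑ , |ts| = ts
      , ⊑-trans ts⊑ (⊑-resp-↭ Ts⊑ (↭-reflexive (cong concat (++-identityʳ (Block.cells β)))))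
      , trans |ts| (cong (_* m) |Ts|)

  bigLevel : ∀ {L} → Tile L → ℕ
  bigLevel (low T) = Low.level T
  bigLevel (top T) = r

  bigLevel≤r : ∀ {L} (T : Tile L) → bigLevel T ≤ r
  bigLevel≤r (low T) = Low.level≤r T
  bigLevel≤r (top T) = ≤-refl

  bigBlock : ∀ {L} (T : Tile L) → Block G (m * L) (bigLevel T)
  bigBlock (low T) = Low.block T
  bigBlock (top T) = Top.block T

  bigs : ∀ {L} → Tile L → List (Fin n)
  bigs T = Block.vertices (bigBlock T)

  bigs⊑ : ∀ {L} (T : Tile L) → bigs T ⊑ tileVertices T
  bigs⊑ (low T) = ⊑-refl
  bigs⊑ (top T) = ⊑-++ˡ (Top.small T) (Block.vertices (Top.block T))

  module _ (1≤r : 1 ≤ r) (s<m : s < m) (l : ℕ) where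

    private
      τ = tot * l

    l≤τ : l ≤ τ
    l≤τ = m≤n*m l tot {{>-nonZero (≤-trans (≤-trans (s≤s z≤n) s<m) (≤-trans (≤-trans (m≤m*n m r {{>-nonZero 1≤r}})
      (≤-reflexive (*-comm m r))) (m≤n+m (r * m) s)))}}

    -- The balance for one block. Slices of scale τ of a low tile with i + 1 cells and of a tile of
    -- weight w are given up; in return there are tiles of value v made from the block, and the i
    -- cells of the low tile that the block does not touch. The surplus is at least l.
    Gain : ℕ → ℕ → ℕ → Set
    Gain i w v = τ * (suc i * suc i) + τ * w + l ≤ v + τ * (i * i)

    Upgraded : ∀ {j} → Block G (m * τ) (suc j) → Set
    Upgraded {j} β = ∃ λ (ts : List (Tile l)) → verts ts ⊑ Block.vertices β ×
      (∀ i → suc i ≤ j → Gain i (j * j) (Φ ts)) × (j ≡ r → ∀ i → suc i ≤ r → Gain i topValue (Φ ts))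

    -- Convexity: (j + 1)² + i² exceeds (i + 1)² + j² by 2(j - i), which is at least 2 for i < j.
    upgrade-low : ∀ {j} → j < r → (β : Block G (m * τ) (suc j)) → Upgraded β
    upgrade-low {j} j<r β = lows (chop tot l refl (low T))
      where
      T : Low τ
      T = record { level = suc j ; level≤r = j<r ; block = β }
      lows : (∃ λ (ts : List (Tile l)) → verts ts ⊑ Block.vertices β × τ * (suc j * suc j) ≤ Φ ts) → Upgraded β
      lows (ts , ts⊑ , value) = ts , ts⊑ , gain , λ j≡r → ⊥-elim (<⇒≢ j<r j≡r)
        where
        gain : ∀ i → suc i ≤ j → Gain i (j * j) (Φ ts)
        gain i i<j = ≤-cert _ _ τ (+-mono-≤ value (+-mono-≤ l≤τ (*-monoʳ-≤ (2 * τ) i<j)))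
          (((∀ τ i j l f → τ * (suc i * suc i) + τ * (j * j) + l + (f + (τ + 2 * τ * j)) + τ
             ≡ f + τ * (i * i) + (τ * (suc j * suc j) + (l + 2 * τ * suc i))) ∋ solve-∀) τ i j l (Φ ts))

    -- A slice of scale τ of a top tile is worth `tot` top tiles of scale l, while the block yields
    -- (r + 1) m ≥ `tot` + 1 of them because s < m. The additional one pays for the low tile and for
    -- the surplus. If the other tile is low with r cells, one top tile alone is enough.
    upgrade-full : (β : Block G (m * τ) (suc r)) → Upgraded β
    upgrade-full β = tops (block⇒tops l β)
      where
      tops : (∃ λ (ts : List (Top l)) → topVerts ts ⊑ Block.vertices β × length ts ≡ suc r * m) → Upgraded β
      tops (ts , ts⊑ , |ts|) = map top ts , ↭-resp-⊑ (↭-reflexive (verts-tops ts)) ts⊑ , low-gain , λ _ → top-gain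
        where
        V = l * topValue
        value : suc r * m * V ≤ Φ (map top ts)
        value = ≤-reflexive (trans (cong (_* V) (sym |ts|)) (sym (Φ-tops ts)))
        squares : ∀ i → suc i ≤ r → τ * (suc i * suc i) ≤ τ * (r * r)
        squares i i<r = *-monoʳ-≤ τ (*-mono-≤ i<r i<r)
        V-expand : V ≡ τ + 2 * (τ * (r * r))
        V-expand = ((∀ l t x → l * (t * suc (2 * x)) ≡ t * l + 2 * (t * l * x)) ∋ solve-∀) l tot (r * r)
        V≤ : V ≤ suc r * m * V
        V≤ = m≤n*m V (suc r * m) {{>-nonZero (≤-trans (≤-trans (s≤s z≤n) s<m) (m≤n*m m (suc r)))}}
        low-gain : ∀ i → suc i ≤ r → Gain i (r * r) (Φ (map top ts))
        low-gain i i<r = begin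
          τ * (suc i * suc i) + τ * (r * r) + l ≤⟨ +-mono-≤ (+-monoˡ-≤ _ (squares i i<r)) l≤τ ⟩
          τ * (r * r) + τ * (r * r) + τ         ≡⟨ ((∀ x τ → x + x + τ ≡ τ + 2 * x) ∋ solve-∀) (τ * (r * r)) τ ⟩
          τ + 2 * (τ * (r * r))                 ≡⟨ sym V-expand ⟩
          V                                     ≤⟨ ≤-trans V≤ value ⟩
          Φ (map top ts)                        ≤⟨ m≤m+n _ _ ⟩
          Φ (map top ts) + τ * (i * i)          ∎
          where open ≤-Reasoning
        top-gain : ∀ i → suc i ≤ r → Gain i topValue (Φ (map top ts))
        top-gain i i<r = begin
          τ * (suc i * suc i) + τ * topValue + l        ≤⟨ +-mono-≤ (+-monoˡ-≤ _ (squares i i<r)) l≤τ ⟩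
          τ * (r * r) + τ * topValue + τ                ≤⟨ m≤m+n _ (τ * (r * r)) ⟩
          τ * (r * r) + τ * topValue + τ + τ * (r * r)  ≡⟨ ((∀ x y τ → x + y + τ + x ≡ τ + 2 * x + y) ∋ solve-∀) (τ * (r * r)) (τ * topValue) τ ⟩
          τ + 2 * (τ * (r * r)) + τ * topValue          ≡⟨ cong₂ _+_ (sym V-expand) (*-assoc tot l topValue) ⟩
          suc tot * V                                   ≤⟨ *-monoˡ-≤ V (+-monoˡ-≤ (r * m) s<m) ⟩
          suc r * m * V                                 ≤⟨ value ⟩
          Φ (map top ts)                                ≤⟨ m≤m+n _ _ ⟩
          Φ (map top ts) + τ * (i * i)                  ∎
          where open ≤-Reasoning

    -- A slice of a tile with j big cells together with a slice of a cell of a low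
    -- tile with suc i cells.
    upgrade : ∀ {j} → j ≤ r → (β : Block G (m * τ) (suc j)) → Upgraded β
    upgrade j≤r with m≤n⇒m<n∨m≡n j≤r
    ... | inj₁ j<r  = upgrade-low j<r
    ... | inj₂ refl = upgrade-full

-- Retiling a dense pair

shuffle : ∀ (S X P Y E B : List A) → (X ++ (P ++ Y)) ++ ((S ++ E) ++ B) ↭ (X ++ Y) ++ (S ++ ((P ++ E) ++ B))
shuffle {A} = solve 6 (λ S X P Y E B →
    ((X ⊕ (P ⊕ Y)) ⊕ ((S ⊕ E) ⊕ B)) ⊜ ((X ⊕ Y) ⊕ (S ⊕ ((P ⊕ E) ⊕ B)))) ↭-refl
  where open CommutativeMonoidSolver (++-commutativeMonoid {A = A})

shuffle′ : ∀ (S P O C : List A) → O ++ (S ++ (P ++ C)) ↭ (P ++ O) ++ (S ++ C)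
shuffle′ {A} = solve 4 (λ S P O C → (O ⊕ (S ⊕ (P ⊕ C))) ⊜ ((P ⊕ O) ⊕ (S ⊕ C))) ↭-refl
  where open CommutativeMonoidSolver (++-commutativeMonoid {A = A})

module Retiling {n} (G : Graph n) (r s m : ℕ) (1≤r : 1 ≤ r) (s<m : s < m) (l : ℕ) where
  open Tiles G r s m

  private
    _⋈′_ = _⋈_ G
    infix 4 _⋈′_
    τ = tot * l

  upgrades : ∀ {L} i (T : Tile L) → suc i ≤ bigLevel T → (Bs : List (Block G (m * τ) (suc (bigLevel T)))) →
    ∃ λ (ts : List (Tile l)) → verts ts ⊑ blockVertices G Bs ×
      length Bs * (τ * (suc i * suc i) + τ * weight T + l) ≤ Φ ts + length Bs * (τ * (i * i))
  upgrades i T up [] = [] , []⊑ _ , z≤n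
  upgrades i T up (B ∷ Bs) with upgrade 1≤r s<m l (bigLevel≤r T) B | upgrades i T up Bs
  ... | ts , ts⊑ , low-gain , top-gain | us , us⊑ , gains = ts ++ us
    , ↭-resp-⊑ (↭-reflexive (verts-++ ts us)) (⊑-++ ts⊑ us⊑)
    , ≤-trans (+-mono-≤ (gain T low-gain top-gain up) gains)
        (≤-reflexive (trans (((∀ a b c d → a + b + (c + d) ≡ (a + c) + (b + d)) ∋ solve-∀) (Φ ts) (τ * (i * i)) (Φ us) _)
          (cong (_+ suc (length Bs) * (τ * (i * i))) (sym (Φ-++ ts us)))))
    where
    gain : ∀ {L} (T : Tile L) → (∀ i → suc i ≤ bigLevel T → Gain 1≤r s<m l i (bigLevel T * bigLevel T) (Φ ts)) →
      (bigLevel T ≡ r → ∀ i → suc i ≤ r → Gain 1≤r s<m l i topValue (Φ ts)) → suc i ≤ bigLevel T →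
      Gain 1≤r s<m l i (weight T) (Φ ts)
    gain (low T) low-gain _ up = low-gain i up
    gain (top T) _ top-gain up = top-gain refl i up

  m-distrib : ∀ q k → m * (q * τ + k) ≡ q * (m * τ) + m * k
  m-distrib q k = ((∀ m q τ k → m * (q * τ + k) ≡ q * (m * τ) + m * k) ∋ solve-∀) m q τ k

  -- When big cells of a top tile have been used up in part, the corresponding share `S₀` of its
  -- small cell is thrown away to restore the proportions. The balance in `Gain` allows for this: it
  -- counts the whole slice of the top tile as lost.
  shrink : ∀ q k (T : Tile (q * τ + k)) {Fs Es} → Peel (q * (m * τ)) Fs Es (Block.cells (bigBlock T)) →
    ∃ λ (T₁ : Tile k) → weight T₁ ≡ weight T ×
    ∃₂ λ S′ S → S′ ⊑ S × tileVertices T₁ ≡ S′ ++ concat Es × tileVertices T ≡ S ++ bigs T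
  shrink q k (low T) ps = low (record { level≤r = Low.level≤r T ; block = peelʳ (Low.block T) ps (m-distrib q k) })
    , refl , [] , [] , ⊑-refl , refl , refl
  shrink q k (top T) ps with splitAt-length (s * (q * τ)) (s * k) (Top.small T) (trans (Top.|small| T) (*-distribˡ-+ s (q * τ) k))
  ... | S₀ , S′ , refl , _ , |S′| = top (record
      { small = S′ ; |small| = |S′| ; block = peelʳ (Top.block T) ps (m-distrib q k)
      ; crossing = All.map (⋈-⊑ G (⊑-++ˡ S₀ S′) ⊑-refl) (Peel-Allʳ (⋈-⊑ G ⊑-refl) ps (Top.crossing T)) })
    , refl , S′ , S₀ ++ S′ , ⊑-++ˡ S₀ S′ , refl , refl

  Retiled : ∀ {L} → ℕ → ℕ → List (Fin n) → Tile L → Set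
  Retiled {L} q i X T = ∃ λ (ts : List (Tile l)) → verts ts ⊑ X ++ tileVertices T ×
    L * (suc i * suc i) + L * weight T + q * l ≤ Φ ts

  -- The q blocks use up `q * (m * τ)` vertices of `P` and of each big cell of `T`. The slices of
  -- `Os` that lose their partner in `P` become a tile with i cells, and the rest of either tile
  -- keeps its shape at scale `k * l`. The latter two change nothing in the potential, so the gain
  -- is l for each block.
  retile : ∀ d q k i P Os → let L = q * τ + k * l in (T : Tile L) → 1 ≤ l → suc i ≤ r →
    AllPairs _⋈′_ (P ∷ Os) → All (λ C → length C ≡ m * L) (P ∷ Os) → length Os ≡ i → suc i ≤ bigLevel T →
    suc d * misses G P (bigs T) ≤ d * (m * (k * l) * (m * (k * l))) → threshold d (m * τ) r ≤ m * (k * l) →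
    Retiled q i (P ++ concat Os) T
  retile d q k i P Os T 1≤l i<r (P⋈ ∷ linked) (|P| ∷ |Os|) count up few big =
    go (extract-blocks G d (m * τ) r (m * (k * l)) q 1≤mτ (trans |P| (m-distrib q (k * l)))
          (All.map (λ e → trans e (m-distrib q (k * l))) (Block.sizes (bigBlock T)))
          (Block.count (bigBlock T)) (bigLevel≤r T) (Block.linked (bigBlock T)) few big)
       (Peel-split (q * (m * τ)) (m * (k * l)) Os (All.map (λ e → trans e (m-distrib q (k * l))) |Os|))
    where
    L = q * τ + k * l
    1≤mτ : 1 ≤ m * τ
    1≤mτ = *-mono-≤ (≤-trans (s≤s z≤n) s<m) (≤-trans 1≤l (l≤τ 1≤r s<m l))
    go : Extractions G (m * τ) (m * (k * l)) (bigLevel T) q P (Block.cells (bigBlock T)) →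
      (∃₂ λ Xs Ys → Peel (q * (m * τ)) Xs Ys Os) → Retiled q i (P ++ concat Os) T
    go (P′ , Es , P′⊑P , |P′| , (_ , es) , Bs , |Bs| , perm) (Xs , Ys , ps) = rebuild (shrink q (k * l) T es)
      where
      T₋ : Low (q * τ)
      T₋ = record { level = i ; level≤r = ≤-trans (n≤1+n i) i<r ; block = record
          { cells = Xs ; linked = Peel-AllPairsˡ (⋈-⊑ G) ps linked
          ; sizes = All.map (λ e → trans e (((∀ q m t → q * (m * t) ≡ m * (q * t)) ∋ solve-∀) q m τ)) (Peel-sizesˡ ps)
          ; count = trans (Peel-lengthˡ ps) count } }
      T₊ : Low (k * l)
      T₊ = record { level = suc i ; level≤r = i<r ; block = record
          { cells = P′ ∷ Ys ; linked = All.map (⋈-⊑ G P′⊑P ⊑-refl) (Peel-Allʳ (⋈-⊑ G ⊑-refl) ps P⋈) ∷ Peel-AllPairsʳ (⋈-⊑ G) ps linked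
          ; sizes = |P′| ∷ Peel-sizesʳ ps (All.map (λ e → trans e (m-distrib q (k * l))) |Os|)
          ; count = cong suc (trans (Peel-lengthʳ ps) count) } }
      rebuild : (∃ λ (T₁ : Tile (k * l)) → weight T₁ ≡ weight T ×
        ∃₂ λ S′ S → S′ ⊑ S × tileVertices T₁ ≡ S′ ++ concat Es × tileVertices T ≡ S ++ bigs T) →
        Retiled q i (P ++ concat Os) T
      rebuild (T₁ , wT , S′ , S , S′⊑S , vT₁ , vT) =
        assemble (chop (q * tot) l (sym (*-assoc q tot l)) (low T₋)) (chop k l refl (low T₊)) (chop k l refl T₁) (upgrades i T up Bs)
        where
        assemble : (∃ λ (ts : List (Tile l)) → verts ts ⊑ concat Xs × q * τ * (i * i) ≤ Φ ts) →
            (∃ λ (ts : List (Tile l)) → verts ts ⊑ P′ ++ concat Ys × k * l * (suc i * suc i) ≤ Φ ts) →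
            (∃ λ (ts : List (Tile l)) → verts ts ⊑ tileVertices T₁ × k * l * weight T₁ ≤ Φ ts) →
            (∃ λ (ts : List (Tile l)) → verts ts ⊑ blockVertices G Bs ×
              length Bs * (τ * (suc i * suc i) + τ * weight T + l) ≤ Φ ts + length Bs * (τ * (i * i))) →
            Retiled q i (P ++ concat Os) T
        assemble (ts₁ , ts₁⊑ , v₁) (ts₂ , ts₂⊑ , v₂) (ts₃ , ts₃⊑ , v₃) (ts₄ , ts₄⊑ , v₄) =
            (ts₁ ++ ts₂) ++ (ts₃ ++ ts₄)
            , ↭-resp-⊑ (↭-reflexive (trans (verts-++ (ts₁ ++ ts₂) (ts₃ ++ ts₄)) (cong₂ _++_ (verts-++ ts₁ ts₂) (verts-++ ts₃ ts₄))))
                (⊑-trans (⊑-++ (⊑-++ ts₁⊑ ts₂⊑) (⊑-++ (⊑-resp-↭ ts₃⊑ (↭-reflexive vT₁)) ts₄⊑))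
                (↭-resp-⊑ (shuffle S′ (concat Xs) P′ (concat Ys) (concat Es) (blockVertices G Bs))
                (⊑-trans (⊑-++ (⊑-reflexive (Peel-concat ps)) (⊑-++ S′⊑S (⊑-reflexive perm)))
                (⊑-reflexive (↭-trans (shuffle′ S P (concat Os) (bigs T)) (++⁺ˡ (P ++ concat Os) (↭-reflexive (sym vT))))))))
            , ≤-trans (≤-cert _ _ 0
                (+-mono-≤ (subst (λ b → b * (τ * (suc i * suc i) + τ * weight T + l) ≤ Φ ts₄ + b * (τ * (i * i))) |Bs| v₄)
                  (+-mono-≤ v₁ (+-mono-≤ v₂ (subst (λ w → k * l * w ≤ Φ ts₃) wT v₃))))
                (((∀ q τ x w l f₁ f₂ f₃ f₄ i κ →
                    (q * τ + κ) * x + (q * τ + κ) * w + q * l + (f₄ + q * (τ * i) + (f₁ + (f₂ + f₃))) + 0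
                    ≡ (f₁ + f₂ + (f₃ + f₄)) + (q * (τ * x + τ * w + l) + (q * τ * i + (κ * x + κ * w)))) ∋ solve-∀)
                  q τ (suc i * suc i) (weight T) l (Φ ts₁) (Φ ts₂) (Φ ts₃) (Φ ts₄) (i * i) (k * l)))
              (≤-reflexive (sym (trans (Φ-++ (ts₁ ++ ts₂) (ts₃ ++ ts₄)) (cong₂ _+_ (Φ-++ ts₁ ts₂) (Φ-++ ts₃ ts₄)))))

-- The scales and the gain of a round

module Scales (r s m E′ : ℕ) where

  private tot = s + r * m

  -- The number of blocks cut from a pair of tiles. Letting it equal the threshold makes the
  -- remainders automatically exceed the threshold, as `rest` is a multiple of it.
  units : ℕ → ℕ
  units l = threshold (suc (2 * E′)) (m * (tot * l)) r

  -- This is 3 + 4E′ times what the blocks use, so they take only 1/(4E′ + 4) of each cell. If at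
  -- most E′/(E′+1) of the pairs of full cell size are missing, then at most (2E′+1)/(2E′+2) of the
  -- pairs of remaining cell size are: the squared ratio of sizes is at least 1 - 1/(2E′+2), and the
  -- square of (2E′+1)/(2E′+2) is at least E′/(E′+1).
  rest : ℕ → ℕ
  rest l = (3 + 4 * E′) * (units l * tot)

  next : ℕ → ℕ
  next l = units l * (tot * l) + rest l * l

  next-multiple : ∀ l → next l ≡ (units l * tot + rest l) * l
  next-multiple l = ((∀ z t l k → z * (t * l) + k * l ≡ (z * t + k) * l) ∋ solve-∀) (units l) tot l (rest l)

  -- With L = `next l`, a merge gains `units l * l` = L/(4(E′+1) · tot). A round makes ⌊n / (4(E′+1)
  -- · tot · L)⌋ merges, and rounding down costs at most a factor 2; hence 32 = 4 · 4 · 2.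
  growth : ℕ
  growth = 32 * (suc E′ * suc E′ * (tot * tot))

  -- The first summand makes the m L vertices that filling may leave out negligible, the second
  -- allows at least one merge.
  lowerBound : ℕ → ℕ
  lowerBound l = suc (2 * suc E′ * (m * next l)) + 4 * suc E′ * (tot * next l)

  scale : ℕ → ℕ → ℕ
  scale L₀ zero    = L₀
  scale L₀ (suc k) = next (scale L₀ k)

  1≤next : 1 ≤ m → 1 ≤ tot → ∀ {l} → 1 ≤ l → 1 ≤ next l
  1≤next 1≤m 1≤tot 1≤l = ≤-trans (*-mono-≤ (≤-trans (*-mono-≤ 1≤m (*-mono-≤ 1≤tot 1≤l)) (a≤threshold (suc (2 * E′)) _ r)) (*-mono-≤ 1≤tot 1≤l)) (m≤m+n _ _)

module Pairing {n} (G : Graph n) (r s m e E′ : ℕ) (1≤r : 1 ≤ r) (s<m : s < m) (1+E′ : suc E′ ≡ 2 * (e * m)) where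
  open Tiles G r s m
  open Scales r s m E′

  1≤m : 1 ≤ m
  1≤m = ≤-trans (s≤s z≤n) s<m

  1≤tot : 1 ≤ tot
  1≤tot = ≤-trans (*-mono-≤ 1≤r 1≤m) (m≤n+m (r * m) s)

  tileLength≤ : ∀ {L} (T : Tile L) → length (tileVertices T) ≤ tot * L
  tileLength≤ {L} (low T) = begin
    length (Low.vertices T) ≡⟨ |low| T ⟩
    Low.level T * (m * L)   ≤⟨ *-monoˡ-≤ (m * L) (Low.level≤r T) ⟩
    r * (m * L)             ≡⟨ sym (*-assoc r m L) ⟩
    r * m * L               ≤⟨ *-monoˡ-≤ L (m≤n+m (r * m) s) ⟩
    tot * L                 ∎
    where open ≤-Reasoning
  tileLength≤ (top T) = ≤-reflexive (|top| T)

  -- As 1 + E′ = 2em, this bounds the share of missing pairs by m/tot - 1/(2e · tot), halfway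
  -- between m/tot and the bound m/tot - 1/(e · tot) that the degree condition gives for a vertex.
  -- One half of the margin is spent on uncovered vertices in `not-sparse`, the other on the
  -- shrinking of cells in `sparse-cell`.
  Dense : List (Fin n) → List (Fin n) → Set
  Dense X Y = 2 * e * tot * misses G X Y < E′ * (length X * length Y)

  Dense-sym : ∀ {X Y} → Dense X Y → Dense Y X
  Dense-sym {X} {Y} = subst₂ (λ k j → 2 * e * tot * k < E′ * j) (misses-sym G X Y) (*-comm (length X) (length Y))

  module _ (l : ℕ) (1≤l : 1 ≤ l) where
    open Retiling G r s m 1≤r s<m l

    private
      L = next l

    Merged : ℕ → List (Fin n) → Set
    Merged w X = ∃ λ (ts : List (Tile l)) → verts ts ⊑ X × w + units l * l ≤ Φ ts

    enough : threshold (suc (2 * E′)) (m * (tot * l)) r ≤ m * (rest l * l)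
    enough = ≤-trans (≤-trans (m≤m*n (units l) tot {{>-nonZero 1≤tot}})
      (≤-trans (m≤n*m (units l * tot) (3 + 4 * E′)) (m≤m*n (rest l) l {{>-nonZero 1≤l}})))
      (m≤n*m (rest l * l) m {{>-nonZero 1≤m}})

    -- After cancelling suc i and multiplying by m, the factor 2em becomes 1 + E′, and `P` misses at
    -- most E′/(E′+1) of (m L)² pairs. The proportion chosen in `rest` turns this into the bound for
    -- the remainders.
    sparse-cell : ∀ P Y i → 2 * e * (suc i * misses G P Y) ≤ E′ * (suc i * (m * L) * L) →
      suc (suc (2 * E′)) * misses G P Y ≤ suc (2 * E′) * (m * (rest l * l) * (m * (rest l * l)))
    sparse-cell P Y i h = ≤-cert _ _ (W * (10 * E′ + 9))
        (*-monoʳ-≤ 2 (subst₂ _≤_ lhs refl (*-monoʳ-≤ m cancelled)))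
        (((∀ M z t l E m → suc (suc (2 * E)) * M
            + 2 * (m * (E * (m * (z * (t * l) + (3 + 4 * E) * (z * t) * l) * (z * (t * l) + (3 + 4 * E) * (z * t) * l))))
            + m * m * (z * t * l) * (z * t * l) * (10 * E + 9)
            ≡ suc (2 * E) * (m * ((3 + 4 * E) * (z * t) * l) * (m * ((3 + 4 * E) * (z * t) * l)))
              + 2 * (suc E * M)) ∋ solve-∀) M (units l) tot l E′ m)
      where
      M = misses G P Y
      W = m * m * (units l * tot * l) * (units l * tot * l)
      cancelled : 2 * e * M ≤ E′ * (m * L * L)
      cancelled = *-cancelˡ-≤ (suc i) (≤-trans (≤-reflexive (((∀ i e M → suc i * (2 * e * M) ≡ 2 * e * (suc i * M)) ∋ solve-∀) i e M))
        (≤-trans h (≤-reflexive (((∀ i E m L → E * (suc i * m * L) ≡ suc i * (E * (m * L))) ∋ solve-∀) i E′ (m * L) L))))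
      lhs : m * (2 * e * M) ≡ suc E′ * M
      lhs = trans (((∀ m e M → m * (2 * e * M) ≡ 2 * (e * m) * M) ∋ solve-∀) m e M) (cong (_* M) (sym 1+E′))

    merge-oriented : ∀ i (T′ : Low L) → Low.level T′ ≡ suc i → (T : Tile L) → suc i ≤ bigLevel T →
      Dense (Low.vertices T′) (tileVertices T) →
      Merged (L * (Low.level T′ * Low.level T′) + L * weight T) (Low.vertices T′ ++ tileVertices T)
    merge-oriented i T′ level≡ T up dense = choose (Low.cells T′) refl
      where
      Cs = Low.cells T′
      summed : 2 * e * ∑ Cs (λ C → misses G C (bigs T)) ≤ E′ * (suc i * (m * L) * L)
      summed = *-cancelˡ-≤ tot {{>-nonZero 1≤tot}} (begin
        tot * (2 * e * ∑ Cs (λ C → misses G C (bigs T)))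
          ≡⟨ ((∀ t e x → t * (2 * e * x) ≡ 2 * e * t * x) ∋ solve-∀) tot e _ ⟩
        2 * e * tot * ∑ Cs (λ C → misses G C (bigs T))
          ≡⟨ cong (2 * e * tot *_) (sym (∑-concat Cs (λ u → ∑ (bigs T) (unjoined G u)))) ⟩
        2 * e * tot * misses G (Low.vertices T′) (bigs T)
          ≤⟨ *-monoʳ-≤ (2 * e * tot) (misses-⊑ G {X = Low.vertices T′} ⊑-refl (bigs⊑ T)) ⟩
        2 * e * tot * misses G (Low.vertices T′) (tileVertices T)
          ≤⟨ <⇒≤ dense ⟩
        E′ * (length (Low.vertices T′) * length (tileVertices T))
          ≤⟨ *-monoʳ-≤ E′ (*-mono-≤ (≤-reflexive (trans (|low| T′) (cong (_* (m * L)) level≡))) (tileLength≤ T)) ⟩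
        E′ * (suc i * (m * L) * (tot * L))
          ≡⟨ ((∀ E x t L → E * (x * (t * L)) ≡ t * (E * (x * L))) ∋ solve-∀) E′ (suc i * (m * L)) tot L ⟩
        tot * (E′ * (suc i * (m * L) * L)) ∎)
        where open ≤-Reasoning
      Goal = Merged (L * (Low.level T′ * Low.level T′) + L * weight T) (Low.vertices T′ ++ tileVertices T)
      with-cell : ∀ P → P ∈ Cs → length Cs * misses G P (bigs T) ≤ ∑ Cs (λ C → misses G C (bigs T)) → Goal
      with-cell P P∈ avg = split (∈⇒↭ P∈)
        where
        count : length Cs ≡ suc i
        count = trans (Low.count T′) level≡
        split : (∃ λ Os → P ∷ Os ↭ Cs) → Goal
        split (Os , p) = finish (retile (suc (2 * E′)) (units l) (rest l) i P Os T 1≤l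
            (≤-trans (≤-reflexive (sym level≡)) (Low.level≤r T′))
            (AllPairs-↭ (⋈-sym G) (↭-sym p) (Low.linked T′)) (All-resp-↭ (↭-sym p) (Low.sizes T′))
            (suc-injective (trans (↭-length p) count)) up
            (sparse-cell P (bigs T) i (≤-trans (*-monoʳ-≤ (2 * e) (subst (λ c → c * misses G P (bigs T) ≤ ∑ Cs (λ C → misses G C (bigs T))) count avg)) summed))
            enough)
          where
          finish : Retiled (units l) i (P ++ concat Os) T → Goal
          finish (ts , ts⊑ , gain) = ts , ⊑-resp-↭ ts⊑ (++⁺ʳ (tileVertices T) (concat-↭ p))
            , subst (λ j → L * (j * j) + L * weight T + units l * l ≤ Φ ts) (sym level≡) gain
      choose : ∀ Ds → Ds ≡ Cs → Goal
      choose [] eq = ⊥-elim (0≢1+n (trans (cong length eq) (trans (Low.count T′) level≡)))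
      choose (D ∷ Ds) eq = pick (∃-≤average D Ds (λ C → misses G C (bigs T)))
        where
        pick : (∃ λ P → P ∈ D ∷ Ds × length (D ∷ Ds) * misses G P (bigs T) ≤ ∑ (D ∷ Ds) (λ C → misses G C (bigs T))) → Goal
        pick (P , P∈ , avg) = with-cell P (subst (P ∈_) eq P∈)
          (subst (λ Cs → length Cs * misses G P (bigs T) ≤ ∑ Cs (λ C → misses G C (bigs T))) eq avg)

    merge-levelled : ∀ i (T′ : Low L) → Low.level T′ ≡ i → (T : Tile L) → i ≤ bigLevel T →
      Dense (Low.vertices T′) (tileVertices T) →
      Merged (L * (Low.level T′ * Low.level T′) + L * weight T) (Low.vertices T′ ++ tileVertices T)
    -- `Dense` is strict, so a tile without vertices does not satisfy it.
    merge-levelled zero T′ level≡ T up dense = ⊥-elim (m<n⇒n≢0 dense (trans (cong (λ k → E′ * (k * length (tileVertices T)))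
      (trans (|low| T′) (cong (_* (m * L)) level≡))) (*-zeroʳ E′)))
    merge-levelled (suc i) T′ = merge-oriented i T′

    -- The tile with at most as many big cells as the other has to give one up. A top tile has the
    -- most possible, and two low tiles can exchange their roles because density is symmetric.
    merge : ∀ (T′ : Low L) (T : Tile L) → Dense (Low.vertices T′) (tileVertices T) →
      Merged (L * (Low.level T′ * Low.level T′) + L * weight T) (Low.vertices T′ ++ tileVertices T)
    merge T′ T dense with Low.level T′ ≤? bigLevel T
    merge T′ T       dense | yes le = merge-levelled (Low.level T′) T′ refl T le dense
    merge T′ (top T) dense | no  gt = ⊥-elim (gt (Low.level≤r T′))
    merge T′ (low T) dense | no  gt = swapped (merge-levelled (Low.level T) T refl (low T′) (≰⇒≥ gt)
      (Dense-sym {Low.vertices T′} {Low.vertices T} dense))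
      where
      swapped : Merged (L * (Low.level T * Low.level T) + L * weight (low T′)) (Low.vertices T ++ Low.vertices T′) →
        Merged (L * (Low.level T′ * Low.level T′) + L * weight (low T)) (Low.vertices T′ ++ Low.vertices T)
      swapped (ts , ts⊑ , gain) = ts , ⊑-resp-↭ ts⊑ (++-comm (Low.vertices T) (Low.vertices T′))
        , subst (λ k → k + units l * l ≤ Φ ts) (+-comm (L * (Low.level T * Low.level T)) _) gain

-- Rounds of retiling

module Rounds {n} (G : Graph n) (r s m e E′ : ℕ) (1≤r : 1 ≤ r) (s<m : s < m) (1+E′ : suc E′ ≡ 2 * (e * m))
  (few : ∀ v → e * (s + r * m) * ∑ (allFin n) (unjoined G v) + n ≤ e * m * n) where
  open Tiles G r s m
  open Scales r s m E′
  open Pairing G r s m e E′ 1≤r s<m 1+E′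

  private
    V = allFin n
    |V| : length V ≡ n
    |V| = length-tabulate id

  -- Tiles with one cell need no edges, so uncovered vertices, among them those thrown away by
  -- earlier rounds, can always be brought back.
  fill : ∀ {L} → 1 ≤ L → ∀ fuel (X : List (Fin n)) → length X ≤ fuel →
    ∃ λ (ts : List (Tile L)) → verts ts ⊑ X × length X ≤ length (verts ts) + m * L
  fill {L} 1≤L fuel X |X|≤ with length X ≤? m * L
  ... | yes small = [] , []⊑ X , small
  fill {L} 1≤L zero X |X|≤ | no large = ⊥-elim (large (≤-trans |X|≤ z≤n))
  fill {L} 1≤L (suc fuel) X |X|≤ | no large with splitAt-length (m * L) (length X ∸ m * L) X (sym (m+[n∸m]≡n (≰⇒≥ large)))
  ... | C , Y , refl , |C| , |Y| with fill {L} 1≤L fuel Y (s≤s⁻¹ (≤-trans (s≤s (m≤n+m (length Y) 0)) (≤-trans Y<X |X|≤)))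
    where
    Y<X : length Y < length (C ++ Y)
    Y<X = ≤-trans (+-monoˡ-≤ (length Y) (≤-trans (*-mono-≤ 1≤m 1≤L) (≤-reflexive (sym |C|)))) (≤-reflexive (sym (length-++ C)))
  ... | ts , ts⊑ , covered = low T ∷ ts
    , ⊑-++ (⊑-reflexive (↭-reflexive (++-identityʳ C))) ts⊑
    , (begin
      length (C ++ Y)                               ≡⟨ length-++ C ⟩
      length C + length Y                           ≤⟨ +-monoʳ-≤ (length C) covered ⟩
      length C + (length (verts ts) + m * L)        ≡⟨ sym (+-assoc (length C) _ _) ⟩
      length C + length (verts ts) + m * L          ≡⟨ cong (λ c → c + length (verts ts) + m * L) (cong length (sym (++-identityʳ C))) ⟩
      length (C ++ []) + length (verts ts) + m * L  ≡⟨ cong (_+ m * L) (sym (length-++ (C ++ []))) ⟩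
      length ((C ++ []) ++ verts ts) + m * L        ∎)
    where
    open ≤-Reasoning
    T : Low L
    T = record { level = 1 ; level≤r = 1≤r ; block = record { cells = C ∷ [] ; linked = [] ∷ [] ; sizes = |C| ∷ [] ; count = refl } }

  verts-↭ : ∀ {L} {ts us : List (Tile L)} → ts ↭ us → verts ts ↭ verts us
  verts-↭ p = concat-↭ (map⁺ tileVertices p)

  Φ-↭ : ∀ {L} {ts us : List (Tile L)} → ts ↭ us → Φ ts ≡ Φ us
  Φ-↭ p = ∑-↭ _ p

  -- Retiling a tile with one cell leaves tiles without cells. Hence the search is for a low tile
  -- with a vertex; if there is none, the top tiles cover everything.
  find-low : ∀ {L} (A : List (Tile L)) →
    (∃ λ (ts : List (Top L)) → topVerts ts ⊑ verts A × length (verts A) ≤ length (topVerts ts)) ⊎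
    (∃₂ λ (T : Low L) A′ → low T ∷ A′ ↭ A × 1 ≤ length (Low.vertices T))
  find-low [] = inj₁ ([] , ⊑-refl , z≤n)
  find-low (low T ∷ A) with 1 ≤? length (Low.vertices T)
  ... | yes nonempty = inj₂ (T , A , ↭-refl , nonempty)
  ... | no  empty with find-low A
  ...   | inj₁ (ts , ts⊑ , covered) = inj₁ (ts , ⊑-trans ts⊑ (⊑-++ˡ (Low.vertices T) (verts A))
    , ≤-trans (≤-reflexive (trans (length-++ (Low.vertices T)) (cong (_+ length (verts A)) (n<1⇒n≡0 (≰⇒> empty))))) covered)
  ...   | inj₂ (T′ , A′ , p , nonempty) = inj₂ (T′ , low T ∷ A′ , ↭-trans (↭-swap _ _ ↭-refl) (↭-prep _ p) , nonempty)
  find-low (top T ∷ A) with find-low A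
  ... | inj₁ (ts , ts⊑ , covered) = inj₁ (T ∷ ts , ⊑-++ ⊑-refl ts⊑
    , subst₂ _≤_ (sym (length-++ (Top.vertices T))) (sym (length-++ (Top.vertices T))) (+-monoʳ-≤ _ covered))
  ... | inj₂ (T′ , A′ , p , nonempty) = inj₂ (T′ , top T ∷ A′ , ↭-trans (↭-swap _ _ ↭-refl) (↭-prep _ p) , nonempty)

  -- Missing pairs and products of sizes add up over the tiles, so if no tile is dense to `X`, their
  -- union is not either.
  find-dense : ∀ {L} (X : List (Fin n)) (A : List (Tile L)) →
    (∃₂ λ T A′ → T ∷ A′ ↭ A × Dense X (tileVertices T)) ⊎
    E′ * (length X * length (verts A)) ≤ 2 * e * tot * misses G X (verts A)
  find-dense X [] = inj₂ (≤-trans (≤-reflexive (trans (cong (E′ *_) (*-zeroʳ (length X))) (*-zeroʳ E′))) z≤n)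
  find-dense X (T ∷ A) with 2 * e * tot * misses G X (tileVertices T) <? E′ * (length X * length (tileVertices T))
  ... | yes dense = inj₁ (T , A , ↭-refl , dense)
  ... | no  sparse with find-dense X A
  ...   | inj₁ (T′ , A′ , p , dense) = inj₁ (T′ , T ∷ A′ , ↭-trans (↭-swap _ _ ↭-refl) (↭-prep _ p) , dense)
  ...   | inj₂ rest-sparse = inj₂ (begin
    E′ * (length X * length (tileVertices T ++ verts A))
      ≡⟨ cong (λ k → E′ * (length X * k)) (length-++ (tileVertices T)) ⟩
    E′ * (length X * (length (tileVertices T) + length (verts A)))
      ≡⟨ ((∀ E x a b → E * (x * (a + b)) ≡ E * (x * a) + E * (x * b)) ∋ solve-∀) E′ (length X) (length (tileVertices T)) (length (verts A)) ⟩
    E′ * (length X * length (tileVertices T)) + E′ * (length X * length (verts A))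
      ≤⟨ +-mono-≤ (≮⇒≥ sparse) rest-sparse ⟩
    c * misses G X (tileVertices T) + c * misses G X (verts A)
      ≡⟨ sym (*-distribˡ-+ c (misses G X (tileVertices T)) (misses G X (verts A))) ⟩
    c * (misses G X (tileVertices T) + misses G X (verts A))
      ≡⟨ cong (c *_) (sym (∑-+ X _ _)) ⟩
    c * ∑ X (λ u → ∑ (tileVertices T) (unjoined G u) + ∑ (verts A) (unjoined G u))
      ≡⟨ cong (c *_) (∑-cong X (λ u → sym (∑-++ (tileVertices T) (verts A) (unjoined G u)))) ⟩
    c * misses G X (tileVertices T ++ verts A) ∎)
    where
    open ≤-Reasoning
    c = 2 * e * tot

  -- By the degree condition, 2e · tot times the missing pairs is at most (E′ - 1) n for each vertex
  -- of `X`. Sparsity would give E′ · |Y| ≤ (E′ - 1) n, whereas `Y` leaves out at most `B` vertices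
  -- and E′ · B < n.
  not-sparse : ∀ {X Y B} → 1 ≤ length X → Y ⊑ V → n ≤ length Y + B → E′ * B < n →
    ¬ E′ * (length X * length Y) ≤ 2 * e * tot * misses G X Y
  not-sparse {X} {Y} {B} nonempty Y⊑ n≤ B-small sparse = <⇒≱ B-small
    (≤-cert n (E′ * B) 0 (+-mono-≤ (*-monoʳ-≤ E′ n≤) cancelled)
      (((∀ n E y B → n + (E * (y + B) + suc E * n) + 0 ≡ E * B + (E * n + (E * y + 2 * n))) ∋ solve-∀) n E′ (length Y) B))
    where
    x = length X
    y = length Y
    M = misses G X Y
    degrees : e * tot * M + x * n ≤ x * (e * m * n)
    degrees = begin
      e * tot * M + x * n                                  ≤⟨ +-monoˡ-≤ (x * n) (*-monoʳ-≤ (e * tot) (misses-⊑ G {X = X} ⊑-refl Y⊑)) ⟩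
      e * tot * misses G X V + x * n                       ≡⟨ cong₂ _+_ (sym (∑-*ˡ (e * tot) X _)) (sym (∑-const X n)) ⟩
      ∑ X (λ u → e * tot * ∑ V (unjoined G u)) + ∑ X (λ _ → n) ≡⟨ sym (∑-+ X _ _) ⟩
      ∑ X (λ u → e * tot * ∑ V (unjoined G u) + n)         ≤⟨ ∑-mono X (λ {u} _ → few u) ⟩
      ∑ X (λ _ → e * m * n)                                ≡⟨ ∑-const X (e * m * n) ⟩
      x * (e * m * n)                                      ∎
      where open ≤-Reasoning
    cancelled : E′ * y + 2 * n ≤ suc E′ * n
    cancelled = *-cancelˡ-≤ x {{>-nonZero nonempty}} (≤-cert _ _ 0 (+-mono-≤ sparse (*-monoʳ-≤ 2 degrees))
      (trans (((∀ x E y n e t m M → x * (E * y + 2 * n) + (2 * e * t * M + 2 * (x * (e * m * n))) + 0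
          ≡ x * (2 * (e * m) * n) + (E * (x * y) + 2 * (e * t * M + x * n))) ∋ solve-∀) x E′ y n e tot m M)
        (cong (λ k → x * (k * n) + (E′ * (x * y) + 2 * (e * tot * M + x * n))) (sym 1+E′))))

  Success : ℕ → Set
  Success L = ∃₂ λ (ts : List (Top L)) B → topVerts ts ⊑ V × n ≤ length (topVerts ts) + B × E′ * B < n

  chopSuccess : ∀ q l → Success (q * l) → Success l
  chopSuccess q l (Ts , B , Ts⊑ , n≤ , B-small) with chopTops Ts
    where
    chopTops : (Ts : List (Top (q * l))) → ∃ λ (ts : List (Top l)) → topVerts ts ⊑ topVerts Ts ×
      length (topVerts Ts) ≤ length (topVerts ts)
    chopTops [] = [] , ⊑-refl , z≤n
    chopTops (T ∷ Ts) with chopTop q l T | chopTops Ts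
    ... | ts , ts⊑ , |ts| | us , us⊑ , le = ts ++ us
      , ↭-resp-⊑ (↭-reflexive (concatMap-++ Top.vertices ts us)) (⊑-++ ts⊑ us⊑)
      , (begin
        length (Top.vertices T ++ topVerts Ts)                 ≡⟨ length-++ (Top.vertices T) ⟩
        length (Top.vertices T) + length (topVerts Ts)         ≤⟨ +-mono-≤ (≤-reflexive same) le ⟩
        length (topVerts ts) + length (topVerts us)            ≡⟨ sym (length-++ (topVerts ts)) ⟩
        length (topVerts ts ++ topVerts us)                    ≡⟨ cong length (sym (concatMap-++ Top.vertices ts us)) ⟩
        length (topVerts (ts ++ us))                           ∎)
      where
      open ≤-Reasoning
      total : ∀ {l} (ts : List (Top l)) → length (topVerts ts) ≡ length ts * (tot * l)
      total [] = refl
      total (t ∷ ts) = trans (length-++ (Top.vertices t)) (cong₂ _+_ (|top| t) (total ts))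
      same : length (Top.vertices T) ≡ length (topVerts ts)
      same = trans (|top| T) (trans (((∀ t q l → t * (q * l) ≡ q * (t * l)) ∋ solve-∀) tot q l)
        (trans (cong (_* (tot * l)) (sym |ts|)) (sym (total ts))))
  ... | ts , ts⊑ , le = ts , B , ⊑-trans ts⊑ Ts⊑ , ≤-trans n≤ (+-monoˡ-≤ B le) , B-small

  module _ (l : ℕ) (1≤l : 1 ≤ l) where

    private
      L = next l

    Improved : ℕ → Set
    Improved w = ∃ λ (ts : List (Tile l)) → verts ts ⊑ V × w ≤ Φ ts

    -- `A` holds the tiles of scale L not yet used in this round, `D` the tiles of scale l produced
    -- so far. A merge takes two tiles, at most 2 · tot · L vertices, out of `A`; with the reserve p
    -- · 2 · tot · L in the hypothesis, `A` covers all but `B` vertices throughout.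
    improve : ∀ B → E′ * B < n → ∀ p (A : List (Tile L)) (D : List (Tile l)) → verts D ++ verts A ⊑ V →
      n + p * (2 * (tot * L)) ≤ length (verts A) + B →
      Success L ⊎ Improved (Φ D + Φ A + p * (units l * l))
    improve B B-small zero A D ⊑V _ with chopAll (units l * tot + rest l) l (next-multiple l) A
    ... | ts , ts⊑ , le = inj₂ (D ++ ts
      , ↭-resp-⊑ (↭-reflexive (verts-++ D ts)) (⊑-trans (⊑-++ ⊑-refl ts⊑) ⊑V)
      , ≤-trans (≤-reflexive (+-identityʳ _)) (≤-trans (+-monoʳ-≤ (Φ D) le) (≤-reflexive (sym (Φ-++ D ts)))))
    improve B B-small (suc p) A D ⊑V large = first (find-low A)
      where
      A⊑V : verts A ⊑ V
      A⊑V = ⊑-trans (⊑-++ˡ (verts D) (verts A)) ⊑V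
      Goal = Success L ⊎ Improved (Φ D + Φ A + suc p * (units l * l))
      second : ∀ (T : Low L) A′ → low T ∷ A′ ↭ A → 1 ≤ length (Low.vertices T) →
        (∃₂ λ T′ A″ → T′ ∷ A″ ↭ A′ × Dense (Low.vertices T) (tileVertices T′)) ⊎
        E′ * (length (Low.vertices T) * length (verts A′)) ≤ 2 * e * tot * misses G (Low.vertices T) (verts A′) → Goal
      -- Removing `T` uses at most half of the reserve for one merge, so `A′` is still large enough
      -- for `not-sparse`.
      second T A′ perm nonempty (inj₂ sparse) = ⊥-elim (not-sparse {Low.vertices T} {verts A′} {B} nonempty
        (⊑-trans (⊑-resp-↭ (⊑-++ˡ (Low.vertices T) (verts A′)) (verts-↭ perm)) A⊑V)
        (≤-cert n (length (verts A′) + B) (suc (2 * p) * (tot * L))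
          (+-mono-≤ large (+-mono-≤ (≤-reflexive (sym (trans (sym (length-++ (Low.vertices T))) (↭-length (verts-↭ perm))))) (tileLength≤ (low T))))
          (((∀ n a a′ b x t p → n + (a + b + (x + a′ + t)) + suc (2 * p) * t
            ≡ a′ + b + (n + suc p * (2 * t) + (a + x))) ∋ solve-∀) n (length (verts A)) (length (verts A′)) B (length (Low.vertices T)) (tot * L) p)) B-small sparse)
      second T A′ perm nonempty (inj₁ (T′ , A″ , perm′ , dense)) = third (merge l 1≤l T T′ dense)
        where
        whole : low T ∷ T′ ∷ A″ ↭ A
        whole = ↭-trans (↭-prep (low T) perm′) perm
        third : Merged l 1≤l (L * (Low.level T * Low.level T) + L * weight T′) (Low.vertices T ++ tileVertices T′) → Goal
        third (ts , ts⊑ , gain) = fourth (improve B B-small p A″ (ts ++ D) inside large′)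
          where
          inside : verts (ts ++ D) ++ verts A″ ⊑ V
          inside = ⊑-trans (↭-resp-⊑ (++⁺ʳ (verts A″) (↭-reflexive (verts-++ ts D)))
            (⊑-++ (⊑-++ ts⊑ (⊑-refl {xs = verts D})) (⊑-refl {xs = verts A″})))
            (↭-resp-⊑ (↭-trans (↭-trans (↭-reflexive (++-assoc′ X (verts D) (verts A″))) (shifts X (verts D)))
              (++⁺ˡ (verts D) (↭-trans (↭-reflexive (++-assoc′ (Low.vertices T) (tileVertices T′) (verts A″))) (verts-↭ whole)))) ⊑V)
            where X = Low.vertices T ++ tileVertices T′
          large′ : n + p * (2 * (tot * L)) ≤ length (verts A″) + B
          large′ = ≤-cert _ _ 0 (+-mono-≤ large (+-mono-≤ (≤-reflexive (sym split)) (+-mono-≤ (tileLength≤ (low T)) (tileLength≤ T′))))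
            (((∀ n p t a a″ b x y → n + p * (2 * t) + (a + b + (x + (y + a″) + (t + t))) + 0
               ≡ a″ + b + (n + suc p * (2 * t) + (a + (x + y)))) ∋ solve-∀)
              n p (tot * L) (length (verts A)) (length (verts A″)) B (length (Low.vertices T)) (length (tileVertices T′)))
            where
            split : length (Low.vertices T) + (length (tileVertices T′) + length (verts A″)) ≡ length (verts A)
            split = trans (cong (length (Low.vertices T) +_) (sym (length-++ (tileVertices T′))))
              (trans (sym (length-++ (Low.vertices T))) (↭-length (verts-↭ whole)))
          fourth : Success L ⊎ Improved (Φ (ts ++ D) + Φ A″ + p * (units l * l)) → Goal
          fourth (inj₁ success) = inj₁ success
          fourth (inj₂ (us , us⊑ , le)) = inj₂ (us , us⊑ , ≤-trans (≤-cert _ _ 0 gain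
            (trans (cong (λ k → Φ D + k + suc p * (units l * l) + Φ ts + 0) (sym (Φ-↭ whole)))
            (((∀ d w w′ a p u f → d + (w + (w′ + a)) + suc p * u + f + 0 ≡ f + d + a + p * u + (w + w′ + u)) ∋ solve-∀)
              (Φ D) (L * (Low.level T * Low.level T)) (L * weight T′) (Φ A″) p (units l * l) (Φ ts))))
            (≤-trans (≤-reflexive (cong (λ k → k + Φ A″ + p * (units l * l)) (sym (Φ-++ ts D)))) le))
      first : (∃ λ (ts : List (Top L)) → topVerts ts ⊑ verts A × length (verts A) ≤ length (topVerts ts)) ⊎
        (∃₂ λ (T : Low L) A′ → low T ∷ A′ ↭ A × 1 ≤ length (Low.vertices T)) → Goal
      first (inj₁ (ts , ts⊑ , covered)) = inj₁ (ts , B , ⊑-trans ts⊑ A⊑V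
        , ≤-trans (≤-trans (m≤m+n n _) large) (+-monoˡ-≤ B covered) , B-small)
      first (inj₂ (T , A′ , perm , nonempty)) = second T A′ perm nonempty (find-dense (Low.vertices T) A′)

    step : ℕ
    step = 4 * suc E′ * (tot * L)

    round : 1 ≤ L → lowerBound l ≤ n → (ts : List (Tile L)) → verts ts ⊑ V →
      Success L ⊎ ∃ λ (us : List (Tile l)) → verts us ⊑ V × growth * Φ ts + n ≤ growth * Φ us
    round 1≤L n-large ts (X , p⊑) = from-fill (fill 1≤L (length X) X ≤-refl)
      where
      instance
        step≢0 : NonZero step
        step≢0 = >-nonZero (*-mono-≤ {1} {4 * suc E′} (s≤s z≤n) (*-mono-≤ 1≤tot 1≤L))
      p = n / step
      -- The vertices that p merges take away, and those that filling leaves out.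
      B = p * (2 * (tot * L)) + m * L
      1≤p : 1 ≤ p
      1≤p = m≥n⇒m/n>0 (≤-trans (m≤n+m step (suc (2 * suc E′ * (m * L)))) n-large)
      B-small : E′ * B < n
      B-small = ≤-<-trans (*-monoˡ-≤ B (n≤1+n E′)) (*-cancelˡ-< 2 _ _ (begin-strict
        2 * (suc E′ * B)                           ≡⟨ ((∀ E p t x → 2 * (E * (p * (2 * t) + x)) ≡ p * (4 * E * t) + 2 * E * x) ∋ solve-∀) (suc E′) p (tot * L) (m * L) ⟩
        p * step + 2 * suc E′ * (m * L)            <⟨ +-mono-≤-< (m/n*n≤m n step) (≤-trans (m≤m+n _ step) n-large) ⟩
        n + n                                      ≡⟨ cong (n +_) (sym (+-identityʳ n)) ⟩
        2 * n                                      ∎))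
        where open ≤-Reasoning
      gained : n ≤ growth * (p * (units l * l))
      gained = begin
        n                  ≤⟨ ≤-trans (≤-reflexive (m≡m%n+[m/n]*n n step)) (+-monoˡ-≤ (p * step) (<⇒≤ (m%n<n n step))) ⟩
        suc p * step       ≤⟨ *-monoˡ-≤ step (+-monoˡ-≤ p 1≤p) ⟩
        (p + p) * step     ≡⟨ ((∀ p E t z l → (p + p) * (4 * suc E * (t * (z * (t * l) + (3 + 4 * E) * (z * t) * l)))
                                ≡ 32 * (suc E * suc E * (t * t)) * (p * (z * l))) ∋ solve-∀) p E′ tot (units l) l ⟩
        growth * (p * (units l * l)) ∎
        where open ≤-Reasoning
      Goal = Success L ⊎ ∃ λ (us : List (Tile l)) → verts us ⊑ V × growth * Φ ts + n ≤ growth * Φ us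
      from-fill : (∃ λ (fs : List (Tile L)) → verts fs ⊑ X × length X ≤ length (verts fs) + m * L) → Goal
      from-fill (fs , fs⊑ , covered) = conclude (improve B B-small p (ts ++ fs) [] filled⊑V enough-covered)
        where
        filled⊑V : verts (ts ++ fs) ⊑ V
        filled⊑V = ↭-resp-⊑ (↭-reflexive (verts-++ ts fs)) (⊑-resp-↭ (⊑-++ ⊑-refl fs⊑) p⊑)
        enough-covered : n + p * (2 * (tot * L)) ≤ length (verts (ts ++ fs)) + B
        enough-covered = ≤-cert _ _ 0 (+-mono-≤ (≤-reflexive (trans (sym |V|) (trans (sym (↭-length p⊑)) (length-++ (verts ts))))) covered)
          (trans (((∀ n q a x f y → n + q + (a + x + (f + y)) + 0 ≡ (a + f) + (q + y) + (n + x)) ∋ solve-∀)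
              n (p * (2 * (tot * L))) (length (verts ts)) (length X) (length (verts fs)) (m * L))
            (cong (λ k → k + B + (n + length X)) (sym (trans (cong length (verts-++ ts fs)) (length-++ (verts ts))))))
        conclude : Success L ⊎ Improved (Φ {l} [] + Φ (ts ++ fs) + p * (units l * l)) → Goal
        conclude (inj₁ success) = inj₁ success
        conclude (inj₂ (us , us⊑ , le)) = inj₂ (us , us⊑ , (begin
          growth * Φ ts + n                                             ≤⟨ +-mono-≤ (*-monoʳ-≤ growth (m≤m+n (Φ ts) (Φ fs))) gained ⟩
          growth * (Φ ts + Φ fs) + growth * (p * (units l * l))         ≡⟨ sym (*-distribˡ-+ growth (Φ ts + Φ fs) _) ⟩
          growth * (Φ ts + Φ fs + p * (units l * l))                    ≡⟨ cong (λ k → growth * (k + p * (units l * l))) (sym (Φ-++ ts fs)) ⟩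
          growth * (Φ (ts ++ fs) + p * (units l * l))                   ≤⟨ *-monoʳ-≤ growth le ⟩
          growth * Φ us                                                 ∎))
          where open ≤-Reasoning

  -- A low tile with j cells is worth j² L and has at least j L vertices, where j ≤ r; a top tile is
  -- worth L · `topValue` and has at least L vertices.
  Φ-bound : ∀ {L} (ts : List (Tile L)) → Φ ts ≤ (r + topValue) * length (verts ts)
  Φ-bound [] = z≤n
  Φ-bound {L} (t ∷ ts) = begin
    L * weight t + Φ ts                                                    ≤⟨ +-mono-≤ (single t) (Φ-bound ts) ⟩
    c * length (tileVertices t) + c * length (verts ts)                    ≡⟨ sym (*-distribˡ-+ c (length (tileVertices t)) _) ⟩
    c * (length (tileVertices t) + length (verts ts))                      ≡⟨ cong (c *_) (sym (length-++ (tileVertices t))) ⟩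
    c * length (tileVertices t ++ verts ts)                                ∎
    where
    open ≤-Reasoning
    c = r + topValue
    single : ∀ t → L * weight t ≤ c * length (tileVertices t)
    single (low T) = begin
      L * (j * j)                    ≡⟨ ((∀ L j → L * (j * j) ≡ j * (j * L)) ∋ solve-∀) L j ⟩
      j * (j * L)                    ≤⟨ *-mono-≤ (≤-trans (Low.level≤r T) (m≤m+n r topValue)) (*-monoʳ-≤ j (m≤n*m L m {{>-nonZero 1≤m}})) ⟩
      c * (j * (m * L))              ≡⟨ cong (c *_) (sym (|low| T)) ⟩
      c * length (Low.vertices T)    ∎
      where j = Low.level T
    single (top T) = begin
      L * topValue                   ≡⟨ *-comm L topValue ⟩
      topValue * L                   ≤⟨ *-mono-≤ (m≤n+m topValue r) (m≤n*m L tot {{>-nonZero 1≤tot}}) ⟩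
      c * (tot * L)                  ≡⟨ cong (c *_) (sym (|top| T)) ⟩
      c * length (Top.vertices T)    ∎

  -- After k more rounds the potential would exceed its upper bound c n.
  module _ (L₀ : ℕ) (1≤L₀ : 1 ≤ L₀) (1≤n : 1 ≤ n) where

    c = r + topValue

    1≤scale : ∀ k → 1 ≤ scale L₀ k
    1≤scale zero    = 1≤L₀
    1≤scale (suc k) = 1≤next 1≤m 1≤tot (1≤scale k)

    descend : ∀ k → Success (scale L₀ k) → Success L₀
    descend zero    success = success
    descend (suc k) success = descend k (chopSuccess (units l * tot + rest l) l (subst Success (next-multiple l) success))
      where l = scale L₀ k

    iterate : ∀ k → (∀ i → i < k → lowerBound (scale L₀ i) ≤ n) → (ts : List (Tile (scale L₀ k))) → verts ts ⊑ V →
      suc (growth * c) * n ≤ growth * Φ ts + k * n → Success L₀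
    iterate zero _ ts ts⊑ high = ⊥-elim (<⇒≱ (m<n+m (growth * c * n) 1≤n) (begin
      suc (growth * c) * n                 ≤⟨ high ⟩
      growth * Φ ts + 0                    ≡⟨ +-identityʳ _ ⟩
      growth * Φ ts                        ≤⟨ *-monoʳ-≤ growth (≤-trans (Φ-bound ts) (*-monoʳ-≤ c (≤-trans (length-⊑ ts⊑) (≤-reflexive |V|)))) ⟩
      growth * (c * n)                     ≡⟨ sym (*-assoc growth c n) ⟩
      growth * c * n                       ∎))
      where open ≤-Reasoning
    iterate (suc k) n-large ts ts⊑ high = next-round (round l (1≤scale k) (1≤scale (suc k)) (n-large k ≤-refl) ts ts⊑)
      where
      l = scale L₀ k
      next-round : Success (next l) ⊎ (∃ λ (us : List (Tile l)) → verts us ⊑ V × growth * Φ ts + n ≤ growth * Φ us) → Success L₀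
      next-round (inj₁ success) = descend (suc k) success
      next-round (inj₂ (us , us⊑ , grown)) = iterate k (λ i i<k → n-large i (≤-trans i<k (n≤1+n k))) us us⊑
        (≤-trans high (≤-trans (≤-reflexive (((∀ f n k → f + suc k * n ≡ f + n + k * n) ∋ solve-∀) (growth * Φ ts) n k)) (+-monoˡ-≤ (k * n) grown)))

-- The number of rounds and all scales depend on r, s, m, e and `L₀` only, so `n₀` can be chosen
-- before the graph. The degree condition says that a vertex has at most (m/tot - 1/(e · tot)) n
-- non-neighbours, itself included, and at most n/e vertices are missed.
topTiling : ∀ r s m e L₀ → 1 ≤ r → s < m → 1 ≤ e → 1 ≤ L₀ → ∃ λ n₀ → ∀ n → n₀ ≤ n → (G : Graph n) →
  (∀ v → e * (s + r * m) * ∑ (allFin n) (unjoined G v) + n ≤ e * m * n) →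
  ∃ λ (ts : List (Tiles.Top G r s m L₀)) → Tiles.topVerts G r s m ts ⊑ allFin n ×
    e * n ≤ e * length (Tiles.topVerts G r s m ts) + n
topTiling r s m e L₀ 1≤r s<m 1≤e 1≤L₀ = suc (bound rounds) , tile
  where
  E′ = 2 * (e * m) ∸ 1
  open Scales r s m E′
  1≤em : 1 ≤ e * m
  1≤em = *-mono-≤ 1≤e (≤-trans (s≤s z≤n) s<m)
  1+E′ : suc E′ ≡ 2 * (e * m)
  1+E′ = m+[n∸m]≡n (≤-trans 1≤em (m≤m+n (e * m) _))
  e≤E′ : e ≤ E′
  e≤E′ = s≤s⁻¹ (≤-trans (≤-cert (suc e) (2 * (e * m)) 0
      (+-mono-≤ 1≤em (m≤m*n e m {{>-nonZero (≤-trans (s≤s z≤n) s<m)}}))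
      (((∀ e x → suc e + (x + x) + 0 ≡ 2 * x + (1 + e)) ∋ solve-∀) e (e * m))) (≤-reflexive (sym 1+E′)))
  -- This is r + `topValue`, spelled out because it is needed before `G` is given.
  c = r + (s + r * m) * suc (2 * (r * r))
  rounds = suc (growth * c)
  bound : ℕ → ℕ
  bound zero    = 0
  bound (suc k) = lowerBound (scale L₀ k) + bound k
  bound-large : ∀ {i k} → i < k → lowerBound (scale L₀ i) ≤ bound k
  bound-large {i} {suc k} i<1+k with m≤n⇒m<n∨m≡n (s≤s⁻¹ i<1+k)
  ... | inj₁ i<k  = ≤-trans (bound-large i<k) (m≤n+m (bound k) (lowerBound (scale L₀ k)))
  ... | inj₂ refl = m≤m+n (lowerBound (scale L₀ k)) (bound k)
  tile : ∀ n → suc (bound rounds) ≤ n → (G : Graph n) →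
    (∀ v → e * (s + r * m) * ∑ (allFin n) (unjoined G v) + n ≤ e * m * n) →
    ∃ λ (ts : List (Tiles.Top G r s m L₀)) → Tiles.topVerts G r s m ts ⊑ allFin n ×
      e * n ≤ e * length (Tiles.topVerts G r s m ts) + n
  tile n n-large G few = conclude (iterate L₀ 1≤L₀ (≤-trans (s≤s z≤n) n-large) rounds
      (λ i i<k → ≤-trans (bound-large i<k) (≤-trans (n≤1+n _) n-large)) [] ([]⊑ _)
      (≤-reflexive (cong (_+ rounds * n) (sym (*-zeroʳ growth)))))
    where
    open Rounds G r s m e E′ 1≤r s<m 1+E′ few
    conclude : Success L₀ → ∃ λ (ts : List (Tiles.Top G r s m L₀)) → Tiles.topVerts G r s m ts ⊑ allFin n ×
      e * n ≤ e * length (Tiles.topVerts G r s m ts) + n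
    conclude (ts , B , ts⊑ , n≤ , B-small) = ts , ts⊑ , ≤-trans (*-monoʳ-≤ e n≤)
      (≤-trans (≤-reflexive (*-distribˡ-+ e _ B)) (+-monoʳ-≤ _ (≤-trans (*-monoˡ-≤ B e≤E′) (<⇒≤ B-small))))

-- Sorting permutations

∈-map-allFin : ∀ {N} {B : Set} (f : Fin N → B) x → f x ∈ map f (allFin N)
∈-map-allFin f x = ∈-map⁺ f (∈-allFin x)

Unique-map-allFin : ∀ {N} {B : Set} {f : Fin N → B} → (∀ {x y} → f x ≡ f y → x ≡ y) → Unique (map f (allFin N))
Unique-map-allFin {N} inj = Uniqueₚ.map⁺ inj (Uniqueₚ.allFin⁺ N)

length-map-allFin : ∀ {N} {B : Set} (f : Fin N → B) → length (map f (allFin N)) ≡ N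
length-map-allFin {N} f = trans (length-map f (allFin N)) (length-tabulate id)

map-allFin-↭ : ∀ {N} {f : Fin N → Fin N} → (∀ {x y} → f x ≡ f y → x ≡ y) → map f (allFin N) ↭ allFin N
map-allFin-↭ {N} {f} inj = ⊑-length⇒↭ (Unique⇒⊑ (Unique-map-allFin inj) (λ {x} _ → ∈-allFin x))
  (≤-reflexive (trans (length-tabulate id) (sym (length-map-allFin f))))

injective⇒permutation : ∀ {N} (f : Fin N → Fin N) → (∀ {x y} → f x ≡ f y → x ≡ y) →
  ∃ λ (π : Permutation′ N) → ∀ x → π ⟨$⟩ʳ x ≡ f x
injective⇒permutation {N} f inj = permutation f (proj₁ ∘ preimage) (proj₂ ∘ preimage) (λ x → inj (proj₂ (preimage (f x)))) , λ _ → refl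
  where
  preimage : ∀ y → ∃ λ x → f x ≡ y
  preimage y with ∈-map⁻ f (∈-resp-↭ (↭-sym (map-allFin-↭ inj)) (∈-allFin y))
  ... | x , _ , eq = x , sym eq

Sorts : ∀ {N} → Permutation′ N → (Fin N → ℕ) → Set
Sorts π key = ∀ x y → key x < key y → (π ⟨$⟩ʳ x) Fin.< (π ⟨$⟩ʳ y)

abstract
  sorting : ∀ {N} (key : Fin N → ℕ) → (∀ {x y} → key x ≡ key y → x ≡ y) → ∃ λ π → Sorts π key
  sorting {N} key inj = proj₁ ranked , λ x y x<y →
      subst₂ Fin._<_ (sym (proj₂ ranked x)) (sym (proj₂ ranked y)) (rank-mono x<y)
    where
    below : Fin N → List (Fin N)
    below x = filter (λ y → key y <? key x) (allFin N)
    mono : ∀ {x y} → key x < key y → length (below x) < length (below y)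
    mono {x} {y} x<y = length-⊑ {xs = x ∷ below x} (Unique⇒⊑
      (All.tabulate (λ z∈ x≡z → <-irrefl (cong key (sym x≡z)) (proj₂ (∈-filter⁻ (λ z → key z <? key x) {xs = allFin N} z∈)))
        ∷ Uniqueₚ.filter⁺ (λ z → key z <? key x) (Uniqueₚ.allFin⁺ N)) sub)
      where
      sub : ∀ {z} → z ∈ x ∷ below x → z ∈ below y
      sub (here refl) = ∈-filter⁺ (λ z → key z <? key y) (∈-allFin _) x<y
      sub {z} (there z∈) = ∈-filter⁺ (λ z → key z <? key y) (∈-allFin z)
        (<-trans (proj₂ (∈-filter⁻ (λ z → key z <? key x) {xs = allFin N} z∈)) x<y)
    below<N : ∀ x → length (below x) < N
    below<N x = ≤-trans (length-⊑ {xs = x ∷ below x} (Unique⇒⊑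
      (All.tabulate (λ z∈ x≡z → <-irrefl (cong key (sym x≡z)) (proj₂ (∈-filter⁻ (λ z → key z <? key x) {xs = allFin N} z∈)))
        ∷ Uniqueₚ.filter⁺ (λ z → key z <? key x) (Uniqueₚ.allFin⁺ N)) (λ {z} _ → ∈-allFin z))) (≤-reflexive (length-tabulate id))
    rank : Fin N → Fin N
    rank x = fromℕ< (below<N x)
    rank-mono : ∀ {x y} → key x < key y → rank x Fin.< rank y
    rank-mono {x} {y} x<y = subst₂ _<_ (sym (Fin.toℕ-fromℕ< (below<N x))) (sym (Fin.toℕ-fromℕ< (below<N y))) (mono x<y)
    rank-injective : ∀ {x y} → rank x ≡ rank y → x ≡ y
    rank-injective {x} {y} eq with <-cmp (key x) (key y)
    ... | tri< lt _ _ = ⊥-elim (<-irrefl (cong toℕ eq) (rank-mono lt))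
    ... | tri≈ _ eq′ _ = inj eq′
    ... | tri> _ _ gt = ⊥-elim (<-irrefl (cong toℕ (sym eq)) (rank-mono gt))
    ranked : ∃ λ (π : Permutation′ N) → ∀ x → π ⟨$⟩ʳ x ≡ rank x
    ranked = injective⇒permutation rank rank-injective

-- Embedding a blow-up

union : ∀ {k} {A : Set} → (Fin k → List A) → List A
union {k} D = concat (map D (allFin k))

∈-union : ∀ {k} {D : Fin k → List A} i {x} → x ∈ D i → x ∈ union D
∈-union {D = D} i x∈ = ∈-concat⁺′ x∈ (∈-map-allFin D i)

length-union : ∀ {k} (D : Fin k → List A) → length (union D) ≡ ∑ (allFin k) (length ∘ D)
length-union {k = k} D = trans (length-concat (map D (allFin k))) (∑-map D (allFin k) length)

lookup-AllPairs : ∀ {R : A → A → Set} {xs} → AllPairs R xs → ∀ {i j} → i Fin.< j → R (lookup xs i) (lookup xs j)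
lookup-AllPairs (h ∷ _) {zero}  {suc j} _         = All.lookup h (∈-lookup j)
lookup-AllPairs (_ ∷ u) {suc i} {suc j} (s≤s i<j) = lookup-AllPairs u i<j

-- The bounds are irrelevant arguments, so that positions can be compared whatever proofs their
-- bounds come with.
record Enumeration {n} (X : List (Fin n)) (N : ℕ) : Set where
  field
    at      : ∀ j → .(j < N) → Fin n
    at-∈    : ∀ j .(p : j < N) → at j p ∈ X
    at-mono : ∀ {i j} .(p : i < N) .(q : j < N) → i < j → at i p Fin.< at j q

enumerate : ∀ {n N} (X : List (Fin n)) → Unique X → length X ≡ N → Enumeration X N
enumerate {n} X unique refl = record
  { at      = λ j p → lookup S (fromℕ< (subst (j <_) (sym |S|) p))
  ; at-∈    = λ j p → proj₂ (∈-filter⁻ (_∈? X) {xs = allFin n} (∈-lookup (fromℕ< (subst (j <_) (sym |S|) p))))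
  ; at-mono = λ {i} {j} p q i<j → lookup-AllPairs increasing (subst₂ _<_
      (sym (Fin.toℕ-fromℕ< (subst (i <_) (sym |S|) p))) (sym (Fin.toℕ-fromℕ< (subst (j <_) (sym |S|) q))) i<j) }
  where
  open import Data.List.Membership.DecPropositional (Fin._≟_ {n}) using (_∈?_)
  S = filter (_∈? X) (allFin n)
  increasing : AllPairs Fin._<_ S
  increasing = AllPairsₚ.filter⁺ (_∈? X) (AllPairsₚ.tabulate⁺-< id)
  S↭X : S ↭ X
  S↭X = ⊑-length⇒↭ (Unique⇒⊑ (Uniqueₚ.filter⁺ (_∈? X) (Uniqueₚ.allFin⁺ n)) (λ x∈ → proj₂ (∈-filter⁻ (_∈? X) {xs = allFin n} x∈)))
    (length-⊑ (Unique⇒⊑ unique (λ {x} x∈ → ∈-filter⁺ (_∈? X) (∈-allFin x) x∈)))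
  |S| : length S ≡ length X
  |S| = ↭-length S↭X

module Copies {h n} (H : OrderedGraph h) (G : OrderedGraph n) where

  copyVerts : List (Copy H G) → List (Fin n)
  copyVerts cs = concat (map (λ c → map (embed c) (allFin h)) cs)

  -- Inclusion together with the reverse inequality of lengths: the copies use up `X` exactly.
  Tileable : List (Fin n) → Set
  Tileable X = ∃ λ cs → copyVerts cs ⊑ X × length X ≤ length (copyVerts cs)

  Tileable-[] : Tileable []
  Tileable-[] = [] , ⊑-refl , z≤n

  Tileable-++ : ∀ {X Y} → Tileable X → Tileable Y → Tileable (X ++ Y)
  Tileable-++ {X} {Y} (cs , cs⊑ , le) (ds , ds⊑ , le′) = cs ++ ds
    , ↭-resp-⊑ (↭-reflexive eq) (⊑-++ cs⊑ ds⊑)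
    , (begin
      length (X ++ Y)                               ≡⟨ length-++ X ⟩
      length X + length Y                           ≤⟨ +-mono-≤ le le′ ⟩
      length (copyVerts cs) + length (copyVerts ds) ≡⟨ sym (length-++ (copyVerts cs)) ⟩
      length (copyVerts cs ++ copyVerts ds)         ≡⟨ cong length (sym eq) ⟩
      length (copyVerts (cs ++ ds))                 ∎)
    where
    open ≤-Reasoning
    eq = concatMap-++ (λ c → map (embed c) (allFin h)) cs ds

  Tileable-↭ : ∀ {X Y} → X ↭ Y → Tileable X → Tileable Y
  Tileable-↭ p (cs , cs⊑ , le) = cs , ⊑-resp-↭ cs⊑ p , subst (_≤ _) (↭-length p) le

module _ {k b} (B : CompletePartite k b) where
  open CompletePartite B hiding (graph; edge)

  partSize : Fin k → ℕ
  partSize i = # (λ v → part v Fin.≟ i)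

  partSizes-total : ∑ (allFin k) partSize ≡ b
  partSizes-total = begin
    ∑ (allFin k) partSize                                       ≡⟨ ∑-cong (allFin k) (λ i → length-filter-𝟙 (λ v → part v Fin.≟ i) (allFin b)) ⟩
    ∑ (allFin k) (λ i → ∑ (allFin b) (λ v → 𝟙 (part v Fin.≟ i))) ≡⟨ ∑-swap (allFin k) (allFin b) _ ⟩
    ∑ (allFin b) (λ v → ∑ (allFin k) (λ i → 𝟙 (part v Fin.≟ i))) ≡⟨ ∑-cong (allFin b) (λ v → sym (length-filter-𝟙 (part v Fin.≟_) (allFin k))) ⟩
    ∑ (allFin b) (λ v → length (filter (part v Fin.≟_) (allFin k))) ≡⟨ ∑-cong (allFin b) (λ v → once (part v)) ⟩
    ∑ (allFin b) (λ _ → 1)                                      ≡⟨ sym (length-as-∑ (allFin b)) ⟩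
    length (allFin b)                                           ≡⟨ length-tabulate id ⟩
    b                                                           ∎
    where
    open ≡-Reasoning
    once : ∀ (j : Fin k) → length (filter (j Fin.≟_) (allFin k)) ≡ 1
    once j = ↭-length (⊑-length⇒↭ {ys = [ j ]}
      (Unique⇒⊑ (Uniqueₚ.filter⁺ (j Fin.≟_) (Uniqueₚ.allFin⁺ k)) (λ x∈ → here (sym (proj₂ (∈-filter⁻ (j Fin.≟_) {xs = allFin k} x∈)))))
      (length-⊑ {xs = [ j ]} (Unique⇒⊑ ([] ∷ []) (λ { (here refl) → ∈-filter⁺ (j Fin.≟_) (∈-allFin j) refl }))))

  module _ {h n} (H : OrderedGraph h) (G : OrderedGraph n) where
    open Copies H G
    open Graph G

    -- The tiling is transported along a monotone bijection `f` from the blow-up to the union of the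
    -- `D i`. A vertex of V_x goes to the set of x's part, at the position given by the number of
    -- vertices of that part before x, times t, plus its place in V_x. Between different parts `f`
    -- is monotone because φ and the sets `D i` both follow π.
    blowUp-tileable : ∀ t (π : Permutation′ k) (φ : Permutation′ b) → IsIntervalLabelling B π φ →
      (T : Tiling H (orderedBlowUp (CompletePartite.graph B) t φ)) → Perfect T → (D : Fin k → List (Fin n)) → (∀ i → Unique (D i)) →
      (∀ i → length (D i) ≡ t * partSize i) → (∀ i j → (π ⟨$⟩ʳ i) Fin.< (π ⟨$⟩ʳ j) → _◁_ G (D i) (D j)) →
      Tileable (union D)
    blowUp-tileable t π φ interval T perfect D unique |D| ordered = map toCopy (allFin (size T))
      , Unique⇒⊑ (subst Unique verts≡ (Uniqueₚ.map⁺ f-injective W-unique)) inside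
      , (begin
        length (union D)                          ≡⟨ length-union D ⟩
        ∑ (allFin k) (length ∘ D)                 ≡⟨ ∑-cong (allFin k) |D| ⟩
        ∑ (allFin k) (λ i → t * partSize i)       ≡⟨ ∑-*ˡ t (allFin k) partSize ⟩
        t * ∑ (allFin k) partSize                 ≡⟨ cong (t *_) partSizes-total ⟩
        t * b                                     ≡⟨ *-comm t b ⟩
        b * t                                     ≡⟨ sym (length-tabulate id) ⟩
        length (allFin (b * t))                   ≤⟨ length-⊑ (Unique⇒⊑ (Uniqueₚ.allFin⁺ (b * t)) (λ {v} _ → W-all v)) ⟩
        length W                                  ≡⟨ sym (length-map f W) ⟩
        length (map f W)                          ≡⟨ cong length verts≡ ⟩
        length (copyVerts (map toCopy (allFin (size T)))) ∎)
      where
      open ≤-Reasoning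
      V = Fin (b * t)
      q : V → Fin b
      q v = quotient t v
      x : V → Fin b
      x v = φ ⟨$⟩ˡ q v
      φx : ∀ v → φ ⟨$⟩ʳ x v ≡ q v
      φx v = inverseʳ φ
      earlier : Fin b → List (Fin b)
      earlier y = filter (λ z → φ ⟨$⟩ʳ z Fin.<? φ ⟨$⟩ʳ y) (filter (λ z → part z Fin.≟ part y) (allFin b))
      earlier-unique : ∀ y → Unique (y ∷ earlier y)
      earlier-unique y = All.tabulate (λ z∈ y≡z → Fin.<-irrefl (cong (φ ⟨$⟩ʳ_) (sym y≡z))
          (proj₂ (∈-filter⁻ (λ z → φ ⟨$⟩ʳ z Fin.<? φ ⟨$⟩ʳ y) {xs = filter (λ z → part z Fin.≟ part y) (allFin b)} z∈)))
        ∷ Uniqueₚ.filter⁺ (λ z → φ ⟨$⟩ʳ z Fin.<? φ ⟨$⟩ʳ y) (Uniqueₚ.filter⁺ (λ z → part z Fin.≟ part y) (Uniqueₚ.allFin⁺ b))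
      earlier-∈ : ∀ {y z} → part z ≡ part y → φ ⟨$⟩ʳ z Fin.< φ ⟨$⟩ʳ y → z ∈ earlier y
      earlier-∈ {y} {z} same lt = ∈-filter⁺ (λ z → φ ⟨$⟩ʳ z Fin.<? φ ⟨$⟩ʳ y)
        (∈-filter⁺ (λ z → part z Fin.≟ part y) (∈-allFin z) same) lt
      ∈-earlier : ∀ {y z} → z ∈ earlier y → part z ≡ part y × φ ⟨$⟩ʳ z Fin.< φ ⟨$⟩ʳ y
      ∈-earlier {y} z∈ with ∈-filter⁻ (λ z → φ ⟨$⟩ʳ z Fin.<? φ ⟨$⟩ʳ y) {xs = filter (λ z → part z Fin.≟ part y) (allFin b)} z∈
      ... | z∈′ , lt = proj₂ (∈-filter⁻ (λ z → part z Fin.≟ part y) {xs = allFin b} z∈′) , lt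
      rank : Fin b → ℕ
      rank y = length (earlier y)
      rank-mono : ∀ {y z} → part y ≡ part z → φ ⟨$⟩ʳ y Fin.< φ ⟨$⟩ʳ z → rank y < rank z
      rank-mono {y} {z} same lt = length-⊑ {xs = y ∷ earlier y} (Unique⇒⊑ (earlier-unique y) sub)
        where
        sub : ∀ {w} → w ∈ y ∷ earlier y → w ∈ earlier z
        sub (here refl) = earlier-∈ same lt
        sub (there w∈)  = earlier-∈ (trans (proj₁ (∈-earlier w∈)) same) (Fin.<-trans (proj₂ (∈-earlier w∈)) lt)
      rank-bound : ∀ y → rank y < partSize (part y)
      rank-bound y = length-⊑ {xs = y ∷ earlier y} (Unique⇒⊑ (earlier-unique y) sub)
        where
        sub : ∀ {w} → w ∈ y ∷ earlier y → w ∈ filter (λ z → part z Fin.≟ part y) (allFin b)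
        sub (here refl) = ∈-filter⁺ (λ z → part z Fin.≟ part y) (∈-allFin _) refl
        sub {w} (there w∈) = ∈-filter⁺ (λ z → part z Fin.≟ part y) (∈-allFin w) (proj₁ (∈-earlier w∈))
      index : V → ℕ
      index v = rank (x v) * t + toℕ (remainder {b} t v)
      index< : ∀ v {N} → rank (x v) < N → index v < N * t
      index< v {N} lt = ≤-trans (+-monoʳ-< (rank (x v) * t) (Fin.toℕ<n (remainder {b} t v)))
        (≤-trans (≤-reflexive (+-comm (rank (x v) * t) t)) (*-monoˡ-≤ t lt))
      enum : ∀ i → Enumeration (D i) (partSize i * t)
      enum i = enumerate (D i) (unique i) (trans (|D| i) (*-comm t (partSize i)))
      open Enumeration
      f : V → Fin n
      f v = at (enum (part (x v))) (index v) (index< v (rank-bound (x v)))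
      f-∈ : ∀ v → f v ∈ D (part (x v))
      f-∈ v = at-∈ (enum (part (x v))) (index v) (index< v (rank-bound (x v)))
      same-part : ∀ {i j a c} .{p : a < partSize i * t} .{p′ : c < partSize j * t} → i ≡ j → a < c →
        at (enum i) a p Fin.< at (enum j) c p′
      same-part {i} {p = p} {p′} refl lt = at-mono (enum i) p p′ lt
      π-injective : ∀ {i j} → π ⟨$⟩ʳ i ≡ π ⟨$⟩ʳ j → i ≡ j
      π-injective eq = trans (sym (inverseˡ π)) (trans (cong (π ⟨$⟩ˡ_) eq) (inverseˡ π))
      f-mono-x : ∀ v w → φ ⟨$⟩ʳ x v Fin.< φ ⟨$⟩ʳ x w → f v Fin.< f w
      f-mono-x v w lt = by-part (part (x v) Fin.≟ part (x w))
        where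
        by-order : part (x v) ≢ part (x w) → Tri _ _ _ → f v Fin.< f w
        by-order diff (tri< before _ _) = proj₂ (ordered _ _ before (f-∈ v) (f-∈ w))
        by-order diff (tri≈ _ eq _)     = ⊥-elim (diff (π-injective eq))
        by-order diff (tri> _ _ after)  = ⊥-elim (Fin.<-asym lt (interval (x w) (x v) after))
        by-part : Dec (part (x v) ≡ part (x w)) → f v Fin.< f w
        by-part (yes same) = same-part same (≤-trans (index< v (rank-mono same lt)) (m≤m+n (rank (x w) * t) _))
        by-part (no diff)  = by-order diff (Fin.<-cmp (π ⟨$⟩ʳ part (x v)) (π ⟨$⟩ʳ part (x w)))
      v≡ : ∀ v → combine (q v) (remainder {b} t v) ≡ v
      v≡ v = Fin.combine-remQuot {b} t v
      f-mono : ∀ {v w} → v Fin.< w → f v Fin.< f w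
      f-mono {v} {w} v<w = by-quotient (Fin.<-cmp (q v) (q w))
        where
        by-quotient : Tri (q v Fin.< q w) (q v ≡ q w) (q w Fin.< q v) → f v Fin.< f w
        by-quotient (tri< lt _ _) = f-mono-x v w (subst₂ Fin._<_ (sym (φx v)) (sym (φx w)) lt)
        by-quotient (tri> _ _ gt) = ⊥-elim (Fin.<-asym v<w (subst₂ Fin._<_ (v≡ w) (v≡ v)
          (Fin.combine-monoˡ-< (remainder {b} t w) (remainder {b} t v) gt)))
        by-quotient (tri≈ _ eq _) = same-part (cong part x≡) (subst (λ y → index v < rank y * t + toℕ (remainder {b} t w)) x≡
            (+-monoʳ-< (rank (x v) * t) rem<))
          where
          x≡ : x v ≡ x w
          x≡ = cong (φ ⟨$⟩ˡ_) eq
          rem< : remainder {b} t v Fin.< remainder {b} t w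
          rem< = +-cancelˡ-< (t * toℕ (q v)) _ _ (subst₂ _<_
            (trans (cong toℕ (sym (v≡ v))) (Fin.toℕ-combine (q v) (remainder {b} t v)))
            (trans (cong toℕ (sym (v≡ w))) (trans (Fin.toℕ-combine (q w) (remainder {b} t w))
              (cong (λ y → t * toℕ y + toℕ (remainder {b} t w)) (sym eq))))
            v<w)
      f-injective : ∀ {v w} → f v ≡ f w → v ≡ w
      f-injective {v} {w} eq = by-order (Fin.<-cmp v w)
        where
        by-order : Tri (v Fin.< w) (v ≡ w) (w Fin.< v) → v ≡ w
        by-order (tri< lt _ _)  = ⊥-elim (Fin.<-irrefl eq (f-mono lt))
        by-order (tri≈ _ v≡w _) = v≡w
        by-order (tri> _ _ gt)  = ⊥-elim (Fin.<-irrefl (sym eq) (f-mono gt))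
      f-adj : ∀ v w → part (x v) ≢ part (x w) → Adj (f v) (f w)
      f-adj v w diff = by-order (Fin.<-cmp (π ⟨$⟩ʳ part (x v)) (π ⟨$⟩ʳ part (x w)))
        where
        by-order : Tri _ _ _ → Adj (f v) (f w)
        by-order (tri< before _ _) = proj₁ (ordered _ _ before (f-∈ v) (f-∈ w))
        by-order (tri≈ _ eq _)     = ⊥-elim (diff (π-injective eq))
        by-order (tri> _ _ after)  = adj-sym (proj₁ (ordered _ _ after (f-∈ w) (f-∈ v)))
      toCopy : Fin (size T) → Copy H G
      toCopy s = record
        { embed          = f ∘ embed (copy T s)
        ; injective      = λ eq → injective (copy T s) (f-injective eq)
        ; preserves-<    = λ i j i<j → f-mono (preserves-< (copy T s) i j i<j)
        ; preserves-edge = λ i j ij → f-adj _ _ (preserves-edge (copy T s) i j ij)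
        }
      rows : List (List V)
      rows = map (λ s → map (embed (copy T s)) (allFin h)) (allFin (size T))
      W = concat rows
      W-all : ∀ v → v ∈ W
      W-all v with perfect v
      ... | s , i , refl = ∈-concat⁺′ (∈-map-allFin (embed (copy T s)) i) (∈-map-allFin (λ s → map (embed (copy T s)) (allFin h)) s)
      W-unique : Unique W
      W-unique = Uniqueₚ.concat⁺ (Allₚ.map⁺ (All.tabulate λ {s} _ → Unique-map-allFin (injective (copy T s))))
        (AllPairsₚ.map⁺ (AllPairsₚ.tabulate⁺ λ s≢s′ → λ { (v∈ , v∈′) → separate s≢s′ (∈-map⁻ _ v∈) (∈-map⁻ _ v∈′) }))
        where
        separate : ∀ {s s′} {v : V} → s ≢ s′ → (∃ λ i → i ∈ allFin h × v ≡ embed (copy T s) i) →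
          (∃ λ i → i ∈ allFin h × v ≡ embed (copy T s′) i) → ⊥
        separate {s} {s′} s≢s′ (i , _ , e) (j , _ , e′) = disjoint T s s′ s≢s′ i j (trans (sym e) e′)
      verts≡ : map f W ≡ copyVerts (map toCopy (allFin (size T)))
      verts≡ = trans (concat-map′ rows) (cong concat (trans (sym (map-∘ (allFin (size T)))) (trans
        (map-cong (λ s → sym (map-∘ (allFin h))) (allFin (size T))) (map-∘ (allFin (size T))))))
        where
        concat-map′ : ∀ (xss : List (List V)) → map f (concat xss) ≡ concat (map (map f) xss)
        concat-map′ xss = sym (concat-map xss)
      inside : ∀ {v} → v ∈ copyVerts (map toCopy (allFin (size T))) → v ∈ union D
      inside {v} v∈ = image (∈-map⁻ f (subst (v ∈_) (sym verts≡) v∈))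
        where
        image : (∃ λ w → w ∈ W × v ≡ f w) → v ∈ union D
        image (w , _ , v≡fw) = subst (_∈ union D) (sym v≡fw) (∈-union (part (x w)) (f-∈ w))

concatMap-split : ∀ {I : Set} (D D₁ D₂ : I → List A) → (∀ i → D₁ i ++ D₂ i ↭ D i) → ∀ is →
  concat (map D₁ is) ++ concat (map D₂ is) ↭ concat (map D is)
concatMap-split D D₁ D₂ p []       = ↭-refl
concatMap-split D D₁ D₂ p (i ∷ is) = ↭-trans (interchange-↭ (D₁ i) (concat (map D₁ is)) (D₂ i) (concat (map D₂ is)))
  (++⁺ (p i) (concatMap-split D D₁ D₂ p is))

length≡0⇒[] : ∀ (xs : List A) → length xs ≡ 0 → xs ≡ []
length≡0⇒[] [] _ = refl

inhabited : ∀ (xs : List A) → 1 ≤ length xs → ∃ λ x → x ∈ xs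
inhabited (x ∷ _) _ = x , here refl

-- A blow-up size common to all orders of the parts

module Bottle {k b h} (B : CompletePartite k b) (H : OrderedGraph h) (bottle : IsBottlegraph B H) where
  open CompletePartite B hiding (graph; edge)

  abstract
    -- `combine` is monotone for the lexicographic order, so sorting by it lists the parts in the
    -- order π.
    labelling : ∀ π → ∃ λ φ → IsIntervalLabelling B π φ
    labelling π = proj₁ sorted , λ x y lt → proj₂ sorted x y (Fin.combine-monoˡ-< {i = π ⟨$⟩ʳ part x} {j = π ⟨$⟩ʳ part y} x y lt)
      where
      key : Fin b → ℕ
      key x = toℕ (combine (π ⟨$⟩ʳ part x) x)
      sorted : ∃ λ φ → Sorts φ key
      sorted = sorting (λ x → toℕ (combine (π ⟨$⟩ʳ part x) x))
        (λ {x} {y} eq → proj₂ (Fin.combine-injective (π ⟨$⟩ʳ part x) x (π ⟨$⟩ʳ part y) y (Fin.toℕ-injective eq)))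

  blowUpSize : Permutation′ k → ℕ
  blowUpSize π = proj₁ (bottle π (proj₁ (labelling π)) (proj₂ (labelling π)))

  blowUpSize≥1 : ∀ π → 1 ≤ blowUpSize π
  blowUpSize≥1 π = proj₁ (proj₂ (bottle π (proj₁ (labelling π)) (proj₂ (labelling π))))

  -- Finitely many permutations sort every ordering of the parts, so that the blow-up
  -- sizes belonging to them have a common multiple.
  arrangement : Fin (k ^ k) → Permutation′ k
  arrangement c with all? (λ x → all? (λ y → (finToFun {k} {k} c x Fin.≟ finToFun c y) →-dec (x Fin.≟ y)))
  ... | yes inj = proj₁ (sorting (toℕ ∘ finToFun {k} {k} c) (λ eq → inj _ _ (Fin.toℕ-injective eq)))
  -- A default for codes of non-injective maps; it merely adds a factor to `unit`.
  ... | no _    = Permutation.id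

  arrangement-sorts : ∀ c → (∀ {x y} → finToFun {k} {k} c x ≡ finToFun c y → x ≡ y) →
    Sorts (arrangement c) (toℕ ∘ finToFun {k} {k} c)
  arrangement-sorts c inj with all? (λ x → all? (λ y → (finToFun {k} {k} c x Fin.≟ finToFun c y) →-dec (x Fin.≟ y)))
  ... | yes inj′ = proj₂ (sorting (toℕ ∘ finToFun {k} {k} c) (λ eq → inj′ _ _ (Fin.toℕ-injective eq)))
  ... | no ¬inj  = ⊥-elim (¬inj (λ _ _ → inj))

  abstract
    unit : ℕ
    unit = product (map (blowUpSize ∘ arrangement) (allFin (k ^ k)))

    1≤unit : 1 ≤ unit
    1≤unit = >-nonZero⁻¹ unit {{product≢0 (Allₚ.map⁺ {xs = allFin (k ^ k)} (All.tabulate (λ {c} _ → >-nonZero (blowUpSize≥1 (arrangement c)))))}}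

    blowUpSize∣unit : ∀ c → blowUpSize (arrangement c) ∣ unit
    blowUpSize∣unit c = ∈⇒∣product (∈-map⁺ (blowUpSize ∘ arrangement) (∈-allFin c))

  partSize≥1 : ∀ i → 1 ≤ partSize B i
  partSize≥1 i with nonEmpty i
  ... | x , refl = length-⊑ {xs = [ x ]} (Unique⇒⊑ ([] ∷ []) (λ { (here refl) → ∈-filter⁺ (λ v → part v Fin.≟ part x) (∈-allFin x) refl }))

  module _ {n} (G : Graph n) where
    open Copies H G

    multiple-tileable : ∀ q π (D : Fin k → List (Fin n)) → (∀ i → Unique (D i)) →
      (∀ i → length (D i) ≡ q * (blowUpSize π * partSize B i)) →
      (∀ i j → (π ⟨$⟩ʳ i) Fin.< (π ⟨$⟩ʳ j) → _◁_ G (D i) (D j)) → Tileable (union D)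
    multiple-tileable zero π D unique |D| ordered = Tileable-↭ (↭-reflexive (sym (empty (allFin k)))) Tileable-[]
      where
      empty : ∀ is → concat (map D is) ≡ []
      empty []       = refl
      empty (i ∷ is) = trans (cong (_++ concat (map D is)) (length≡0⇒[] (D i) (|D| i))) (empty is)
    multiple-tileable (suc q) π D unique |D| ordered = Tileable-↭ (concatMap-split D D₁ D₂ split (allFin k))
      (Tileable-++
        (blowUp-tileable B H G (blowUpSize π) π (proj₁ (labelling π)) (proj₂ (labelling π))
          (proj₁ (proj₂ (proj₂ given))) (proj₂ (proj₂ (proj₂ given))) D₁
          (λ i → Unique-⊑ (D₁⊑D i) (unique i)) (λ i → proj₁ (proj₂ (proj₂ (proj₂ (cut i)))))
          (λ i j lt → ◁-⊑ G (D₁⊑D i) (D₁⊑D j) (ordered i j lt)))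
        (multiple-tileable q π D₂ (λ i → Unique-⊑ (D₂⊑D i) (unique i)) (λ i → proj₂ (proj₂ (proj₂ (proj₂ (cut i)))))
          (λ i j lt → ◁-⊑ G (D₂⊑D i) (D₂⊑D j) (ordered i j lt))))
      where
      given = bottle π (proj₁ (labelling π)) (proj₂ (labelling π))
      cut : ∀ i → ∃₂ λ ys zs → ys ++ zs ≡ D i × length ys ≡ blowUpSize π * partSize B i × length zs ≡ q * (blowUpSize π * partSize B i)
      cut i = splitAt-length (blowUpSize π * partSize B i) (q * (blowUpSize π * partSize B i)) (D i) (|D| i)
      D₁ D₂ : Fin k → List (Fin n)
      D₁ i = proj₁ (cut i)
      D₂ i = proj₁ (proj₂ (cut i))
      split : ∀ i → D₁ i ++ D₂ i ↭ D i
      split i = ↭-reflexive (proj₁ (proj₂ (proj₂ (cut i))))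
      D₁⊑D : ∀ i → D₁ i ⊑ D i
      D₁⊑D i = D₂ i , split i
      D₂⊑D : ∀ i → D₂ i ⊑ D i
      D₂⊑D i = ⊑-resp-↭ (⊑-++ˡ (D₁ i) (D₂ i)) (split i)

    -- Any one member of each `D i` reveals the order of these sets; members exist because a, `unit`
    -- and the part sizes are positive. The permutation that sorts them has a code, and its blow-up
    -- size divides `unit`.
    base-tileable : ∀ a → 1 ≤ a → (D : Fin k → List (Fin n)) → (∀ i → Unique (D i)) →
      (∀ i → length (D i) ≡ a * (unit * partSize B i)) → (∀ i j → i ≢ j → _⋈_ G (D i) (D j)) → Tileable (union D)
    base-tileable a 1≤a D unique |D| linked = multiple-tileable (a * q) π D unique
        (λ i → trans (|D| i) (trans (cong (λ u → a * (u * partSize B i)) (_∣_.equality (blowUpSize∣unit c)))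
          (((∀ a q t p → a * (q * t * p) ≡ a * q * (t * p)) ∋ solve-∀) a q (blowUpSize π) (partSize B i)))) ordered
      where
      member : ∀ i → ∃ λ v → v ∈ D i
      member i = inhabited (D i) (≤-trans (*-mono-≤ 1≤a (*-mono-≤ 1≤unit (partSize≥1 i))) (≤-reflexive (sym (|D| i))))
      key : Fin k → ℕ
      key i = toℕ (proj₁ (member i))
      key-< : ∀ {i j} → _◁_ G (D i) (D j) → key i < key j
      key-< {i} {j} i◁j = proj₂ (i◁j (proj₂ (member i)) (proj₂ (member j)))
      key-injective : ∀ {i j} → key i ≡ key j → i ≡ j
      key-injective {i} {j} eq with i Fin.≟ j
      ... | yes i≡j = i≡j
      ... | no  i≢j with linked i j i≢j
      ...   | inj₁ i◁j = ⊥-elim (<-irrefl eq (key-< i◁j))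
      ...   | inj₂ j◁i = ⊥-elim (<-irrefl (sym eq) (key-< j◁i))
      sorted = sorting key key-injective
      c : Fin (k ^ k)
      c = funToFin (proj₁ sorted ⟨$⟩ʳ_)
      decode : ∀ i → finToFun c i ≡ proj₁ sorted ⟨$⟩ʳ i
      decode = Fin.finToFun-funToFin (proj₁ sorted ⟨$⟩ʳ_)
      π = arrangement c
      π-sorts : Sorts π key
      π-sorts i j lt = arrangement-sorts c
        (λ {x} {y} eq → trans (sym (inverseˡ (proj₁ sorted))) (trans (cong (proj₁ sorted ⟨$⟩ˡ_) (trans (sym (decode x)) (trans eq (decode y)))) (inverseˡ (proj₁ sorted))))
        i j (subst₂ Fin._<_ (sym (decode i)) (sym (decode j)) (proj₂ sorted i j lt))
      q = _∣_.quotient (blowUpSize∣unit c)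
      ordered : ∀ i j → (π ⟨$⟩ʳ i) Fin.< (π ⟨$⟩ʳ j) → _◁_ G (D i) (D j)
      ordered i j lt with linked i j (λ i≡j → Fin.<-irrefl (cong (π ⟨$⟩ʳ_) i≡j) lt)
      ... | inj₁ i◁j = i◁j
      ... | inj₂ j◁i = ⊥-elim (Fin.<-asym lt (π-sorts j i (key-< j◁i)))

-- Chromatic number and smallest class of a complete multipartite graph

σ-least : ∀ {n} (F : Graph n) e → Least (ClassSize F (χ F)) (σ F e)
σ-least F e = proj₂ (smallestClass F e)

module _ {k b} (B : CompletePartite k b) where
  open CompletePartite B hiding (graph; edge)

  representative : Fin k → Fin b
  representative i = proj₁ (nonEmpty i)

  -- One vertex from each part gives a clique.
  colour-injective : ∀ {c} {f : Fin b → Fin c} → Proper (CompletePartite.graph B) f →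
    ∀ {i j} → f (representative i) ≡ f (representative j) → i ≡ j
  colour-injective {f = f} proper {i} {j} eq with i Fin.≟ j
  ... | yes i≡j = i≡j
  ... | no  i≢j = ⊥-elim (proper _ _ (λ same → i≢j (trans (sym (proj₂ (nonEmpty i))) (trans same (proj₂ (nonEmpty j))))) eq)

  chromatic≡ : ∀ {c} → Least (Colourable (CompletePartite.graph B)) c → c ≡ k
  chromatic≡ ((f , proper) , minimal) = ≤-antisym (minimal k (part , λ _ _ xy → xy))
    (Fin.injective⇒≤ {f = f ∘ representative} (colour-injective {f = f} proper))

  χ≡k : χ (CompletePartite.graph B) ≡ k
  χ≡k = chromatic≡ (proj₂ (chromatic (CompletePartite.graph B)))

  -- A proper colouring with k colours is constant on the parts.
  class-is-part : ∀ {s} → ClassSize (CompletePartite.graph B) k s → ∃ λ i → partSize B i ≡ s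
  class-is-part (f , proper , i , size) = j , trans same-size size
    where
    g : Fin k → Fin k
    g = f ∘ representative
    preimage : ∀ c → ∃ λ j → g j ≡ c
    preimage c with ∈-map⁻ g (∈-resp-↭ (↭-sym (map-allFin-↭ (colour-injective {f = f} proper))) (∈-allFin c))
    ... | j , _ , eq = j , sym eq
    j = proj₁ (preimage i)
    f≡g : ∀ v → f v ≡ g (part v)
    f≡g v with preimage (f v)
    ... | l , gl≡ with part v Fin.≟ part (representative l)
    ...   | yes same = sym (trans (cong g (trans same (proj₂ (nonEmpty l)))) gl≡)
    ...   | no  diff = ⊥-elim (proper v (representative l) diff (sym gl≡))
    same-size : partSize B j ≡ # (λ v → f v Fin.≟ i)
    same-size = trans (length-filter-𝟙 (λ v → part v Fin.≟ j) (allFin b)) (trans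
      (∑-cong (allFin b) (λ v → 𝟙-cong (part v Fin.≟ j) (f v Fin.≟ i)
        (λ e → trans (f≡g v) (trans (cong g e) (proj₂ (preimage i))))
        (λ e → colour-injective {f = f} proper (trans (sym (f≡g v)) (trans e (sym (proj₂ (preimage i))))))))
      (sym (length-filter-𝟙 (λ v → f v Fin.≟ i) (allFin b))))

  -- Stated for a variable c, so that the equation `χ≡k` can be matched with `refl`.
  least-class : ∀ {c s} → c ≡ k → Least (ClassSize (CompletePartite.graph B) c) s → (∃ λ i → partSize B i ≡ s) × (∀ i → s ≤ partSize B i)
  least-class refl (class , minimal) = class-is-part class
    , λ i → minimal (partSize B i) (part , (λ _ _ xy → xy) , i , refl)

  smallest-part : (∃ λ i → partSize B i ≡ σ (CompletePartite.graph B) (CompletePartite.edge B)) × (∀ i → σ (CompletePartite.graph B) (CompletePartite.edge B) ≤ partSize B i)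
  smallest-part = least-class {χ (CompletePartite.graph B)} {σ (CompletePartite.graph B) (CompletePartite.edge B)} χ≡k (σ-least (CompletePartite.graph B) (CompletePartite.edge B))

-- Cutting up a top tile

union-↭ : ∀ {k} {D E : Fin k → List A} → (∀ i → D i ↭ E i) → union D ↭ union E
union-↭ {k = k} {D} {E} p = go (allFin k)
  where
  go : ∀ is → concat (map D is) ↭ concat (map E is)
  go []       = ↭-refl
  go (i ∷ is) = ++⁺ (p i) (go is)

union-++ : ∀ {k} (D E : Fin k → List A) → union (λ i → D i ++ E i) ↭ union D ++ union E
union-++ {k = k} D E = ↭-sym (concatMap-split (λ i → D i ++ E i) D E (λ _ → ↭-refl) (allFin k))

union-swap : ∀ {k l} (M : Fin k → Fin l → List A) → union (λ x → union (M x)) ↭ union (λ y → union (λ x → M x y))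
union-swap {k = k} {l} M = go (allFin k)
  where
  none : ∀ (ys : List (Fin l)) → concat (map (λ _ → []) ys) ↭ []
  none []       = ↭-refl
  none (_ ∷ ys) = none ys
  go : ∀ xs → concat (map (λ x → union (M x)) xs) ↭ union (λ y → concat (map (λ x → M x y) xs))
  go []       = ↭-sym (none (allFin l))
  go (x ∷ xs) = ↭-trans (++⁺ˡ (union (M x)) (go xs)) (↭-sym (union-++ (M x) (λ y → concat (map (λ x → M x y) xs))))

union-reindex : ∀ {k} {f : Fin k → Fin k} (D : Fin k → List A) → (∀ {x y} → f x ≡ f y → x ≡ y) → union (D ∘ f) ↭ union D
union-reindex {k = k} {f} D inj = ↭-trans (↭-reflexive (cong concat (map-∘ (allFin k)))) (concat-↭ (map⁺ D (map-allFin-↭ inj)))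

allFin-↭-punchIn : ∀ {K} (i : Fin (suc K)) → allFin (suc K) ↭ i ∷ map (Fin.punchIn i) (allFin K)
allFin-↭-punchIn {K} i = ↭-sym (⊑-length⇒↭ (Unique⇒⊑
  (All.tabulate (λ y∈ i≡y → absurd (∈-map⁻ (Fin.punchIn i) y∈) i≡y) ∷ Unique-map-allFin (λ {x} {y} → Fin.punchIn-injective i x y))
  (λ {x} _ → ∈-allFin x))
  (≤-reflexive (trans (length-tabulate id) (cong suc (sym (length-map-allFin (Fin.punchIn i)))))))
  where
  absurd : ∀ {y} → (∃ λ z → z ∈ allFin K × y ≡ Fin.punchIn i z) → ¬ i ≡ y
  absurd (z , _ , eq) i≡y = Fin.punchInᵢ≢i i z (sym (trans i≡y eq))

union-punchIn : ∀ {K} (i : Fin (suc K)) (D : Fin (suc K) → List A) → union D ↭ D i ++ union (D ∘ Fin.punchIn i)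
union-punchIn {K = K} i D = ↭-trans (concat-↭ (map⁺ D (allFin-↭-punchIn i)))
  (↭-reflexive (cong (λ xs → D i ++ concat xs) (sym (map-∘ (allFin K)))))

∑-punchIn : ∀ {K} (i : Fin (suc K)) (f : Fin (suc K) → ℕ) → ∑ (allFin (suc K)) f ≡ f i + ∑ (allFin K) (f ∘ Fin.punchIn i)
∑-punchIn {K} i f = trans (∑-↭ f (allFin-↭-punchIn i)) (cong (f i +_) (∑-map (Fin.punchIn i) (allFin K) f))

∑-suc : ∀ {K} (f : Fin (suc K) → ℕ) → ∑ (allFin (suc K)) f ≡ f zero + ∑ (allFin K) (f ∘ suc)
∑-suc = ∑-punchIn zero

⊑-union : ∀ {k} (D : Fin k → List A) i → D i ⊑ union D
⊑-union D i = concat-⊑ (∈-map-allFin D i)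

chunks : ∀ {N} (p : Fin N → ℕ) (X : List A) → length X ≡ ∑ (allFin N) p →
  ∃ λ (Q : Fin N → List A) → union Q ↭ X × (∀ y → length (Q y) ≡ p y)
chunks {N = zero}  p []  _ = (λ ()) , ↭-refl , λ ()
chunks {N = suc N} p X |X| with splitAt-length (p zero) (∑ (allFin N) (p ∘ suc)) X (trans |X| (∑-suc p))
... | Y , Z , refl , |Y| , |Z| with chunks (p ∘ suc) Z |Z|
... | Q , q , |Q| = Q′ , ↭-trans (union-punchIn zero Q′) (++⁺ˡ Y q) , λ { zero → |Y| ; (suc y) → |Q| y }
  where
  Q′ : Fin (suc N) → List _
  Q′ zero    = Y
  Q′ (suc y) = Q y

union-insertAt : ∀ {K} (t : Fin K → List A) i S → union (insertAt t i S) ↭ S ++ union t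
union-insertAt {K = K} t i S = ↭-trans (union-punchIn i (insertAt t i S))
  (++⁺ (↭-reflexive (Vectorₚ.insertAt-lookup t i S)) (union-↭ (λ y → ↭-reflexive (Vectorₚ.insertAt-punchIn t i S y))))

insertAt-All : ∀ {K} {B : Set} (P : Fin (suc K) → B → Set) (t : Fin K → B) i S →
  P i S → (∀ y → P (Fin.punchIn i y) (t y)) → ∀ x → P x (insertAt t i S x)
insertAt-All P t i S PS Pt x with i Fin.≟ x
... | yes refl = subst (P i) (sym (Vectorₚ.insertAt-lookup t i S)) PS
... | no  i≢x  = subst (λ x → P x (insertAt t i S x)) (Fin.punchIn-punchOut i≢x)
  (subst (P (Fin.punchIn i (Fin.punchOut i≢x))) (sym (Vectorₚ.insertAt-punchIn t i S (Fin.punchOut i≢x))) (Pt (Fin.punchOut i≢x)))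

-- Addition modulo K + 1, whose table is a Latin square.
shift-mod : ∀ {K} → Fin (suc K) → Fin (suc K) → Fin (suc K)
shift-mod {K} q y = fromℕ< (m%n<n (toℕ q + toℕ y) (suc K))

shift-mod-comm : ∀ {K} (q y : Fin (suc K)) → shift-mod q y ≡ shift-mod y q
shift-mod-comm {K} q y = Fin.fromℕ<-cong _ _ (cong (_% suc K) (+-comm (toℕ q) (toℕ y))) _ _

shift-mod-injectiveˡ : ∀ {K} y {q q′ : Fin (suc K)} → shift-mod q y ≡ shift-mod q′ y → q ≡ q′
shift-mod-injectiveˡ {K} y {q} {q′} eq = Fin.toℕ-injective (begin
  toℕ q                                   ≡⟨ sym (recover q) ⟩
  ((toℕ q + toℕ y) % N + (N ∸ toℕ y) % N) % N  ≡⟨ cong (λ a → (a + (N ∸ toℕ y) % N) % N) mods ⟩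
  ((toℕ q′ + toℕ y) % N + (N ∸ toℕ y) % N) % N ≡⟨ recover q′ ⟩
  toℕ q′                                  ∎)
  where
  open ≡-Reasoning
  N = suc K
  mods : (toℕ q + toℕ y) % N ≡ (toℕ q′ + toℕ y) % N
  mods = Fin.fromℕ<-injective _ _ _ _ eq
  recover : ∀ (q : Fin N) → ((toℕ q + toℕ y) % N + (N ∸ toℕ y) % N) % N ≡ toℕ q
  recover q = begin
    ((toℕ q + toℕ y) % N + (N ∸ toℕ y) % N) % N ≡⟨ sym (%-distribˡ-+ (toℕ q + toℕ y) (N ∸ toℕ y) N) ⟩
    (toℕ q + toℕ y + (N ∸ toℕ y)) % N           ≡⟨ cong (_% N) (trans (+-assoc (toℕ q) (toℕ y) _) (cong (toℕ q +_) (m+[n∸m]≡n (<⇒≤ (Fin.toℕ<n y))))) ⟩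
    (toℕ q + N) % N                             ≡⟨ [m+n]%n≡m%n (toℕ q) N ⟩
    toℕ q % N                                   ≡⟨ m<n⇒m%n≡m (Fin.toℕ<n q) ⟩
    toℕ q                                       ∎

length-allFin : ∀ N → length (allFin N) ≡ N
length-allFin N = length-tabulate id

∑-allFin-const : ∀ N c → ∑ (allFin N) (λ _ → c) ≡ N * c
∑-allFin-const N c = trans (∑-const (allFin N) c) (cong (_* c) (length-allFin N))

as-family : ∀ {r} (R : A → A → Set) (xs : List A) → length xs ≡ r →
  ∃ λ (C : Fin r → A) → map C (allFin r) ≡ xs × (AllPairs R xs → ∀ x y → x Fin.< y → R (C x) (C y))
as-family R xs refl = lookup xs , trans (map-tabulate id (lookup xs)) (tabulate-lookup xs)
  , λ linked x y → lookup-AllPairs linked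

module Assembly {K b h n} (B : CompletePartite (suc K) b) (H : OrderedGraph h) (bottle : IsBottlegraph B H) (G : OrderedGraph n) where
  open Bottle B H bottle
  open Copies H G

  private
    _⋈′_ = _⋈_ G
    infix 4 _⋈′_

  Tileable-union : ∀ {N} (D : Fin N → List (Fin n)) → (∀ i → Tileable (D i)) → Tileable (union D)
  Tileable-union {N} D tileable = go (allFin N)
    where
    go : ∀ is → Tileable (concat (map D is))
    go []       = Tileable-[]
    go (i ∷ is) = Tileable-++ (tileable i) (go is)

  insertAt-linked : ∀ (t : Fin K → List (Fin n)) i S → (∀ y → S ⋈′ t y) → (∀ y y′ → y ≢ y′ → t y ⋈′ t y′) →
    ∀ x x′ → x ≢ x′ → insertAt t i S x ⋈′ insertAt t i S x′
  insertAt-linked t i S S⋈t t⋈t = insertAt-All (λ x X → ∀ x′ → x ≢ x′ → X ⋈′ insertAt t i S x′) t i S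
    (insertAt-All (λ x′ Y → i ≢ x′ → S ⋈′ Y) t i S (λ i≢i → ⊥-elim (i≢i refl)) (λ y _ → S⋈t y))
    (λ y → insertAt-All (λ x′ Y → Fin.punchIn i y ≢ x′ → t y ⋈′ Y) t i S (λ _ → ⋈-sym G (S⋈t y))
      (λ y′ y≢y′ → t⋈t y y′ (y≢y′ ∘ cong (Fin.punchIn i))))

  -- The big cells are cut into one chunk for each part other than i₀; the chunks of
  -- a Latin square of cells and parts are distributed over the copies of B.
  skew-tileable : ∀ {K′} → K ≡ suc K′ → ∀ i₀ S (C : Fin K → List (Fin n)) →
    length S ≡ K * (unit * partSize B i₀) →
    (∀ x → length (C x) ≡ unit * ∑ (allFin K) (partSize B ∘ Fin.punchIn i₀)) →
    Unique (S ++ union C) → (∀ x → S ⋈′ C x) → (∀ x y → x ≢ y → C x ⋈′ C y) → Tileable (S ++ union C)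
  skew-tileable refl i₀ S C |S| |C| unique S⋈C C⋈C = Tileable-↭ regroup (Tileable-union (λ q → union (D q)) base)
    where
    p : Fin K → ℕ
    p y = partSize B (Fin.punchIn i₀ y)
    S-chunks = chunks (λ (_ : Fin K) → unit * partSize B i₀) S (trans |S| (sym (∑-allFin-const K _)))
    Sq : Fin K → List (Fin n)
    Sq = proj₁ S-chunks
    C-chunks = λ x → chunks (λ y → unit * p y) (C x) (trans (|C| x) (sym (∑-*ˡ unit (allFin K) p)))
    M : Fin K → Fin K → List (Fin n)
    M x = proj₁ (C-chunks x)
    t : Fin K → Fin K → List (Fin n)
    t q y = M (shift-mod q y) y
    D : Fin K → Fin (suc K) → List (Fin n)
    D q = insertAt (t q) i₀ (Sq q)
    Sq⊑S : ∀ q → Sq q ⊑ S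
    Sq⊑S q = ⊑-resp-↭ (⊑-union Sq q) (proj₁ (proj₂ S-chunks))
    M⊑C : ∀ x y → M x y ⊑ C x
    M⊑C x y = ⊑-resp-↭ (⊑-union (M x) y) (proj₁ (proj₂ (C-chunks x)))
    base : ∀ q → Tileable (union (D q))
    base q = base-tileable G 1 ≤-refl (D q)
      (insertAt-All (λ _ X → Unique X) (t q) i₀ (Sq q) (Unique-⊑ (⊑-trans (Sq⊑S q) (⊑-++ʳ S (union C))) unique)
        (λ y → Unique-⊑ (⊑-trans (M⊑C _ y) (⊑-trans (⊑-union C _) (⊑-++ˡ S (union C)))) unique))
      (insertAt-All (λ i X → length X ≡ 1 * (unit * partSize B i)) (t q) i₀ (Sq q)
        (trans (proj₂ (proj₂ S-chunks) q) (sym (*-identityˡ _)))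
        (λ y → trans (proj₂ (proj₂ (C-chunks (shift-mod q y))) y) (sym (*-identityˡ _))))
      (insertAt-linked (t q) i₀ (Sq q) (λ y → ⋈-⊑ G (Sq⊑S q) (M⊑C _ y) (S⋈C _))
        (λ y y′ y≢y′ → ⋈-⊑ G (M⊑C _ y) (M⊑C _ y′) (C⋈C _ _ (λ eq → y≢y′ (shift-mod-injectiveˡ q
          (trans (shift-mod-comm y q) (trans eq (shift-mod-comm q y′))))))))
    -- For a fixed y the cell `shift-mod q y` runs through all cells as q varies, so every chunk
    -- `M x y` is used exactly once.
    regroup : union (λ q → union (D q)) ↭ S ++ union C
    regroup = ↭-trans (union-↭ (λ q → union-insertAt (t q) i₀ (Sq q))) (↭-trans (union-++ Sq (λ q → union (t q)))
      (++⁺ (proj₁ (proj₂ S-chunks)) (↭-trans (union-swap t) (↭-trans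
        (union-↭ (λ y → union-reindex {f = λ q → shift-mod q y} (λ x → M x y) (shift-mod-injectiveˡ y)))
        (↭-trans (↭-sym (union-swap M)) (union-↭ (λ x → proj₁ (proj₂ (C-chunks x)))))))))

  -- The x-th copy of B takes part x from the small cell and the other parts from the big cells
  -- other than the x-th. Each big cell keeps its diagonal chunk `M i i`, which with `R i` makes N +
  -- 1 chunks; as there are as many big cells as parts, these remainders form blow-ups of B by
  -- themselves.
  balanced-tileable : ∀ P N S (C : Fin (suc K) → List (Fin n)) → (∀ i → partSize B i ≡ P) →
    length S ≡ suc K * (unit * P) → (∀ i → length (C i) ≡ (suc K + N) * (unit * P)) →
    Unique (S ++ union C) → (∀ x → S ⋈′ C x) → (∀ x y → x ≢ y → C x ⋈′ C y) → Tileable (S ++ union C)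
  balanced-tileable P N S C sizes |S| |C| unique S⋈C C⋈C = Tileable-↭ regroup
    (Tileable-++ (Tileable-union (λ x → union (D x)) base) rest-base)
    where
    u = unit * P
    S-chunks = chunks (λ (_ : Fin (suc K)) → u) S (trans |S| (sym (∑-allFin-const (suc K) u)))
    Sx : Fin (suc K) → List (Fin n)
    Sx = proj₁ S-chunks
    cut : ∀ i → ∃₂ λ ys zs → ys ++ zs ≡ C i × length ys ≡ suc K * u × length zs ≡ N * u
    cut i = splitAt-length (suc K * u) (N * u) (C i) (trans (|C| i) (*-distribʳ-+ u (suc K) N))
    R : Fin (suc K) → List (Fin n)
    R i = proj₁ (proj₂ (cut i))
    C-chunks = λ i → chunks (λ (_ : Fin (suc K)) → u) (proj₁ (cut i))
      (trans (proj₁ (proj₂ (proj₂ (proj₂ (cut i))))) (sym (∑-allFin-const (suc K) u)))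
    M : Fin (suc K) → Fin (suc K) → List (Fin n)
    M i = proj₁ (C-chunks i)
    whole : ∀ i → union (M i) ++ R i ↭ C i
    whole i = ↭-trans (++⁺ʳ (R i) (proj₁ (proj₂ (C-chunks i)))) (↭-reflexive (proj₁ (proj₂ (proj₂ (cut i)))))
    t : Fin (suc K) → Fin K → List (Fin n)
    t x y = M (Fin.punchIn x y) x
    D : Fin (suc K) → Fin (suc K) → List (Fin n)
    D x = insertAt (t x) x (Sx x)
    E : Fin (suc K) → List (Fin n)
    E i = M i i ++ R i
    Sx⊑S : ∀ x → Sx x ⊑ S
    Sx⊑S x = ⊑-resp-↭ (⊑-union Sx x) (proj₁ (proj₂ S-chunks))
    M⊑C : ∀ i x → M i x ⊑ C i
    M⊑C i x = ⊑-trans (⊑-union (M i) x) (⊑-resp-↭ (⊑-++ʳ (union (M i)) (R i)) (whole i))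
    E⊑C : ∀ i → E i ⊑ C i
    E⊑C i = ⊑-resp-↭ (⊑-++ (⊑-union (M i) i) ⊑-refl) (whole i)
    C-unique : ∀ {X} i → X ⊑ C i → Unique X
    C-unique i X⊑ = Unique-⊑ (⊑-trans X⊑ (⊑-trans (⊑-union C i) (⊑-++ˡ S (union C)))) unique
    base : ∀ x → Tileable (union (D x))
    base x = base-tileable G 1 ≤-refl (D x)
      (insertAt-All (λ _ X → Unique X) (t x) x (Sx x) (Unique-⊑ (⊑-trans (Sx⊑S x) (⊑-++ʳ S (union C))) unique)
        (λ y → C-unique (Fin.punchIn x y) (M⊑C _ x)))
      (λ i → trans (insertAt-All (λ _ X → length X ≡ u) (t x) x (Sx x) (proj₂ (proj₂ S-chunks) x)
          (λ y → proj₂ (proj₂ (C-chunks (Fin.punchIn x y))) x) i)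
        (trans (cong (unit *_) (sym (sizes i))) (sym (*-identityˡ _))))
      (insertAt-linked (t x) x (Sx x) (λ y → ⋈-⊑ G (Sx⊑S x) (M⊑C _ x) (S⋈C _))
        (λ y y′ y≢y′ → ⋈-⊑ G (M⊑C _ x) (M⊑C _ x) (C⋈C _ _ (y≢y′ ∘ Fin.punchIn-injective x y y′))))
    rest-base : Tileable (union E)
    rest-base = base-tileable G (suc N) (s≤s z≤n) E (λ i → C-unique i (E⊑C i))
      (λ i → trans (length-++ (M i i)) (trans (cong₂ _+_ (proj₂ (proj₂ (C-chunks i)) i) (proj₂ (proj₂ (proj₂ (proj₂ (cut i))))))
        (cong (λ P → suc N * (unit * P)) (sym (sizes i)))))
      (λ i j i≢j → ⋈-⊑ G (E⊑C i) (E⊑C j) (C⋈C i j i≢j))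
    diagonals : union (λ x → union (t x)) ++ union (λ x → M x x) ↭ union (λ i → union (M i))
    diagonals = ↭-trans (++-comm (union (λ x → union (t x))) (union (λ x → M x x)))
      (↭-trans (↭-sym (union-++ (λ x → M x x) (λ x → union (t x))))
        (↭-trans (union-↭ (λ x → ↭-sym (union-punchIn x (λ i → M i x)))) (↭-sym (union-swap M))))
    regroup : union (λ x → union (D x)) ++ union E ↭ S ++ union C
    regroup = ↭-trans (++⁺ (↭-trans (union-↭ (λ x → union-insertAt (t x) x (Sx x))) (union-++ Sx (λ x → union (t x))))
        (union-++ (λ x → M x x) R))
      (↭-trans (↭-reflexive (++-assoc′ (union Sx) (union (λ x → union (t x))) _)) (++⁺ (proj₁ (proj₂ S-chunks))
        (↭-trans (↭-reflexive (sym (++-assoc′ (union (λ x → union (t x))) (union (λ x → M x x)) (union R))))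
          (↭-trans (++⁺ʳ (union R) diagonals) (↭-trans (↭-sym (union-++ (λ i → union (M i)) R)) (union-↭ whole))))))

  module _ (r s m L : ℕ) where
    open Tiles G r s m

    Splittable : Set
    Splittable = ∀ S (C : Fin r → List (Fin n)) → length S ≡ s * L → (∀ x → length (C x) ≡ m * L) →
      Unique (S ++ union C) → (∀ x → S ⋈′ C x) → (∀ x y → x ≢ y → C x ⋈′ C y) → Tileable (S ++ union C)

    top-tileable : Splittable → (T : Top L) → Unique (Top.vertices T) → Tileable (Top.vertices T)
    top-tileable split T unique = from-family (as-family _⋈′_ (Top.cells T) (Top.count T))
      where
      from-family : (∃ λ (C : Fin r → List (Fin n)) → map C (allFin r) ≡ Top.cells T ×
        (AllPairs _⋈′_ (Top.cells T) → ∀ x y → x Fin.< y → C x ⋈′ C y)) → Tileable (Top.vertices T)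
      from-family (C , eq , link) = subst (λ cs → Tileable (Top.small T ++ concat cs)) eq
        (split (Top.small T) C (Top.|small| T) (λ x → All.lookup (Top.sizes T) (C∈ x))
          (subst (λ cs → Unique (Top.small T ++ concat cs)) (sym eq) unique)
          (λ x → All.lookup (Top.crossing T) (C∈ x)) linked)
        where
        C∈ : ∀ x → C x ∈ Top.cells T
        C∈ x = subst (C x ∈_) eq (∈-map-allFin C x)
        linked : ∀ x y → x ≢ y → C x ⋈′ C y
        linked x y x≢y with Fin.<-cmp x y
        ... | tri< lt _ _ = link (Top.linked T) x y lt
        ... | tri≈ _ x≡y _ = ⊥-elim (x≢y x≡y)
        ... | tri> _ _ gt = ⋈-sym G (link (Top.linked T) y x gt)

    tops-tileable : Splittable → (ts : List (Top L)) → Unique (topVerts ts) → Tileable (topVerts ts)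
    tops-tileable split []       unique = Tileable-[]
    tops-tileable split (t ∷ ts) unique = Tileable-++
      (top-tileable split t (Unique-⊑ (⊑-++ʳ (Top.vertices t) (topVerts ts)) unique))
      (tops-tileable split ts (Unique-⊑ (⊑-++ˡ (Top.vertices t) (topVerts ts)) unique))

-- The proportions of the top tile

all-minimal : ∀ (xs : List A) f c → (∀ {x} → x ∈ xs → c ≤ f x) → ∑ xs f ≤ length xs * c → ∀ {x} → x ∈ xs → f x ≡ c
all-minimal (x ∷ xs) f c c≤ sum≤ = λ { (here refl) → ≤-antisym head≤ (c≤ (here refl))
                                    ; (there y∈) → all-minimal xs f c (c≤ ∘ there) tail≤ y∈ }
  where
  rest≥ : length xs * c ≤ ∑ xs f
  rest≥ = subst (_≤ ∑ xs f) (∑-const xs c) (∑-mono xs (c≤ ∘ there))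
  head≤ : f x ≤ c
  head≤ = +-cancelʳ-≤ (length xs * c) (f x) c (≤-trans (+-monoʳ-≤ (f x) rest≥) sum≤)
  tail≤ : ∑ xs f ≤ length xs * c
  tail≤ = +-cancelˡ-≤ c _ _ (≤-trans (+-monoˡ-≤ (∑ xs f) (c≤ (here refl))) sum≤)

module _ {h} (H : OrderedGraph h) where

  -- Degree condition and conclusion with the real number replaced by 1 / e;
  -- M / T is 1 / χcr.
  AlmostTiling : ℕ → ℕ → ℕ → Set₁
  AlmostTiling e M T = ∃ λ n₀ → ∀ n → n₀ ≤ n → (G : OrderedGraph n) →
    (∀ v → e * T * ∑ (allFin n) (unjoined G v) + n ≤ e * M * n) →
    ∃ λ cs → Copies.copyVerts H G cs ⊑ allFin n × e * n ≤ e * length (Copies.copyVerts H G cs) + n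

  covers : ∀ {n} (G : OrderedGraph n) e {X} → X ⊑ allFin n → e * n ≤ e * length X + n → Copies.Tileable H G X →
    ∃ λ cs → Copies.copyVerts H G cs ⊑ allFin n × e * n ≤ e * length (Copies.copyVerts H G cs) + n
  covers {n} G e X⊑ le (cs , cs⊑ , all) = cs , ⊑-trans cs⊑ X⊑ , ≤-trans le (+-monoˡ-≤ n (*-monoʳ-≤ e all))

  module _ {K b} (B : CompletePartite (suc (suc K)) b) (bottle : IsBottlegraph B H) (i₀ : Fin (suc (suc K)))
    (minimal : ∀ i → partSize B i₀ ≤ partSize B i) (e : ℕ) (1≤e : 1 ≤ e) where

    private
      k-1 = suc K
      P = partSize B i₀
      O = ∑ (allFin k-1) (partSize B ∘ Fin.punchIn i₀)
      open Bottle B H bottle using (unit; 1≤unit; partSize≥1)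

    P+O : P + O ≡ b
    P+O = trans (sym (∑-punchIn i₀ (partSize B))) (partSizes-total B)

    kP≤O : k-1 * P ≤ O
    kP≤O = subst (_≤ O) (∑-allFin-const k-1 P) (∑-mono (allFin k-1) (λ {y} _ → minimal (Fin.punchIn i₀ y)))

    -- Here m/(s + r m) with r = k - 1, s = (k - 1) P and m = O is exactly O/((k - 1) b) = 1/χcr.
    -- The small cell has k - 1 times the smallest part because `skew-tileable` fits k - 1 rotated
    -- copies of B into the tile. The hypothesis is s < m.
    skew : k-1 * P < O → AlmostTiling e O (k-1 * b)
    skew lt = proj₁ core , λ n n₀≤n G few → finish G (proj₂ core n n₀≤n G (λ v → subst (λ T → e * T * ∑ (allFin n) (unjoined G v) + n ≤ e * O * n) tot≡ (few v)))
      where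
      core = topTiling k-1 (k-1 * P) O e unit (s≤s z≤n) lt 1≤e 1≤unit
      tot≡ : k-1 * b ≡ k-1 * P + k-1 * O
      tot≡ = trans (cong (k-1 *_) (sym P+O)) (*-distribˡ-+ k-1 P O)
      finish : ∀ {n} (G : OrderedGraph n) → (∃ λ (ts : List (Tiles.Top G k-1 (k-1 * P) O unit)) →
          Tiles.topVerts G k-1 (k-1 * P) O ts ⊑ allFin n × e * n ≤ e * length (Tiles.topVerts G k-1 (k-1 * P) O ts) + n) →
        ∃ λ cs → Copies.copyVerts H G cs ⊑ allFin n × e * n ≤ e * length (Copies.copyVerts H G cs) + n
      finish {n} G (ts , ts⊑ , le) = covers G e ts⊑ le
        (Assembly.tops-tileable B H bottle G k-1 (k-1 * P) O unit split ts (Unique-⊑ ts⊑ (Uniqueₚ.allFin⁺ n)))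
        where
        split : Assembly.Splittable B H bottle G k-1 (k-1 * P) O unit
        split S C |S| |C| = Assembly.skew-tileable B H bottle G refl i₀ S C
          (trans |S| (((∀ k p u → k * p * u ≡ k * (u * p)) ∋ solve-∀) k-1 P unit))
          (λ x → trans (|C| x) (*-comm O unit))

    -- For balanced B the bottle has k big cells of almost full size and a small
    -- one, so that its small cell is still strictly smaller than the big ones.
    balanced : O ≡ k-1 * P → AlmostTiling e O (k-1 * b)
    balanced O≡ = proj₁ core , λ n n₀≤n G few → finish G (proj₂ core n n₀≤n G (λ v → degrees n (∑ (allFin n) (unjoined G v)) (few v)))
      where
      k = suc k-1
      -- In terms of e′ the hypothesis on the number d of non-neighbours is e′ k d + n ≤ e′ n. Here
      -- m/(s + r m) = m/(k(m + 1)) is a little less than 1/k. Multiplying the hypothesis by m + 1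
      -- gives what is needed, with k n to spare, because m = k + e′; also m exceeds s = k.
      e′ = e * (k-1 * P)
      m = k + e′
      1≤P : 1 ≤ P
      1≤P = partSize≥1 i₀
      1≤e′ : 1 ≤ e′
      1≤e′ = *-mono-≤ 1≤e (*-mono-≤ {1} {k-1} (s≤s z≤n) 1≤P)
      sizes : ∀ i → partSize B i ≡ P
      sizes i = all-minimal (allFin k) (partSize B) P (λ {x} _ → minimal x)
        (≤-reflexive (trans (partSizes-total B) (trans (sym P+O) (trans (cong (P +_) O≡) (cong (_* P) (sym (length-allFin k))))))) (∈-allFin i)
      core = topTiling k k m e′ (unit * P) (s≤s z≤n) (m<m+n k 1≤e′) 1≤e′ (*-mono-≤ 1≤unit 1≤P)
      degrees : ∀ n d → e * (k-1 * b) * d + n ≤ e * O * n → e′ * (k + k * m) * d + n ≤ e′ * m * n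
      degrees n d h = ≤-cert _ _ (k * n) (*-monoʳ-≤ (suc m) (subst₂ (λ b O → e * (k-1 * b) * d + n ≤ e * O * n)
          (trans (sym P+O) (cong (P +_) O≡)) O≡ h))
        (((∀ e K P d n → let x = e * (K * P) in let k = suc K in let m = k + x in
            x * (k + k * m) * d + n + suc m * (e * (K * P) * n) + k * n
            ≡ x * m * n + suc m * (e * (K * (P + K * P)) * d + n)) ∋ solve-∀) e k-1 P d n)
      finish : ∀ {n} (G : OrderedGraph n) → (∃ λ (ts : List (Tiles.Top G k k m (unit * P))) →
          Tiles.topVerts G k k m ts ⊑ allFin n × e′ * n ≤ e′ * length (Tiles.topVerts G k k m ts) + n) →
        ∃ λ cs → Copies.copyVerts H G cs ⊑ allFin n × e * n ≤ e * length (Copies.copyVerts H G cs) + n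
      finish {n} G (ts , ts⊑ , le) = covers G e ts⊑ weaken
        (Assembly.tops-tileable B H bottle G k k m (unit * P) split ts (Unique-⊑ ts⊑ (Uniqueₚ.allFin⁺ n)))
        where
        split : Assembly.Splittable B H bottle G k k m (unit * P)
        split S C |S| |C| = Assembly.balanced-tileable B H bottle G P e′ S C sizes |S| |C|
        x = length (Tiles.topVerts G k k m ts)
        x≤n : x ≤ n
        x≤n = ≤-trans (length-⊑ ts⊑) (≤-reflexive (length-allFin n))
        weaken : e * n ≤ e * x + n
        weaken = begin
          e * n                   ≡⟨ cong (e *_) (sym (m+[n∸m]≡n x≤n)) ⟩
          e * (x + (n ∸ x))       ≡⟨ *-distribˡ-+ e x (n ∸ x) ⟩
          e * x + e * (n ∸ x)     ≤⟨ +-monoʳ-≤ (e * x) (≤-trans (*-monoˡ-≤ (n ∸ x) (m≤m*n e (k-1 * P) {{>-nonZero (*-mono-≤ {1} {k-1} (s≤s z≤n) 1≤P)}})) bound) ⟩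
          e * x + n               ∎
          where
          open ≤-Reasoning
          bound : e′ * (n ∸ x) ≤ n
          bound = +-cancelˡ-≤ (e′ * x) _ _ (≤-trans (≤-reflexive (trans (sym (*-distribˡ-+ e′ x (n ∸ x))) (cong (e′ *_) (m+[n∸m]≡n x≤n)))) le)

    almost-tiling-of-parts : AlmostTiling e O (k-1 * b)
    almost-tiling-of-parts with m≤n⇒m<n∨m≡n kP≤O
    ... | inj₁ lt = skew lt
    ... | inj₂ eq = balanced (sym eq)

  almost-tiling : ∀ {k b} (B : CompletePartite k b) → IsBottlegraph B H → ∀ e → 1 ≤ e →
    AlmostTiling e (b ∸ σ (CompletePartite.graph B) (CompletePartite.edge B)) ((k ∸ 1) * b)
  almost-tiling {0}           B bottle e 1≤e = ⊥-elim (n≮0 (CompletePartite.2≤k B))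
  almost-tiling {1}           B bottle e 1≤e = ⊥-elim (<-irrefl refl (CompletePartite.2≤k B))
  almost-tiling {suc (suc K)} {b} B bottle e 1≤e = from-smallest (smallest-part B)
    where
    from-smallest : ∀ {s} → (∃ λ i → partSize B i ≡ s) × (∀ i → s ≤ partSize B i) → AlmostTiling e (b ∸ s) (suc K * b)
    from-smallest ((i₀ , refl) , minimal) = subst (λ M → AlmostTiling e M (suc K * b))
      (trans (sym (m+n∸m≡n (partSize B i₀) _)) (cong (_∸ partSize B i₀) (P+O B bottle i₀ minimal e 1≤e)))
      (almost-tiling-of-parts B bottle i₀ minimal e 1≤e)

-- From naturals to reals

ι : ℕ → ℚ
ι n = ℤ.+ n ℚ./ 1

ι-toℚᵘ : ∀ n → toℚᵘ (ι n) ℚᵘ.≃ mkℚᵘ (ℤ.+ n) 0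
ι-toℚᵘ n = ℚ.toℚᵘ-fromℚᵘ (mkℚᵘ (ℤ.+ n) 0)

ι-+ : ∀ a b → ι (a + b) ≡ ι a ℚ.+ ι b
ι-+ a b = ℚ.toℚᵘ-injective (ℚᵘ.≃-trans (ι-toℚᵘ (a + b)) (ℚᵘ.≃-sym (ℚᵘ.≃-trans (ℚ.toℚᵘ-homo-+ (ι a) (ι b))
  (ℚᵘ.≃-trans (ℚᵘ.+-cong (ι-toℚᵘ a) (ι-toℚᵘ b))
    (ℚᵘ.*≡* (cong (ℤ._* (ℤ.+ 1)) (cong₂ ℤ._+_ (ℤ.*-identityʳ (ℤ.+ a)) (ℤ.*-identityʳ (ℤ.+ b)))))))))

ι-* : ∀ a b → ι (a * b) ≡ ι a ℚ.* ι b
ι-* a b = ℚ.toℚᵘ-injective (ℚᵘ.≃-trans (ι-toℚᵘ (a * b)) (ℚᵘ.≃-sym (ℚᵘ.≃-trans (ℚ.toℚᵘ-homo-* (ι a) (ι b))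
  (ℚᵘ.≃-trans (ℚᵘ.*-cong (ι-toℚᵘ a) (ι-toℚᵘ b)) (ℚᵘ.*≡* (cong (ℤ._* (ℤ.+ 1)) (sym (ℤ.pos-* a b))))))))

ι-mono : ∀ {a b} → a ≤ b → ι a ℚ.≤ ι b
ι-mono {a} {b} a≤b = ℚ.toℚᵘ-cancel-≤ (ℚᵘ.≤-respʳ-≃ (ℚᵘ.≃-sym (ι-toℚᵘ b)) (ℚᵘ.≤-respˡ-≃ (ℚᵘ.≃-sym (ι-toℚᵘ a))
  (ℚᵘ.*≤* (ℤ.*-monoʳ-≤-nonNeg (ℤ.+ 1) (ℤ.+≤+ a≤b)))))

ι-cancel : ∀ {a b} → ι a ℚ.≤ ι b → a ≤ b
ι-cancel {a} {b} le with ℚᵘ.≤-respʳ-≃ (ι-toℚᵘ b) (ℚᵘ.≤-respˡ-≃ (ι-toℚᵘ a) (ℚ.toℚᵘ-mono-≤ le))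
... | ℚᵘ.*≤* p = ℤ.drop‿+≤+ (subst₂ ℤ._≤_ (ℤ.*-identityʳ (ℤ.+ a)) (ℤ.*-identityʳ (ℤ.+ b)) p)

ι-nonNeg : ∀ a → ℚ.NonNegative (ι a)
ι-nonNeg a = ℚ.nonNegative (ι-mono {0} {a} z≤n)

/-cancel : ∀ p q .{{_ : NonZero q}} → (ℤ.+ p ℚ./ q) ℚ.* ι q ≡ ι p
/-cancel p q@(suc q-1) = ℚ.toℚᵘ-injective (ℚᵘ.≃-trans (ℚ.toℚᵘ-homo-* (ℤ.+ p ℚ./ q) (ι q))
  (ℚᵘ.≃-trans (ℚᵘ.*-cong (ℚ.toℚᵘ-fromℚᵘ (mkℚᵘ (ℤ.+ p) q-1)) (ι-toℚᵘ q))
    (ℚᵘ.≃-trans (ℚᵘ.*≡* (trans (ℤ.*-assoc (ℤ.+ p) (ℤ.+ q) (ℤ.+ 1)) (cong (λ d → ℤ.+ p ℤ.* d)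
      (trans (ℤ.*-identityʳ (ℤ.+ q)) (cong ℤ.+_ (sym (*-identityʳ q))))))) (ℚᵘ.≃-sym (ι-toℚᵘ p)))))

1/χcr-cancel : ∀ {n} (F : Graph n) e → ι ((χ F ∸ 1) * n) ℚ.* 1/χcr F e ≡ ι (n ∸ σ F e)
1/χcr-cancel {n} F e = begin
  ι ((χ F ∸ 1) * n) ℚ.* 1/χcr F e                     ≡⟨ cong (ℚ._* 1/χcr F e) (sym (/-cancel ((χ F ∸ 1) * n) (n ∸ σ F e) {{n∸σ≢0 F e}})) ⟩
  χcr F e ℚ.* ι (n ∸ σ F e) ℚ.* 1/χcr F e             ≡⟨ solve 3 (λ c m x → c :* m :* x := c :* x :* m) refl (χcr F e) (ι (n ∸ σ F e)) (1/χcr F e) ⟩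
  χcr F e ℚ.* 1/χcr F e ℚ.* ι (n ∸ σ F e)             ≡⟨ cong (ℚ._* ι (n ∸ σ F e)) (ℚ.*-inverseʳ (χcr F e) {{χcr≢0 F e}}) ⟩
  1ℚ ℚ.* ι (n ∸ σ F e)                                ≡⟨ ℚ.*-identityˡ _ ⟩
  ι (n ∸ σ F e)                                       ∎
  where
  open ≡-Reasoning
  open +-*-Solver

seq-· : ∀ n x i → seq (n ·ᴿ x) i ≡ ι n ℚ.* seq x i
seq-· zero    x i = sym (ℚ.*-zeroˡ (seq x i))
seq-· (suc n) x i = begin
  seq x i ℚ.+ seq (n ·ᴿ x) i          ≡⟨ cong (seq x i ℚ.+_) (seq-· n x i) ⟩
  seq x i ℚ.+ ι n ℚ.* seq x i         ≡⟨ cong (ℚ._+ ι n ℚ.* seq x i) (sym (ℚ.*-identityˡ (seq x i))) ⟩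
  1ℚ ℚ.* seq x i ℚ.+ ι n ℚ.* seq x i  ≡⟨ sym (ℚ.*-distribʳ-+ (seq x i) 1ℚ (ι n)) ⟩
  (1ℚ ℚ.+ ι n) ℚ.* seq x i            ≡⟨ cong (ℚ._* seq x i) (sym (ι-+ 1 n)) ⟩
  ι (suc n) ℚ.* seq x i               ∎
  where open ≡-Reasoning

-- The numerator of a positive rational is at least 1, so ε is at least the reciprocal of its
-- denominator; that denominator is the e of the integer statements.
1≤ε*↧ε : ∀ ε → 0ℚ ℚ.< ε → 1ℚ ℚ.≤ ε ℚ.* ι (ℚ.↧ₙ ε)
1≤ε*↧ε ε ε>0 = from-numerator ε (ℚ.positive ε>0)
  where
  from-numerator : ∀ ε → ℚ.Positive ε → 1ℚ ℚ.≤ ε ℚ.* ι (ℚ.↧ₙ ε)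
  from-numerator ε@(ℚ.mkℚ (ℤ.+ suc p) d-1 _) _ = subst (1ℚ ℚ.≤_)
    (sym (trans (cong (ℚ._* ι (suc d-1)) (sym (ℚ.↥p/↧p≡p ε))) (/-cancel (suc p) (suc d-1)))) (ι-mono {1} {suc p} (s≤s z≤n))

module _ {h n} (H : OrderedGraph h) (G : OrderedGraph n) where
  open Copies H G

  private
    row : Copy H G → List (Fin n)
    row c = map (embed c) (allFin h)

  list-tiling : (cs : List (Copy H G)) → Unique (copyVerts cs) →
    ∃ λ (T : Tiling H G) → length (copyVerts cs) + uncovered T ≤ n
  list-tiling cs unique = T , (begin
    length (copyVerts cs) + uncovered T                        ≡⟨ sym (length-++ (copyVerts cs)) ⟩
    length (copyVerts cs ++ filter (¬? ∘ covered? T) (allFin n)) ≤⟨ length-⊑ (Unique⇒⊑ all-unique (λ {v} _ → ∈-allFin v)) ⟩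
    length (allFin n)                                          ≡⟨ length-allFin n ⟩
    n                                                          ∎)
    where
    open ≤-Reasoning
    separate : ∀ {X : Set} {f : X → List (Fin n)} (cs : List X) → Unique (concat (map f cs)) →
      ∀ s t → s Fin.< t → ∀ {v} → v ∈ f (lookup cs s) → v ∈ f (lookup cs t) → ⊥
    separate {f = f} (c ∷ cs) u zero (suc t) _ v∈ v∈′ = All.lookup (heads (f c) u v∈)
      (∈-concat⁺′ v∈′ (∈-map⁺ f (∈-lookup {xs = cs} t))) refl
      where
      heads : ∀ xs {ys : List (Fin n)} {v} → Unique (xs ++ ys) → v ∈ xs → All (v ≢_) ys
      heads (x ∷ xs) (h ∷ _) (here refl) = Allₚ.++⁻ʳ xs h
      heads (x ∷ xs) (_ ∷ u) (there v∈)  = heads xs u v∈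
    separate {f = f} (c ∷ cs) u (suc s) (suc t) (s≤s s<t) =
      separate cs (Unique-⊑ (⊑-++ˡ (f c) (concat (map f cs))) u) s t s<t
    apart : ∀ s t → s ≢ t → ∀ i j → embed (lookup cs s) i ≢ embed (lookup cs t) j
    apart s t s≢t i j eq with Fin.<-cmp s t
    ... | tri< lt _ _ = separate {f = row} cs unique s t lt (∈-map-allFin (embed (lookup cs s)) i)
      (subst (_∈ row (lookup cs t)) (sym eq) (∈-map-allFin (embed (lookup cs t)) j))
    ... | tri≈ _ s≡t _ = s≢t s≡t
    ... | tri> _ _ gt = separate {f = row} cs unique t s gt (∈-map-allFin (embed (lookup cs t)) j)
      (subst (_∈ row (lookup cs s)) eq (∈-map-allFin (embed (lookup cs s)) i))
    T : Tiling H G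
    T = record { size = length cs ; copy = lookup cs ; disjoint = apart }
    in-copy : ∀ {v} → v ∈ copyVerts cs → Covered T v
    in-copy v∈ with ∈-concat⁻′ (map row cs) v∈
    ... | xs , v∈xs , xs∈ with ∈-map⁻ row xs∈
    ... | c , c∈ , refl with ∈-map⁻ (embed c) v∈xs
    ... | i , _ , refl = Any.index c∈ , i , cong (λ c → embed c i) (sym (Anyₚ.lookup-index c∈))
    all-unique : Unique (copyVerts cs ++ filter (¬? ∘ covered? T) (allFin n))
    all-unique = Uniqueₚ.++⁺ unique (Uniqueₚ.filter⁺ (¬? ∘ covered? T) (Uniqueₚ.allFin⁺ n))
      (λ (v∈ , v∈′) → proj₂ (∈-filter⁻ (¬? ∘ covered? T) {xs = allFin n} v∈′) (in-copy v∈))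

minDegree≤degree : ∀ {n} (G : Graph n) v → minDegree G ≤ degree G v
minDegree≤degree {n} G v = All.lookup (min≤xs n (map (degree G) (allFin n))) (∈-map-allFin (degree G) v)

unjoined-count : ∀ {n} (G : Graph n) v → degree G v + ∑ (allFin n) (unjoined G v) ≡ n
unjoined-count {n} G v = trans (cong (_+ ∑ (allFin n) (unjoined G v)) (length-filter-𝟙 (Graph.adj? G v) (allFin n)))
  (trans (joined+unjoined G v (allFin n)) (length-allFin n))

regroup-threshold : ∀ n T e ε X → n ℚ.* T ℚ.* e ℚ.+ n ℚ.* T ℚ.* (ε ℚ.* e) ≡
  n ℚ.* ((1ℚ ℚ.- X) ℚ.+ ε) ℚ.* (T ℚ.* e) ℚ.+ n ℚ.* (T ℚ.* X) ℚ.* e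
regroup-threshold = solve 5 (λ n T e ε X → n :* T :* e :+ n :* T :* (ε :* e) :=
  n :* ((con 1ℚ :- X) :+ ε) :* (T :* e) :+ n :* (T :* X) :* e) refl
  where open +-*-Solver

module _ {h} (H : OrderedGraph h) (X : ℚ) (T M : ℕ) (2≤T : 2 ≤ T) (TX≡M : ι T ℚ.* X ≡ ι M)
  (almost : ∀ e → 1 ≤ e → AlmostTiling H e M T) (η : ℝ) (ε : ℚ) (ε>0 : 0ℚ ℚ.< ε)
  (N : ℕ) (ε≤η : ∀ i → N ≤ i → ε ℚ.≤ seq η i) where

  private
    e = ℚ.↧ₙ ε

  -- `_≤ᴿ_` gives an inequality of rationals only up to a positive error. The error 1 is good enough
  -- and turns δ into `suc δ`; multiplying by T e clears all denominators.
  degree-bound : ∀ n δ → n ·ᴿ (fromℚ (1ℚ ℚ.- X) +ᴿ η) ≤ᴿ fromℕ δ → n * T * e + n * T ≤ suc δ * T * e + n * M * e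
  degree-bound n δ large = ι-cancel (begin
    ι (n * T * e + n * T)
      ≡⟨ trans (ι-+ (n * T * e) (n * T)) (cong₂ ℚ._+_ (trans (ι-* (n * T) e) (cong (ℚ._* ι e) (ι-* n T))) (trans (ι-* n T) (sym (ℚ.*-identityʳ _)))) ⟩
    ι n ℚ.* ι T ℚ.* ι e ℚ.+ ι n ℚ.* ι T ℚ.* 1ℚ
      ≤⟨ ℚ.+-monoʳ-≤ (ι n ℚ.* ι T ℚ.* ι e) (ℚ.*-monoˡ-≤-nonNeg (ι n ℚ.* ι T) {{subst ℚ.NonNegative (ι-* n T) (ι-nonNeg (n * T))}} (1≤ε*↧ε ε ε>0)) ⟩
    ι n ℚ.* ι T ℚ.* ι e ℚ.+ ι n ℚ.* ι T ℚ.* (ε ℚ.* ι e)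
      ≡⟨ regroup-threshold (ι n) (ι T) (ι e) ε X ⟩
    ι n ℚ.* ((1ℚ ℚ.- X) ℚ.+ ε) ℚ.* (ι T ℚ.* ι e) ℚ.+ ι n ℚ.* (ι T ℚ.* X) ℚ.* ι e
      ≤⟨ ℚ.+-mono-≤ (ℚ.*-monoʳ-≤-nonNeg (ι T ℚ.* ι e) {{subst ℚ.NonNegative (ι-* T e) (ι-nonNeg (T * e))}} bound)
           (ℚ.≤-reflexive (cong (λ m → ι n ℚ.* m ℚ.* ι e) TX≡M)) ⟩
    ι (suc δ) ℚ.* (ι T ℚ.* ι e) ℚ.+ ι n ℚ.* ι M ℚ.* ι e
      ≡⟨ sym (trans (ι-+ (suc δ * T * e) (n * M * e)) (cong₂ ℚ._+_
           (trans (ι-* (suc δ * T) e) (trans (cong (ℚ._* ι e) (ι-* (suc δ) T)) (ℚ.*-assoc (ι (suc δ)) (ι T) (ι e))))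
           (trans (ι-* (n * M) e) (cong (ℚ._* ι e) (ι-* n M))))) ⟩
    ι (suc δ * T * e + n * M * e) ∎)
    where
    open ℚ.≤-Reasoning
    N′ = proj₁ (large 1ℚ (ℚ.positive⁻¹ 1ℚ))
    i = N ⊔ N′
    bound : ι n ℚ.* ((1ℚ ℚ.- X) ℚ.+ ε) ℚ.≤ ι (suc δ)
    bound = begin
      ι n ℚ.* ((1ℚ ℚ.- X) ℚ.+ ε)                     ≤⟨ ℚ.*-monoˡ-≤-nonNeg (ι n) {{ι-nonNeg n}} (ℚ.+-monoʳ-≤ (1ℚ ℚ.- X) (ε≤η i (m≤m⊔n N N′))) ⟩
      ι n ℚ.* ((1ℚ ℚ.- X) ℚ.+ seq η i)               ≡⟨ sym (seq-· n (fromℚ (1ℚ ℚ.- X) +ᴿ η) i) ⟩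
      seq (n ·ᴿ (fromℚ (1ℚ ℚ.- X) +ᴿ η)) i           ≤⟨ proj₂ (large 1ℚ (ℚ.positive⁻¹ 1ℚ)) i (m≤n⊔m N N′) ⟩
      ι δ ℚ.+ 1ℚ                                     ≡⟨ trans (ℚ.+-comm (ι δ) 1ℚ) (sym (ι-+ 1 δ)) ⟩
      ι (suc δ)                                      ∎

  -- As T ≥ 2, the margin n T contains 2n: one n absorbs the error T e that comes from `suc`, the
  -- other is the n in the conclusion.
  few-nonneighbours : ∀ {n} (G : Graph n) → T * e ≤ n → n * T * e + n * T ≤ suc (minDegree G) * T * e + n * M * e →
    ∀ v → e * T * ∑ (allFin n) (unjoined G v) + n ≤ e * M * n
  few-nonneighbours {n} G n-large h v = ≤-cert _ _ 0
    (+-mono-≤ h (+-mono-≤ (*-monoʳ-≤ (T * e) (minDegree≤degree G v)) (+-mono-≤ (*-monoʳ-≤ n 2≤T) (+-mono-≤ n-large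
      (*-monoˡ-≤ (T * e) (≤-reflexive (unjoined-count G v)))))))
    (((∀ e T M n δ d w → e * T * w + n + (suc δ * T * e + n * M * e + (T * e * d + (n * T + (n + n * (T * e))))) + 0
       ≡ e * M * n + (n * T * e + n * T + (T * e * δ + (n * 2 + (T * e + (d + w) * (T * e)))))) ∋ solve-∀)
      e T M n (minDegree G) (degree G v) (∑ (allFin n) (unjoined G v)))

  uncovered-bound : ∀ n u → e * u ≤ n → fromℕ u ≤ᴿ n ·ᴿ η
  uncovered-bound n u small ε′ ε′>0 = N , λ i i≥N → begin
    ι u                         ≡⟨ sym (ℚ.*-identityʳ (ι u)) ⟩
    ι u ℚ.* 1ℚ                  ≤⟨ ℚ.*-monoˡ-≤-nonNeg (ι u) {{ι-nonNeg u}} (1≤ε*↧ε ε ε>0) ⟩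
    ι u ℚ.* (ε ℚ.* ι e)         ≡⟨ solve 3 (λ u ε e → u :* (ε :* e) := e :* u :* ε) refl (ι u) ε (ι e) ⟩
    ι e ℚ.* ι u ℚ.* ε           ≡⟨ cong (ℚ._* ε) (sym (ι-* e u)) ⟩
    ι (e * u) ℚ.* ε             ≤⟨ ℚ.*-monoʳ-≤-nonNeg ε {{ℚ.nonNegative (ℚ.<⇒≤ ε>0)}} (ι-mono small) ⟩
    ι n ℚ.* ε                   ≤⟨ ℚ.*-monoˡ-≤-nonNeg (ι n) {{ι-nonNeg n}} (ε≤η i i≥N) ⟩
    ι n ℚ.* seq η i             ≡⟨ sym (seq-· n η i) ⟩
    seq (n ·ᴿ η) i              ≡⟨ sym (ℚ.+-identityʳ _) ⟩
    seq (n ·ᴿ η) i ℚ.+ 0ℚ       ≤⟨ ℚ.+-monoʳ-≤ (seq (n ·ᴿ η) i) (ℚ.<⇒≤ ε′>0) ⟩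
    seq (n ·ᴿ η) i ℚ.+ ε′       ∎
    where
    open ℚ.≤-Reasoning
    open +-*-Solver

  tiling-of-almost-all : ∃ λ (n₀ : ℕ) → ∀ (n : ℕ) → n₀ ≤ n → ∀ (G : OrderedGraph n) →
    n ·ᴿ (fromℚ (1ℚ ℚ.- X) +ᴿ η) ≤ᴿ fromℕ (minDegree G) → ∃ λ (T : Tiling H G) → fromℕ (uncovered T) ≤ᴿ n ·ᴿ η
  tiling-of-almost-all = T * e + proj₁ (almost e (s≤s z≤n)) , λ n n₀≤n G large →
    finish G (proj₂ (almost e (s≤s z≤n)) n (≤-trans (m≤n+m _ (T * e)) n₀≤n) G
      (few-nonneighbours G (≤-trans (m≤m+n (T * e) _) n₀≤n) (degree-bound n (minDegree G) large)))
    where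
    finish : ∀ {n} (G : OrderedGraph n) →
      (∃ λ cs → Copies.copyVerts H G cs ⊑ allFin n × e * n ≤ e * length (Copies.copyVerts H G cs) + n) →
      ∃ λ (T : Tiling H G) → fromℕ (uncovered T) ≤ᴿ n ·ᴿ η
    finish {n} G (cs , cs⊑ , le) = proj₁ tiled , uncovered-bound n (uncovered (proj₁ tiled))
      (≤-cert _ _ 0 (+-mono-≤ le (*-monoʳ-≤ e (proj₂ tiled)))
        (((∀ e u n x → e * u + (e * x + n + e * n) + 0 ≡ n + (e * n + e * (x + u))) ∋ solve-∀)
          e (uncovered (proj₁ tiled)) n (length (Copies.copyVerts H G cs))))
      where
      tiled = list-tiling H G cs (Unique-⊑ cs⊑ (Uniqueₚ.allFin⁺ n))

theorem4p3 : ∀ {h k b : ℕ} (H : OrderedGraph h) (B : CompletePartite k b) →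
    IsBottlegraph B H →
    ∀ (η : ℝ) → fromℚ 0ℚ <ᴿ η →
    ∃ λ (n₀ : ℕ) → ∀ (n : ℕ) → n₀ ≤ n → ∀ (G : OrderedGraph n) →
    n ·ᴿ (fromℚ (1ℚ - 1/χcr (CompletePartite.graph B) (CompletePartite.edge B)) +ᴿ η)
    ≤ᴿ fromℕ (minDegree G) →
    ∃ λ (T : Tiling H G) → fromℕ (uncovered T) ≤ᴿ n ·ᴿ η
theorem4p3 {k = k} {b} H B bottle η (ε , ε>0 , N , ε≤η) = tiling-of-almost-all H
  (1/χcr (CompletePartite.graph B) (CompletePartite.edge B)) ((k ∸ 1) * b)
  (b ∸ σ (CompletePartite.graph B) (CompletePartite.edge B)) 2≤T
  (trans (cong (λ c → ι ((c ∸ 1) * b) ℚ.* 1/χcr (CompletePartite.graph B) (CompletePartite.edge B)) (sym (χ≡k B)))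
    (1/χcr-cancel (CompletePartite.graph B) (CompletePartite.edge B)))
  (almost-tiling H B bottle) η ε ε>0 N (λ i i≥N → subst (ℚ._≤ seq η i) (ℚ.+-identityˡ ε) (ε≤η i i≥N))
  where
  2≤b : 2 ≤ b
  2≤b = ≤-trans (CompletePartite.2≤k B) (Fin.injective⇒≤ {f = representative B} (λ {i} {j} eq →
    trans (sym (proj₂ (CompletePartite.nonEmpty B i))) (trans (cong (CompletePartite.part B) eq) (proj₂ (CompletePartite.nonEmpty B j)))))
  2≤T : 2 ≤ (k ∸ 1) * b
  2≤T = *-mono-≤ (∸-monoˡ-≤ 1 (CompletePartite.2≤k B)) 2≤b
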